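{- Let $G$ be a claw-free graph and let $G^T$ be a Tutte-closure of $G$. Then $G^T$ is the line graph of a hypergraph of rank at most $3$.
   Context: All graphs are finite, without loops or multiple edges. A graph is claw-free if it contains no induced $K_{1,3}$. For a vertex $x$ of a graph $G$, the local completion $G^*_x$ is the graph obtained from $G$ by adding all possible edges among the vertices of $N_G(x)$. A path $P$ in $G$ is a Tutte path if every component of $G-V(P)$ has at most $\min\{3,|V(P)|-1\}$ neighbours on $P$. An $(a,b)$-path is a path from $a$ to $b$; it is maximal if there is no $(a,b)$-path $P'$ whose vertex set properly contains $V(P)$. A graph is Tutte-connected if for every pair of its vertices $a,b$ there is a maximal $(a,b)$-path which is a Tutte path. A Tutte-closure $G^T$ of $G$ is defined as follows: if $G$ is Tutte-connected, $G^T$ is the complete graph on $V(G)$; otherwise, one repeatedly performs local completion at a vertex for which the resulting graph is still not Tutte-connected, as long as such a vertex exists, and $G^T$ is a resulting graph (when no such vertex exists). A hypergraph is a collection of subsets (edges, repetitions allowed) of a ground set; its rank is the maximum size of an edge. The line graph of a hypergraph $H$ has vertex set $E(H)$, two vertices being adjacent iff the corresponding edges have a common element. -}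

module Defs where

open import Data.Nat using (ℕ; _≤_; _∸_; _⊓_)
open import Data.Bool using (Bool; true; false; _∧_; _∨_; not)
open import Data.Bool.Properties using (∧-comm)
open import Data.Fin using (Fin; _≟_)
import Data.Fin.Subset as S
open import Data.List using (List; []; _∷_; length)
open import Data.List.Membership.Propositional using (_∈_; _∉_)
open import Data.List.Relation.Unary.Unique.Propositional using (Unique)
open import Data.Product using (Σ; ∃; ∃-syntax; _×_; _,_)
open import Relation.Nullary using (¬_; yes; no)
open import Relation.Nullary.Decidable using (⌊_⌋)
open import Relation.Binary.PropositionalEquality using (_≡_; _≢_; refl; sym; cong)
open import Function.Bundles using (_⇔_)

record Graph (n : ℕ) : Set where
  field
    adj    : Fin n → Fin n → Bool
    symm   : ∀ u v → adj u v ≡ adj v u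
    irrefl : ∀ v → adj v v ≡ false
open Graph public

module _ {n : ℕ} where

  Adj : Graph n → Fin n → Fin n → Set
  Adj G u v = adj G u v ≡ true

  neq : Fin n → Fin n → Bool
  neq u v = not ⌊ u ≟ v ⌋

  neq-sym : ∀ u v → neq u v ≡ neq v u
  neq-sym u v with u ≟ v | v ≟ u
  ... | yes _ | yes _ = refl
  ... | no _  | no _  = refl
  ... | yes p | no q  = Data.Empty.⊥-elim (q (sym p)) where import Data.Empty
  ... | no p  | yes q = Data.Empty.⊥-elim (p (sym q)) where import Data.Empty

  neq-refl : ∀ v → neq v v ≡ false
  neq-refl v with v ≟ v
  ... | yes _ = refl
  ... | no p  = Data.Empty.⊥-elim (p refl) where import Data.Empty

  Complete : Graph n
  Complete = record { adj = neq ; symm = neq-sym ; irrefl = neq-refl }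

  ClawFree : Graph n → Set
  ClawFree G = ¬ (Σ (Fin n) λ x → Σ (Fin n) λ a → Σ (Fin n) λ b → Σ (Fin n) λ c →
      Adj G x a × Adj G x b × Adj G x c
    × a ≢ b × a ≢ c × b ≢ c
    × adj G a b ≡ false × adj G a c ≡ false × adj G b c ≡ false)

  localCompletion : Graph n → Fin n → Graph n
  localCompletion G x = record
    { adj = λ u v → adj G u v ∨ (neq u v ∧ (adj G x u ∧ adj G x v))
    ; symm = λ u v → s u v
    ; irrefl = λ v → i v }
    where
      s : ∀ u v → (adj G u v ∨ (neq u v ∧ (adj G x u ∧ adj G x v)))
                ≡ (adj G v u ∨ (neq v u ∧ (adj G x v ∧ adj G x u)))
      s u v rewrite symm G u v | neq-sym u v | ∧-comm (adj G x u) (adj G x v) = refl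
      i : ∀ v → (adj G v v ∨ (neq v v ∧ (adj G x v ∧ adj G x v))) ≡ false
      i v rewrite irrefl G v | neq-refl v = refl

  data Walk (G : Graph n) : Fin n → Fin n → List (Fin n) → Set where
    single : ∀ {a} → Walk G a a (a ∷ [])
    cons   : ∀ {a b c p} → Adj G a b → Walk G b c p → Walk G a c (a ∷ p)

  IsPath : Graph n → Fin n → Fin n → List (Fin n) → Set
  IsPath G a b P = Walk G a b P × Unique P

  IsMaximalPath : Graph n → Fin n → Fin n → List (Fin n) → Set
  IsMaximalPath G a b P = IsPath G a b P ×
    ¬ (Σ (List (Fin n)) λ P' → IsPath G a b P'
         × (∀ v → v ∈ P → v ∈ P') × (Σ (Fin n) λ w → w ∈ P' × w ∉ P))

  data Reach (G : Graph n) (P : List (Fin n)) : Fin n → Fin n → Set where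
    here : ∀ {u} → u ∉ P → Reach G P u u
    step : ∀ {u v w} → Reach G P u v → Adj G v w → w ∉ P → Reach G P u w

  -- Tutte path: every component of G - V(P) (the component of each vertex v ∉ P)
  -- has at most min{3, |V(P)| - 1} neighbours on P
  IsTuttePath : Graph n → List (Fin n) → Set
  IsTuttePath G P = ∀ v → v ∉ P →
    Σ (List (Fin n)) λ L → length L ≤ (3 ⊓ (length P ∸ 1))
      × (∀ p → p ∈ P → (Σ (Fin n) λ w → Reach G P v w × Adj G p w) → p ∈ L)

  TutteConnected : Graph n → Set
  TutteConnected G = ∀ a b → a ≢ b →
    Σ (List (Fin n)) λ P → IsMaximalPath G a b P × IsTuttePath G P

  -- local completion at x actually changes G (N_G(x) not a clique)
  NonSimplicial : Graph n → Fin n → Set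
  NonSimplicial G x = Σ (Fin n) λ u → Σ (Fin n) λ v →
    u ≢ v × Adj G x u × Adj G x v × adj G u v ≡ false

  SameGraph : Graph n → Graph n → Set
  SameGraph G H = ∀ u v → adj G u v ≡ adj H u v

  data IsTutteClosure : Graph n → Graph n → Set where
    tc-conn : ∀ {G H} → TutteConnected G → SameGraph H Complete → IsTutteClosure G H
    tc-step : ∀ {G H} → ¬ TutteConnected G → (x : Fin n) → NonSimplicial G x
            → ¬ TutteConnected (localCompletion G x)
            → IsTutteClosure (localCompletion G x) H → IsTutteClosure G H
    tc-stop : ∀ {G H} → ¬ TutteConnected G
            → (∀ x → NonSimplicial G x → TutteConnected (localCompletion G x))
            → SameGraph H G → IsTutteClosure G H

  -- G is (isomorphic to) the line graph of a hypergraph of rank ≤ 3: the edges of the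
  -- hypergraph are indexed by V(G) (repetitions allowed), ground set Fin m
  IsLineGraphOfRank≤3Hypergraph : Graph n → Set
  IsLineGraphOfRank≤3Hypergraph G =
    Σ ℕ λ m → Σ (Fin n → S.Subset m) λ e →
      (∀ v → S.∣ e v ∣ ≤ 3)
      × (∀ u v → u ≢ v → (Adj G u v ⇔ (Σ (Fin m) λ z → z S.∈ e u × z S.∈ e v)))

{-# OPTIONS --safe #-}
module Submission where

-- Suppose G is claw-free and not Tutte-connected, but every local completion that changes it is.  Fix a
-- pair a, b without a maximal Tutte (a,b)-path, and for a non-simplicial x take a maximal Tutte
-- (a,b)-path P of the completion at x.  No (a,b)-path of G has the vertex set of P, as it would again be
-- maximal and Tutte; and P contains N[x].  Replace as many new edges of P as possible: since N(x) has no
-- three independent vertices, what remains are two segments with ends in N(x), and N(x) splits into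
-- the set S of vertices joined to both ends of one segment and the set T of those joined to both ends
-- of the other.  Rerouting P through an S–T edge succeeds unless (for x ≠ a, b) the T-end of the edge is
-- a or b, or (for x = a) all S–T edges share one vertex.  Hence a and b lie in at most three maximal
-- cliques each, and every edge at a or b lies in a maximal clique that is determined by one of its
-- edges.  For the other vertices x the same bound holds after discarding the cliques that meet both
-- S and T and contain a or b, and these are not needed to cover the edges of G.

-- For `x` other than `a` and `b` the path is closed to a cycle by an extra vertex adjacent to
-- exactly `a` and `b`. The two outer pieces of the path then form one segment `D` through the extra
-- vertex, and the middle piece is the other segment `B`. The extra vertex may lie in claws, so
-- claw-freeness applies only away from it. Hence the exception for `a` and `b`: a `T`-vertex `t` is
-- moved from `D` to `B` by excluding a claw at `t` whose leaves are `x` and the two neighbours of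
-- `t` on `D`, and this works unless one of these is the extra vertex. For `x = a` no extra vertex
-- is needed, but `D` ends in `b`, which may lie outside N(x) or in both `S` and `T` and needs
-- separate treatment. Discarding cliques is safe because only cliques through `a` or `b` are
-- discarded, while the clique that takes over a pair of vertices avoids both. The failure of
-- Tutte-connectedness does not constructively yield a pair `a`, `b`. The property finally required
-- of the pair is decidable, so a search over all pairs finds one.

open import Defs
open import Data.Bool.Base using (true; false)
import Data.Bool.Properties as Bool
open import Data.Empty using (⊥; ⊥-elim)
open import Data.Fin.Base using (Fin; zero; suc; combine; remQuot)
open import Data.Fin.Patterns
open import Data.Fin.Properties using (_≟_; all?; any?; ¬∀⟶∃¬; remQuot-combine; combine-remQuot)
open import Data.Fin.Subset using (Subset; inside; outside; _⊆_; _∪_; ⁅_⁆; ∣_∣) renaming (_∈_ to _∈ˢ_; _∉_ to _∉ˢ_)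
open import Data.Fin.Subset.Properties using (⊆-antisym; anySubset?; x∈⁅x⁆; x∈⁅y⁆⇒x≡y; x∈p∪q⁺; x∈p∪q⁻; p⊆q⇒∣p∣≤∣q∣; ∣⁅x⁆∣≡1) renaming (_∈?_ to _∈ˢ?_)
open import Data.List.Base using (List; []; _∷_; _++_; map; length; allFin)
import Data.List.Membership.DecPropositional as DecMembership
open import Data.List.Membership.Propositional using (_∈_; _∉_; find; lose)
open import Data.List.Membership.Propositional.Properties using (∈-++⁺ˡ; ∈-++⁺ʳ; ∈-++⁻; ∈-map⁺; ∈-map⁻; ∈-allFin)
import Data.List.Properties as List
import Data.List.Relation.Binary.Permutation.Setoid.Properties as PermS
open import Data.List.Relation.Binary.Permutation.Propositional hiding (trans)
open import Data.List.Relation.Binary.Permutation.Propositional.Properties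
import Data.List.Relation.Unary.All as All
open import Data.List.Relation.Unary.All.Properties using (¬Any⇒All¬)
open import Data.List.Relation.Unary.AllPairs using ([]; _∷_)
open import Data.List.Relation.Unary.Any as Any using (Any; here; there)
open import Data.List.Relation.Unary.Unique.Propositional using (Unique)
import Data.List.Relation.Unary.Unique.Propositional.Properties as Unique
open import Data.Maybe.Base using (Maybe; just; nothing; fromMaybe)
import Data.Maybe.Properties as Maybe
open import Data.Nat.Base using (ℕ; zero; suc; _+_; _^_; _≤_; _⊓_; _∸_; z≤n; s≤s)
import Data.Nat.Properties as ℕ
open import Data.Product using (Σ; ∃; _×_; _,_; proj₁; proj₂)
open import Data.Sum using (_⊎_; inj₁; inj₂; [_,_]′)
open import Data.Unit.Base using (⊤; tt)
open import Data.Vec.Base as Vec using (Vec; []; _∷_; here; lookup; replicate; tabulate)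
open import Data.Vec.Properties using (lookup⇒[]=; []=⇒lookup; lookup∘tabulate)
open import Function.Bundles using (mk⇔; Equivalence)
open import Relation.Binary.PropositionalEquality using (_≡_; _≢_; refl; sym; trans; cong; subst; setoid)
open import Relation.Nullary using (¬_; yes; no; Dec; does)
open import Relation.Nullary.Decidable using (False; toWitnessFalse; _⊎-dec_; _×-dec_; _→-dec_; ¬?; decidable-stable; dec-true)

-- Routes

infixl 6 _⊕_
_⊕_ : ∀ {k} → Vec ℕ k → Vec ℕ k → Vec ℕ k
[]      ⊕ []      = []
(m ∷ c) ⊕ (n ∷ d) = m + n ∷ c ⊕ d

unit : ∀ {k} → Fin k → Vec ℕ k
unit {suc k} zero    = 1 ∷ replicate k 0
unit         (suc i) = 0 ∷ unit i

ones : ∀ {k} → Vec ℕ k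
ones = replicate _ 1

module _ {V : Set} where

  Unique-resp-↭ : ∀ {l m : List V} → l ↭ m → Unique l → Unique m
  Unique-resp-↭ p = PermS.Unique-resp-↭ (setoid V) (↭⇒↭ₛ p)

  Unique-++⁻ : ∀ (l : List V) {m} → Unique (l ++ m) → Unique l × Unique m
  Unique-++⁻ []      U       = [] , U
  Unique-++⁻ (x ∷ l) (p ∷ U) with Unique-++⁻ l U
  ... | Ul , Um = All.tabulate (λ v∈ → All.lookup p (∈-++⁺ˡ v∈)) ∷ Ul , Um

  Unique-++-apart : ∀ (l : List V) {m u v} → Unique (l ++ m) → u ∈ l → v ∈ m → u ≢ v
  Unique-++-apart (x ∷ l) (p ∷ U) (here refl) v∈ = All.lookup p (∈-++⁺ʳ l v∈)
  Unique-++-apart (x ∷ l) (p ∷ U) (there u∈)  v∈ = Unique-++-apart l U u∈ v∈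

  pile : ∀ {k} → Vec (List V) k → Vec ℕ k → List V
  pile []      []          = []
  pile (l ∷ Γ) (zero  ∷ c) = pile Γ c
  pile (l ∷ Γ) (suc m ∷ c) = l ++ pile (l ∷ Γ) (m ∷ c)

  pile-zero : ∀ {k} (Γ : Vec (List V) k) → pile Γ (replicate k 0) ≡ []
  pile-zero []      = refl
  pile-zero (l ∷ Γ) = pile-zero Γ

  pile-unit : ∀ {k} (Γ : Vec (List V) k) i → lookup Γ i ≡ pile Γ (unit i)
  pile-unit (l ∷ Γ) zero    rewrite pile-zero Γ = sym (List.++-identityʳ l)
  pile-unit (l ∷ Γ) (suc i) = pile-unit Γ i

  pile-⊕ : ∀ {k} (Γ : Vec (List V) k) c d → pile Γ c ++ pile Γ d ↭ pile Γ (c ⊕ d)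
  pile-⊕ []      []          []          = ↭-refl
  pile-⊕ (l ∷ Γ) (zero  ∷ c) (zero  ∷ d) = pile-⊕ Γ c d
  pile-⊕ (l ∷ Γ) (zero  ∷ c) (suc n ∷ d) =
    ↭-trans (shifts (pile Γ c) l) (++⁺ˡ l (pile-⊕ (l ∷ Γ) (zero ∷ c) (n ∷ d)))
  pile-⊕ (l ∷ Γ) (suc m ∷ c) (n ∷ d)     =
    ↭-trans (↭-reflexive (List.++-assoc l (pile (l ∷ Γ) (m ∷ c)) _))
            (++⁺ˡ l (pile-⊕ (l ∷ Γ) (m ∷ c) (n ∷ d)))

  ∈-pile : ∀ {k} (Γ : Vec (List V) k) i {v} → v ∈ lookup Γ i → v ∈ pile Γ ones
  ∈-pile (l ∷ Γ) zero    v∈ = ∈-++⁺ˡ v∈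
  ∈-pile (l ∷ Γ) (suc i) v∈ = ∈-++⁺ʳ l (∈-pile Γ i v∈)

  pile-apart : ∀ {k} (Γ : Vec (List V) k) → Unique (pile Γ ones) → ∀ i j → i ≢ j →
               ∀ {u v} → u ∈ lookup Γ i → v ∈ lookup Γ j → u ≢ v
  pile-apart (l ∷ Γ) U zero    zero    i≢j u∈ v∈ = ⊥-elim (i≢j refl)
  pile-apart (l ∷ Γ) U zero    (suc j) i≢j u∈ v∈ = Unique-++-apart l U u∈ (∈-pile Γ j v∈)
  pile-apart (l ∷ Γ) U (suc i) zero    i≢j u∈ v∈ = λ eq → Unique-++-apart l U v∈ (∈-pile Γ i u∈) (sym eq)
  pile-apart (l ∷ Γ) U (suc i) (suc j) i≢j u∈ v∈ =
    pile-apart Γ (proj₂ (Unique-++⁻ l U)) i j (λ eq → i≢j (cong suc eq)) u∈ v∈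

  -- A record keeps `Γ` inferable: `pile Γ ones` evaluates to a concatenation from which the pieces
  -- cannot be read off.
  record Tiles {k} (Γ : Vec (List V) k) (L : List V) : Set where
    constructor tiles
    field layout : L ↭ pile Γ ones
  open Tiles public

  tiles-apart : ∀ {k} (Γ : Vec (List V) k) {L} → Unique L → Tiles Γ L →
                ∀ i j {_ : False (i ≟ j)} {u v} → u ∈ lookup Γ i → v ∈ lookup Γ j → u ≢ v
  tiles-apart Γ U τ i j {i≢j} = pile-apart Γ (Unique-resp-↭ (layout τ) U) i j (toWitnessFalse i≢j)

  tiles-unique : ∀ {k} (Γ : Vec (List V) k) {L} → Unique L → Tiles Γ L → ∀ i → Unique (lookup Γ i)
  tiles-unique (l ∷ Γ) U τ zero    = proj₁ (Unique-++⁻ l (Unique-resp-↭ (layout τ) U))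
  tiles-unique (l ∷ Γ) U τ (suc i) =
    tiles-unique Γ (proj₂ (Unique-++⁻ l (Unique-resp-↭ (layout τ) U))) (tiles ↭-refl) i

  tiles-∈ : ∀ {k} (Γ : Vec (List V) k) {L} → Tiles Γ L → ∀ i {v} → v ∈ lookup Γ i → v ∈ L
  tiles-∈ Γ τ i v∈ = ∈-resp-↭ (↭-sym (layout τ)) (∈-pile Γ i v∈)

  tiles-swap : ∀ {k} {l m} {Γ : Vec (List V) k} {L} → Tiles (l ∷ m ∷ Γ) L → Tiles (m ∷ l ∷ Γ) L
  tiles-swap {l = l} {m} (tiles τ) = tiles (↭-trans τ (shifts l m))

  tiles-third : ∀ {k} {l m n} {Γ : Vec (List V) k} {L} → Tiles (l ∷ m ∷ n ∷ Γ) L → Tiles (n ∷ l ∷ m ∷ Γ) L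
  tiles-third {l = l} {m} {n} (tiles τ) = tiles (↭-trans τ (↭-trans (++⁺ˡ l (shifts m n)) (shifts l n)))

  pile-++ : ∀ {j k} (Δ : Vec (List V) j) (Γ : Vec (List V) k) →
            pile Δ ones ++ pile Γ ones ≡ pile (Δ Vec.++ Γ) ones
  pile-++ []      Γ = refl
  pile-++ (l ∷ Δ) Γ = trans (List.++-assoc l _ _) (cong (l ++_) (pile-++ Δ Γ))

  tiles-split : ∀ {j k} {l} {Δ : Vec (List V) j} {Γ : Vec (List V) k} {L} →
                Tiles Δ l → Tiles (l ∷ Γ) L → Tiles (Δ Vec.++ Γ) L
  tiles-split {Δ = Δ} {Γ} (tiles σ) (tiles τ) =
    tiles (↭-trans τ (↭-trans (++⁺ʳ _ σ) (↭-reflexive (pile-++ Δ Γ))))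

module Routes {V : Set} (_~_ : V → V → Set) (~-sym : ∀ {u v} → u ~ v → v ~ u) where

  data Trail : V → V → List V → Set where
    stop : ∀ {u} → Trail u u (u ∷ [])
    go   : ∀ {u v w l} → u ~ v → Trail v w l → Trail u w (u ∷ l)

  -- Only the multiset of vertices is indexed, so that reversing a route does not change its type
  -- except for the two ends.
  record Route (u v : V) (l : List V) : Set where
    constructor route
    field
      {verts} : List V
      trail   : Trail u v verts
      perm    : verts ↭ l
  open Route public

  trail-join : ∀ {u v w z l m} → Trail u v l → v ~ w → Trail w z m → Trail u z (l ++ m)
  trail-join stop     e t = go e t
  trail-join (go f s) e t = go f (trail-join s e t)

  join : ∀ {u v w z l m} → Route u v l → v ~ w → Route w z m → Route u z (l ++ m)
  join (route s p) e (route t q) = route (trail-join s e t) (++⁺ p q)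

  point : ∀ u → Route u u (u ∷ [])
  point u = route stop ↭-refl

  resp : ∀ {u v l m} → l ↭ m → Route u v l → Route u v m
  resp σ (route t p) = route t (↭-trans p σ)

  trail-rev : ∀ {u v l} → Trail u v l → Route v u l
  trail-rev stop             = point _
  trail-rev {l = u ∷ l} (go e t) = resp (↭-sym (∷↭∷ʳ u l)) (join (trail-rev t) (~-sym e) (point u))

  rev : ∀ {u v l} → Route u v l → Route v u l
  rev (route t p) = resp p (trail-rev t)

  trail-first∈ : ∀ {u v l} → Trail u v l → u ∈ l
  trail-first∈ stop     = here refl
  trail-first∈ (go _ _) = here refl

  first∈ : ∀ {u v l} → Route u v l → u ∈ l
  first∈ (route t p) = ∈-resp-↭ p (trail-first∈ t)

  last∈ : ∀ {u v l} → Route u v l → v ∈ l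
  last∈ r = first∈ (rev r)

  record Inner (u v y : V) (l : List V) : Set where
    constructor inner
    field
      {p q}   : V
      {l₁ l₂} : List V
      before  : Route u p l₁
      p~y     : p ~ y
      y~q     : y ~ q
      after   : Route q v l₂
      parts   : Tiles (l₁ ∷ (y ∷ []) ∷ l₂ ∷ []) l

  rev-inner : ∀ {u v y l} → Inner u v y l → Inner v u y l
  rev-inner {y = y} (inner {l₁ = l₁} {l₂} s e f t (tiles σ)) =
    inner (rev t) (~-sym f) (~-sym e) (rev s) (tiles (↭-trans σ flip))
    where
    flip : l₁ ++ y ∷ l₂ ++ [] ↭ l₂ ++ y ∷ l₁ ++ []
    flip rewrite List.++-identityʳ l₁ | List.++-identityʳ l₂ =
      ↭-trans (++-comm l₁ _) (↭-sym (shift y l₂ l₁))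

  trail-position : ∀ {u v y l} → Trail u v l → y ∈ l → y ≡ u ⊎ y ≡ v ⊎ Inner u v y l
  trail-position stop     (here refl) = inj₁ refl
  trail-position (go e t) (here refl) = inj₁ refl
  trail-position {u} (go e t) (there y∈) with trail-position t y∈
  trail-position {u} (go e stop)      (there y∈) | inj₁ refl = inj₂ (inj₁ refl)
  trail-position {u} (go e (go f t))  (there y∈) | inj₁ refl =
    inj₂ (inj₂ (inner (point u) e f (route t ↭-refl)
      (tiles (↭-reflexive (cong (λ m → u ∷ _ ∷ m) (sym (List.++-identityʳ _)))))))
  ... | inj₂ (inj₁ refl) = inj₂ (inj₁ refl)
  ... | inj₂ (inj₂ (inner s p~y y~q t′ (tiles σ))) =
    inj₂ (inj₂ (inner (join (point u) e s) p~y y~q t′ (tiles (prep u σ))))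

  position : ∀ {u v y l} → Route u v l → y ∈ l → y ≡ u ⊎ y ≡ v ⊎ Inner u v y l
  position (route t σ) y∈ with trail-position t (∈-resp-↭ (↭-sym σ) y∈)
  ... | inj₁ eq        = inj₁ eq
  ... | inj₂ (inj₁ eq) = inj₂ (inj₁ eq)
  ... | inj₂ (inj₂ (inner s e f t′ (tiles τ))) = inj₂ (inj₂ (inner s e f t′ (tiles (↭-trans (↭-sym σ) τ))))

  uncons : ∀ {u v l} → Route u v l → u ≢ v → ∃ λ p → ∃ λ m → u ~ p × Route p v m × Tiles ((u ∷ []) ∷ m ∷ []) l
  uncons (route stop σ)     u≢v = ⊥-elim (u≢v refl)
  uncons (route (go e t) σ) u≢v = _ , _ , e , route t ↭-refl ,
    tiles (↭-trans (↭-sym σ) (↭-reflexive (cong (_ ∷_) (sym (List.++-identityʳ _)))))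

  -- `middle` includes `s′`, so that consecutive `s` and `s′` need no empty route. The primed fields
  -- cut the same route a second time, at `s′`.
  record Ordered (u v s s′ : V) (l : List V) : Set where
    constructor ordered
    field
      {p q p′ q′}     : V
      {l₁ l₂ l₃ l₁₂}  : List V
      before          : Route u p l₁
      p~s             : p ~ s
      s~q             : s ~ q
      middle          : Route q s′ l₂
      s′~q′           : s′ ~ q′
      after           : Route q′ v l₃
      parts           : Tiles (l₁ ∷ (s ∷ []) ∷ l₂ ∷ l₃ ∷ []) l
      before′         : Route u p′ l₁₂
      p′~s′           : p′ ~ s′
      parts′          : Tiles (l₁₂ ∷ (s′ ∷ []) ∷ l₃ ∷ []) l

    inner₁ : Inner u v s l
    inner₁ = inner before p~s s~q (join middle s′~q′ after)
      (tiles (↭-trans (layout parts) (++⁺ˡ l₁ (prep s (↭-reflexive (sym (List.++-assoc l₂ l₃ [])))))))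

    inner₂ : Inner u v s′ l
    inner₂ = inner before′ p′~s′ s′~q′ after parts′

  after-order : ∀ {u v s s′ l} (i : Inner u v s l) → s′ ≢ v → s′ ∈ Inner.l₂ i → Ordered u v s s′ l
  after-order {u} {v} {s} {s′} (inner {l₁ = l₁} b e f a σ) s′≢v s′∈ with position a s′∈
  ... | inj₂ (inj₁ eq) = ⊥-elim (s′≢v eq)
  ... | inj₁ refl with uncons a s′≢v
  ...   | q′ , m , g , a′ , τ =
    ordered b e f (point s′) g a′ σ₁ (join b e (point s)) f
      (tiles (↭-trans (layout σ₁) (↭-reflexive (sym (List.++-assoc l₁ (s ∷ []) _)))))
    where
    σ₁ : Tiles (l₁ ∷ (s ∷ []) ∷ (s′ ∷ []) ∷ m ∷ []) _
    σ₁ = tiles (↭-trans (layout σ) (++⁺ˡ l₁ (prep s (++⁺ʳ [] (↭-trans (layout τ)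
           (↭-reflexive (cong (s′ ∷_) (List.++-identityʳ m))))))))
  after-order {u} {v} {s} {s′} (inner {l₁ = l₁} b e f a σ) s′≢v s′∈
      | inj₂ (inj₂ (inner {l₁ = m₁} {m₂} b′ e′ f′ a′ τ)) =
    ordered b e f (join b′ e′ (point s′)) f′ a′
      (tiles (↭-trans σ₁ (↭-reflexive (cong (λ m → l₁ ++ s ∷ m) (sym (List.++-assoc m₁ (s′ ∷ []) _))))))
      (join (join b e (point s)) f b′) e′
      (tiles (↭-trans σ₁ (↭-reflexive (reassoc l₁ m₁ _))))
    where
    σ₁ : _ ↭ l₁ ++ s ∷ m₁ ++ s′ ∷ m₂ ++ []
    σ₁ = ↭-trans (layout σ) (++⁺ˡ l₁ (prep s (↭-trans (++⁺ʳ [] (layout τ))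
           (↭-reflexive (List.++-identityʳ _)))))
    reassoc : ∀ (a b c : List V) → a ++ s ∷ b ++ c ≡ ((a ++ s ∷ []) ++ b) ++ c
    reassoc a b c = trans (sym (List.++-assoc a (s ∷ b) c))
      (cong (_++ c) (sym (List.++-assoc a (s ∷ []) b)))

  -- Only the route cut at `s` is traversed; the second decomposition merely shows that `s′` lies in
  -- `l` and is not an end. Both cuts in the result thus belong to one route.
  order : ∀ {u v s s′ l} → Unique l → Inner u v s l → Inner u v s′ l → s ≢ s′ →
          Ordered u v s s′ l ⊎ Ordered u v s′ s l
  order {u} {v} {s} {s′} {l} U i@(inner {l₁ = l₁} {l₂} b e f a σ) i′@(inner {l₁ = m₁} {m₂} b′ e′ f′ a′ σ′) s≢s′
    with ∈-++⁻ l₁ (∈-resp-↭ (layout σ) (tiles-∈ Γ′ σ′ 1F (here refl)))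
    where Γ′ = m₁ ∷ (s′ ∷ []) ∷ m₂ ∷ []
  ... | inj₂ (here eq)   = ⊥-elim (s≢s′ (sym eq))
  ... | inj₂ (there s′∈) = inj₁ (after-order i s′≢v (subst (s′ ∈_) (List.++-identityʳ l₂) s′∈))
    where
    Γ′ = m₁ ∷ (s′ ∷ []) ∷ m₂ ∷ []
    s′≢v : s′ ≢ v
    s′≢v = tiles-apart Γ′ U σ′ 1F 2F (here refl) (last∈ a′)
  ... | inj₁ s′∈ with position b s′∈
  ...   | inj₁ refl = ⊥-elim (tiles-apart (m₁ ∷ (s′ ∷ []) ∷ m₂ ∷ []) U σ′ 1F 0F (here refl) (first∈ b′) refl)
  ...   | inj₂ (inj₁ refl) with uncons (rev b) s′≢u
    where
    s′≢u : s′ ≢ u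
    s′≢u = tiles-apart (m₁ ∷ (s′ ∷ []) ∷ m₂ ∷ []) U σ′ 1F 0F (here refl) (first∈ b′)
  ...     | p , m , g , c , τ =
    inj₂ (ordered (rev c) (~-sym g) e (point s) f a (tiles σ₁) (join (rev c) (~-sym g) (point s′)) e
      (tiles (↭-trans σ₁ (↭-reflexive (sym (List.++-assoc m (s′ ∷ []) _))))))
    where
    σ₁ : l ↭ m ++ s′ ∷ s ∷ l₂ ++ []
    σ₁ = ↭-trans (layout σ) (↭-trans (++⁺ʳ _ (layout τ))
      (↭-trans (↭-reflexive (cong (λ k → s′ ∷ k ++ s ∷ l₂ ++ []) (List.++-identityʳ m)))
        (↭-sym (shift s′ m _))))
  order {u} {v} {s} {s′} {l} U (inner {l₁ = l₁} {l₂} b e f a σ) _ s≢s′ | inj₁ s′∈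
      | inj₂ (inj₂ (inner {l₁ = k₁} {k₂} b″ e″ f″ a″ τ)) =
    inj₂ (ordered b″ e″ f″ (join a″ e (point s)) f a
      (tiles (↭-trans σ₁ (↭-reflexive (cong (λ k → k₁ ++ s′ ∷ k) (sym (List.++-assoc k₂ (s ∷ []) _))))))
      b e σ)
    where
    σ₁ : l ↭ k₁ ++ s′ ∷ k₂ ++ s ∷ l₂ ++ []
    σ₁ = ↭-trans (layout σ) (↭-trans (++⁺ʳ _ (layout τ))
      (↭-reflexive (trans (List.++-assoc k₁ _ _) (cong (λ k → k₁ ++ s′ ∷ k ++ s ∷ l₂ ++ []) (List.++-identityʳ k₂)))))

  -- Segments are indexed by how often they use each piece of Γ, so that the type checker verifies by
  -- evaluation that a rerouting uses every piece exactly once.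
  record Seg {k} (Γ : Vec (List V) k) (u v : V) (c : Vec ℕ k) : Set where
    constructor seg
    field underlying : Route u v (pile Γ c)

  piece : ∀ {k} (Γ : Vec (List V) k) i {u v} → Route u v (lookup Γ i) → Seg Γ u v (unit i)
  piece Γ i r = seg (subst (Route _ _) (pile-unit Γ i) r)

  infixl 5 _⟨_⟩_
  _⟨_⟩_ : ∀ {k} {Γ : Vec (List V) k} {u v w z c d} →
          Seg Γ u v c → v ~ w → Seg Γ w z d → Seg Γ u z (c ⊕ d)
  _⟨_⟩_ {Γ = Γ} {c = c} {d} (seg r) e (seg s) = seg (resp (pile-⊕ Γ c d) (join r e s))

  _⁻ : ∀ {k} {Γ : Vec (List V) k} {u v c} → Seg Γ u v c → Seg Γ v u c
  (seg r) ⁻ = seg (rev r)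

  whole : ∀ {k} {Γ : Vec (List V) k} {L u v} → Tiles Γ L → Seg Γ u v ones → Route u v L
  whole (tiles τ) (seg r) = resp (↭-sym τ) r

-- Rerouting at a vertex

record Adjacency : Set₁ where
  field
    V     : Set
    _≟ⱽ_  : (u v : V) → Dec (u ≡ v)
    _~_   : V → V → Set
    ~-sym : ∀ {u v} → u ~ v → v ~ u
    ~-irr : ∀ {v} → ¬ (v ~ v)
    _~?_  : (u v : V) → Dec (u ~ v)

module Local (H : Adjacency) where
  open Adjacency H

  open Routes _~_ ~-sym public

  infix 4 _≃_
  _≃_ : V → V → Set
  u ≃ v = u ≡ v ⊎ u ~ v

  ≃-sym : ∀ {u v} → u ≃ v → v ≃ u
  ≃-sym (inj₁ refl) = inj₁ refl
  ≃-sym (inj₂ e)    = inj₂ (~-sym e)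

  _≃?_ : ∀ u v → Dec (u ≃ v)
  u ≃? v = (u ≟ⱽ v) ⊎-dec (u ~? v)

  ≃⇒~ : ∀ {u v} → u ≢ v → u ≃ v → u ~ v
  ≃⇒~ u≢v (inj₁ u≡v) = ⊥-elim (u≢v u≡v)
  ≃⇒~ u≢v (inj₂ u~v) = u~v

  -- `w` is one vertex exempt from the three adjacency clauses. It need not be a neighbour of `x`.
  record Separation (x : V) : Set₁ where
    field
      w        : V
      P R      : V → Set
      P?       : ∀ v → Dec (P v)
      R?       : ∀ v → Dec (R v)
      cover    : ∀ {v} → x ~ v → P v ⊎ R v
      P-clique : ∀ {u v} → x ~ u → x ~ v → P u → P v → u ≢ w → v ≢ w → u ≃ v
      R-clique : ∀ {u v} → x ~ u → x ~ v → R u → R v → u ≢ w → v ≢ w → u ≃ v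
      apart    : ∀ {u v} → x ~ u → x ~ v → P u → R v → u ≢ w → v ≢ w → ¬ (u ≃ v)

  -- `Ord` singles out the vertices of the given graph; claws containing the extra vertex that
  -- closes a path to a cycle are not excluded.
  NoClaw : (V → Set) → Set
  NoClaw Ord = ∀ {c p q r} → Ord c → Ord p → Ord q → Ord r → c ~ p → c ~ q → c ~ r →
               ¬ (p ≃ q) → ¬ (p ≃ r) → ¬ (q ≃ r) → ⊥

module AtVertex (H : Adjacency) (Ord : Adjacency.V H → Set) (Ord? : ∀ v → Dec (Ord v))
  (noClaw : Local.NoClaw H Ord) (x : Adjacency.V H) (Ox : Ord x)
  (ordN : ∀ {v} → Adjacency._~_ H x v → Ord v) where
  open Adjacency H
  open Local H

  third : ∀ {c p q r} → Ord c → Ord p → Ord q → Ord r → c ~ p → c ~ q → c ~ r →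
          ¬ (p ≃ q) → ¬ (p ≃ r) → q ≃ r
  third Oc Op Oq Or cp cq cr pq pr =
    decidable-stable (_ ≃? _) (noClaw Oc Op Oq Or cp cq cr pq pr)

  thirdN : ∀ {p q r} → x ~ p → x ~ q → x ~ r → ¬ (p ≃ q) → ¬ (p ≃ r) → q ≃ r
  thirdN xp xq xr = third Ox (ordN xp) (ordN xq) (ordN xr) xp xq xr

  Good : V → List V → Set
  Good s D = ∃ λ r → x ~ r × Route s r D

  -- A route whose ends are joined is a cycle; at s it can be cut next to a neighbour of x, or else
  -- the two neighbours of s on it are joined (no claw at s) and s can be put in front of an end.
  good : ∀ {e₁ e₂ D s} → Unique D → x ∉ D → Route e₁ e₂ D → x ~ e₁ → x ~ e₂ → e₁ ≃ e₂ →
         x ~ s → s ≃ e₁ → s ∈ D →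
         Good s D ⊎ Σ (Inner e₁ e₂ s D) λ i → ¬ Ord (Inner.p i) ⊎ ¬ Ord (Inner.q i)
  good {e₁} {e₂} {D} {s} U x∉ d xe₁ xe₂ ee xs se₁ s∈ with position d s∈
  ... | inj₁ refl        = inj₁ (e₂ , xe₂ , d)
  ... | inj₂ (inj₁ refl) = inj₁ (e₁ , xe₁ , rev d)
  ... | inj₂ (inj₂ i@(inner {p} {q} {D₁} {D₂} b ps sq a σ)) = cases
    where
    Γ = D₁ ∷ (s ∷ []) ∷ D₂ ∷ []
    τ : Tiles Γ D
    τ = σ
    B = piece Γ 0F b
    S = piece Γ 1F (point s)
    A = piece Γ 2F a
    e₁~e₂ : e₁ ~ e₂
    e₁~e₂ = ≃⇒~ (tiles-apart Γ U τ 0F 2F (first∈ b) (last∈ a)) ee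
    s~e₁ : s ~ e₁
    s~e₁ = ≃⇒~ (tiles-apart Γ U τ 1F 0F (here refl) (first∈ b)) se₁
    p≢q : p ≢ q
    p≢q = tiles-apart Γ U τ 0F 2F (last∈ b) (first∈ a)
    p∈ : p ∈ D
    p∈ = tiles-∈ Γ τ 0F (last∈ b)
    q∈ : q ∈ D
    q∈ = tiles-∈ Γ τ 2F (first∈ a)
    cases : Good s D ⊎ Σ (Inner e₁ e₂ s D) λ i → ¬ Ord (Inner.p i) ⊎ ¬ Ord (Inner.q i)
    cases with x ~? p | x ~? q | p ~? q
    ... | yes xp | _      | _      = inj₁ (p , xp , whole τ (S ⟨ sq ⟩ A ⟨ ~-sym e₁~e₂ ⟩ B))
    ... | no _   | yes xq | _      = inj₁ (q , xq , whole τ (S ⟨ ~-sym ps ⟩ B ⁻ ⟨ e₁~e₂ ⟩ A ⁻))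
    ... | no _   | no _   | yes pq = inj₁ (e₂ , xe₂ , whole τ (S ⟨ s~e₁ ⟩ B ⟨ pq ⟩ A))
    ... | no xp  | no xq  | no pq  = inj₂ (i , notBoth)
      where
      notBoth : ¬ Ord p ⊎ ¬ Ord q
      notBoth with Ord? p | Ord? q
      ... | no ¬Op | _      = inj₁ ¬Op
      ... | yes _  | no ¬Oq = inj₂ ¬Oq
      ... | yes Op | yes Oq = ⊥-elim (noClaw (ordN xs) Ox Op Oq (~-sym xs) (~-sym ps) sq
        (λ { (inj₁ refl) → x∉ p∈ ; (inj₂ e) → xp e })
        (λ { (inj₁ refl) → x∉ q∈ ; (inj₂ e) → xq e })
        (λ { (inj₁ e) → p≢q e ; (inj₂ e) → pq e }))

-- A spanning cycle of L minus x is missing two links between neighbours of x: the segments D and B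
-- of a configuration have all their ends in N(x).
module Cyclic (H : Adjacency) (Ord : Adjacency.V H → Set) (Ord? : ∀ v → Dec (Ord v))
  (noClaw : Local.NoClaw H Ord) (x : Adjacency.V H) (Ox : Ord x)
  (ordN : ∀ {v} → Adjacency._~_ H x v → Ord v) (Ord₂ : ∀ {u v} → u ≢ v → Ord u ⊎ Ord v)
  (L : List (Adjacency.V H)) (UL : Unique L) (N⊆L : ∀ {v} → Adjacency._~_ H x v → v ∈ L)
  (noCycle : ∀ {u v} → Local.Route H u v L → Adjacency._~_ H v u → ⊥) where
  open Adjacency H
  open Local H
  open AtVertex H Ord Ord? noClaw x Ox ordN

  record Config : Set where
    field
      {e₁ e₂ f₁ f₂} : V
      {D B}         : List V
      pD  : Route e₁ e₂ D
      pB  : Route f₁ f₂ B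
      xe₁ : x ~ e₁
      xe₂ : x ~ e₂
      xf₁ : x ~ f₁
      xf₂ : x ~ f₂
      cov : Tiles (D ∷ B ∷ (x ∷ []) ∷ []) L
  open Config

  exchange : Config → Config
  exchange c = record { pD = pB c ; pB = pD c ; xe₁ = xf₁ c ; xe₂ = xf₂ c ; xf₁ = xe₁ c
                      ; xf₂ = xe₂ c ; cov = tiles-swap (cov c) }

  revD : Config → Config
  revD c = record c { pD = rev (pD c) ; xe₁ = xe₂ c ; xe₂ = xe₁ c }

  revB : Config → Config
  revB c = record c { pB = rev (pB c) ; xf₁ = xf₂ c ; xf₂ = xf₁ c }

  kill : ∀ {k} {Γ : Vec (List V) k} {u v} → Tiles Γ L → Seg Γ u v ones → v ~ u → ⊥
  kill τ s = noCycle (whole τ s)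

  -- A link would close `D`, `B` and `x` to a spanning cycle. Applied to `revD` and `revB`, this
  -- covers all four pairs of ends.
  e₁≄f₁ : ∀ c → ¬ (e₁ c ≃ f₁ c)
  e₁≄f₁ c (inj₁ eq) = tiles-apart _ UL (cov c) 0F 1F (first∈ (pD c)) (first∈ (pB c)) eq
  e₁≄f₁ c (inj₂ ef) = kill (cov c)
    (piece Γ 0F (rev (pD c)) ⟨ ef ⟩ piece Γ 1F (pB c) ⟨ ~-sym (xf₂ c) ⟩ piece Γ 2F (point x)) (xe₂ c)
    where Γ = D c ∷ B c ∷ (x ∷ []) ∷ []

  e₁≃e₂ : ∀ c → e₁ c ≃ e₂ c
  e₁≃e₂ c = thirdN (xf₁ c) (xe₁ c) (xe₂ c) (λ h → e₁≄f₁ c (≃-sym h))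
                   (λ h → e₁≄f₁ (revD c) (≃-sym h))

  InS InT : Config → V → Set
  InS c v = v ≃ e₁ c × v ≃ e₂ c
  InT c v = v ≃ f₁ c × v ≃ f₂ c

  -- If `v` misses one of the ends of `D`, then it is joined to both ends of `B`: that end of `D`
  -- misses them too, and `x` centres no claw.
  S∪T : ∀ c {v} → x ~ v → InS c v ⊎ InT c v
  S∪T c {v} xv with v ≃? e₁ c | v ≃? e₂ c
  ... | yes a | yes b = inj₁ (a , b)
  ... | no ¬a | _     = inj₂
    ( thirdN (xe₁ c) xv (xf₁ c) (λ h → ¬a (≃-sym h)) (e₁≄f₁ c)
    , thirdN (xe₁ c) xv (xf₂ c) (λ h → ¬a (≃-sym h)) (e₁≄f₁ (revB c)))
  ... | yes _ | no ¬b = inj₂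
    ( thirdN (xe₂ c) xv (xf₁ c) (λ h → ¬b (≃-sym h)) (e₁≄f₁ (revD c))
    , thirdN (xe₂ c) xv (xf₂ c) (λ h → ¬b (≃-sym h)) (e₁≄f₁ (revD (revB c))))

  x∉D : ∀ c → x ∉ D c
  x∉D c x∈ = tiles-apart _ UL (cov c) 0F 2F x∈ (here refl) refl

  D⊎B : ∀ c {v} → x ~ v → v ∈ D c ⊎ v ∈ B c
  D⊎B c {v} xv with ∈-++⁻ (D c) (∈-resp-↭ (layout (cov c)) (N⊆L xv))
  ... | inj₁ v∈ = inj₁ v∈
  ... | inj₂ v∈ with ∈-++⁻ (B c) v∈
  ...   | inj₁ v∈′         = inj₂ v∈′
  ...   | inj₂ (here refl) = inj₁ (⊥-elim (~-irr xv))

  module Cut (c : Config) {y : V} (i : Inner (e₁ c) (e₂ c) y (D c)) where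
    open Inner i public
    Γ : Vec (List V) 5
    Γ = l₁ ∷ (y ∷ []) ∷ l₂ ∷ B c ∷ (x ∷ []) ∷ []
    τ : Tiles Γ L
    τ = tiles-split parts (cov c)
    D₁ = piece Γ 0F before
    Y  = piece Γ 1F (point y)
    D₂ = piece Γ 2F after
    F  = piece Γ 3F (pB c)
    X  = piece Γ 4F (point x)
    e₁~e₂ : e₁ c ~ e₂ c
    e₁~e₂ = ≃⇒~ (tiles-apart Γ UL τ 0F 2F (first∈ before) (last∈ after)) (e₁≃e₂ c)
    y≢e₁ : y ≢ e₁ c
    y≢e₁ = tiles-apart Γ UL τ 1F 0F (here refl) (first∈ before)
    y≢B : ∀ {f} → f ∈ B c → y ≢ f
    y≢B = tiles-apart Γ UL τ 1F 3F (here refl)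
    q≢B : ∀ {f} → f ∈ B c → q ≢ f
    q≢B = tiles-apart Γ UL τ 2F 3F (first∈ after)
    q≢e₁ : q ≢ e₁ c
    q≢e₁ = tiles-apart Γ UL τ 2F 0F (first∈ after) (first∈ before)
    p≢q : p ≢ q
    p≢q = tiles-apart Γ UL τ 0F 2F (last∈ before) (first∈ after)
    q≢x : q ≢ x
    q≢x = tiles-apart Γ UL τ 2F 4F (first∈ after) (here refl)
    p≢x : p ≢ x
    p≢x = tiles-apart Γ UL τ 0F 4F (last∈ before) (here refl)

  -- Otherwise `y` centres a claw with leaves `f₁`, `q`, `e₁`: since `y` can be linked to `f₂`, an
  -- edge from `q` to `f₁` or to `e₁` would close a spanning cycle.
  S∩T-inner : ∀ c {y} → x ~ y → InS c y → InT c y → (i : Inner (e₁ c) (e₂ c) y (D c)) →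
              ¬ Ord (Inner.q i)
  S∩T-inner c {y} xy (ye₁ , _) (yf₁ , yf₂) i Oq =
    noClaw (ordN xy) (ordN (xf₁ c)) Oq (ordN (xe₁ c))
           (≃⇒~ (y≢B (first∈ (pB c))) yf₁) y~q y~e₁
           (λ { (inj₁ e) → q≢B (first∈ (pB c)) (sym e)
              ; (inj₂ e) → kill τ (D₁ ⟨ p~y ⟩ Y ⟨ y~f₂ ⟩ F ⁻ ⟨ e ⟩ D₂ ⟨ ~-sym (xe₂ c) ⟩ X) (xe₁ c) })
           (λ h → e₁≄f₁ c (≃-sym h))
           (λ { (inj₁ e) → q≢e₁ e
              ; (inj₂ e) → kill τ (D₁ ⟨ p~y ⟩ Y ⟨ y~f₂ ⟩ F ⁻ ⟨ ~-sym (xf₁ c) ⟩ X ⟨ xe₂ c ⟩ D₂ ⁻) e })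
    where
    open Cut c i
    y~f₂ = ≃⇒~ (y≢B (last∈ (pB c))) yf₂
    y~e₁ = ≃⇒~ y≢e₁ ye₁

  S∩T-D : ∀ c {y} → x ~ y → InS c y → InT c y → y ∈ D c → ⊥
  S∩T-D c xy Sy Ty y∈ with position (pD c) y∈
  ... | inj₁ refl        = e₁≄f₁ c (proj₁ Ty)
  ... | inj₂ (inj₁ refl) = e₁≄f₁ (revD c) (proj₁ Ty)
  ... | inj₂ (inj₂ i) with Ord₂ (Cut.p≢q c i)
  ...   | inj₂ Oq = S∩T-inner c xy Sy Ty i Oq
  ...   | inj₁ Op = S∩T-inner (revD c) xy (proj₂ Sy , proj₁ Sy) Ty (rev-inner i) Op

  S∩T : ∀ c {y} → x ~ y → InS c y → InT c y → ⊥
  S∩T c xy Sy Ty with D⊎B c xy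
  ... | inj₁ y∈ = S∩T-D c xy Sy Ty y∈
  ... | inj₂ y∈ = S∩T-D (exchange c) xy Ty Sy y∈

  T-inner : ∀ c {t} → x ~ t → InT c t → t ∈ D c → Inner (e₁ c) (e₂ c) t (D c)
  T-inner c xt Tt t∈ with position (pD c) t∈
  ... | inj₁ refl        = ⊥-elim (e₁≄f₁ c (proj₁ Tt))
  ... | inj₂ (inj₁ refl) = ⊥-elim (e₁≄f₁ (revD c) (proj₁ Tt))
  ... | inj₂ (inj₂ i)    = i

  next≁f₁ : ∀ c {t} → x ~ t → InT c t → (i : Inner (e₁ c) (e₂ c) t (D c)) → ¬ (Inner.q i ~ f₁ c)
  next≁f₁ c xt (tf₁ , tf₂) i e =
    kill τ (D₁ ⟨ p~y ⟩ Y ⟨ ≃⇒~ (y≢B (last∈ (pB c))) tf₂ ⟩ F ⁻ ⟨ ~-sym e ⟩ D₂ ⟨ ~-sym (xe₂ c) ⟩ X) (xe₁ c)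
    where open Cut c i

  next≁x : ∀ c {t} → x ~ t → InT c t → (i : Inner (e₁ c) (e₂ c) t (D c)) → ¬ (x ~ Inner.q i)
  next≁x c xt (tf₁ , tf₂) i e =
    kill τ (D₁ ⟨ p~y ⟩ Y ⟨ ≃⇒~ (y≢B (last∈ (pB c))) tf₂ ⟩ F ⁻ ⟨ ~-sym (xf₁ c) ⟩ X ⟨ e ⟩ D₂)
         (~-sym e₁~e₂)
    where open Cut c i

  -- Neither neighbour of `t` on `D` is joined to `x`, so they are joined to each other, there being
  -- no claw at `t`. This closes `D` behind `t`, which then extends `B` at `f₁`.
  move : ∀ c {t} → x ~ t → InT c t → (i : Inner (e₁ c) (e₂ c) t (D c)) →
         Ord (Inner.p i) → Ord (Inner.q i) → Config
  move c {t} xt Tt@(tf₁ , tf₂) i Op Oq = record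
    { pD = join before p~q after ; pB = join (point t) (≃⇒~ (y≢B (first∈ (pB c))) tf₁) (pB c)
    ; xe₁ = xe₁ c ; xe₂ = xe₂ c ; xf₁ = xt ; xf₂ = xf₂ c
    ; cov = tiles (↭-trans (layout τ) regroup) }
    where
    open Cut c i
    p~q : p ~ q
    p~q = ≃⇒~ p≢q (third (ordN xt) Ox Op Oq (~-sym xt) (~-sym p~y) y~q
      (λ { (inj₁ e) → p≢x (sym e) ; (inj₂ e) → next≁x (revD c) xt Tt (rev-inner i) e })
      (λ { (inj₁ e) → q≢x (sym e) ; (inj₂ e) → next≁x c xt Tt i e }))
    regroup : l₁ ++ t ∷ l₂ ++ B c ++ x ∷ [] ↭ (l₁ ++ l₂) ++ t ∷ B c ++ x ∷ []
    regroup = ↭-trans (++⁺ˡ l₁ (↭-sym (shift t l₂ (B c ++ x ∷ []))))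
                      (↭-reflexive (sym (List.++-assoc l₁ l₂ _)))

  -- In the closed graph this says that `B` contains neither the extra vertex nor `a` nor `b`.
  Plain : List V → Set
  Plain B = ∀ {v w} → v ∈ B → v ≃ w → Ord w

  glue : ∀ c {s t} → Good s (D c) → Good t (B c) → ¬ (s ~ t)
  glue c (r , xr , d) (r′ , xr′ , b) st = kill (cov c)
    (piece Γ 0F (rev d) ⟨ st ⟩ piece Γ 1F b ⟨ ~-sym xr′ ⟩ piece Γ 2F (point x)) xr
    where Γ = D c ∷ B c ∷ (x ∷ []) ∷ []

  good-B : ∀ c → Plain (B c) → ∀ {t} → x ~ t → InT c t → t ∈ B c → Good t (B c)
  good-B c plain xt Tt t∈
    with good (tiles-unique _ UL (cov c) 1F) (x∉D (exchange c)) (pB c) (xf₁ c) (xf₂ c)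
              (e₁≃e₂ (exchange c)) xt (proj₁ Tt) t∈
  ... | inj₁ g              = g
  ... | inj₂ (i , inj₁ ¬Op) = ⊥-elim (¬Op (plain t∈ (inj₂ (~-sym (Inner.p~y i)))))
  ... | inj₂ (i , inj₂ ¬Oq) = ⊥-elim (¬Oq (plain t∈ (inj₂ (Inner.y~q i))))

  -- Since `p` is the one vertex outside `Ord`, `q` is ordinary, and `s` would centre a claw with
  -- leaves `e₁`, `t`, `q`: any edge among these closes a spanning cycle.
  cross-special : ∀ c {s t} → x ~ s → x ~ t → InS c s → t ∈ B c → Good t (B c) →
                  (i : Inner (e₁ c) (e₂ c) s (D c)) → ¬ Ord (Inner.p i) → ¬ (s ~ t)
  cross-special c {s} {t} xs xt (se₁ , se₂) t∈ g@(r , xr , b) i ¬Op st with Ord₂ (Cut.p≢q c i)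
  ... | inj₁ Op = ¬Op Op
  ... | inj₂ Oq = noClaw (ordN xs) (ordN (xe₁ c)) (ordN xt) Oq (≃⇒~ y≢e₁ se₁) st y~q
           (λ { (inj₁ e) → tiles-apart Γ UL τ 0F 3F (first∈ before) t∈ e
              ; (inj₂ e) → glue c (e₂ c , xe₂ c , pD c) g e })
           (λ { (inj₁ e) → q≢e₁ (sym e)
              ; (inj₂ e) → kill τ (D₂ ⁻ ⟨ ~-sym e ⟩ D₁ ⟨ p~y ⟩ Y ⟨ st ⟩ T ⟨ ~-sym xr ⟩ X) (xe₂ c) })
           (λ { (inj₁ e) → q≢B t∈ (sym e)
              ; (inj₂ e) → kill τ (D₁ ⟨ p~y ⟩ Y ⟨ ~-sym xs ⟩ X ⟨ xr ⟩ T ⁻ ⟨ e ⟩ D₂) (~-sym e₁~e₂) })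
    where
    open Cut c i
    T = piece Γ 3F b

  cross-DB : ∀ c → Plain (B c) → ∀ {s t} → x ~ s → x ~ t → InS c s → InT c t →
             s ∈ D c → t ∈ B c → ¬ (s ~ t)
  cross-DB c plain {s} {t} xs xt Ss Tt s∈ t∈ st
    with good (tiles-unique _ UL (cov c) 0F) (x∉D c) (pD c) (xe₁ c) (xe₂ c) (e₁≃e₂ c)
              xs (proj₁ Ss) s∈ | good-B c plain xt Tt t∈
  ... | inj₁ g              | h = glue c g h st
  ... | inj₂ (i , inj₁ ¬Op) | h = cross-special c xs xt Ss t∈ h i ¬Op st
  ... | inj₂ (i , inj₂ ¬Oq) | h =
    cross-special (revD c) xs xt (proj₂ Ss , proj₁ Ss) t∈ h (rev-inner i) ¬Oq st

  -- If `s` lies in `B` too, it is first moved to `D`. The segment `B` only loses a vertex, so it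
  -- stays `Plain`.
  cross-B : ∀ c → Plain (B c) → ∀ {s t} → x ~ s → x ~ t → InS c s → InT c t →
            t ∈ B c → ¬ (s ~ t)
  cross-B c plain {s} {t} xs xt Ss Tt t∈ st with D⊎B c xs
  ... | inj₁ s∈ = cross-DB c plain xs xt Ss Tt s∈ t∈ st
  ... | inj₂ s∈ = cross-DB c′ plain′ xs xt (inj₁ refl , proj₂ Ss) Tt (here refl) t∈′ st
    where
    i = T-inner (exchange c) xs Ss s∈
    c′ = exchange (move (exchange c) xs Ss i (plain s∈ (inj₂ (~-sym (Inner.p~y i))))
                                             (plain s∈ (inj₂ (Inner.y~q i))))
    open Inner i
    old : ∀ {v} → v ∈ l₁ ++ l₂ → v ∈ B c
    old v∈ = ∈-resp-↭ (↭-sym (layout parts)) (lemma (∈-++⁻ l₁ v∈))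
      where
      lemma : ∀ {v} → v ∈ l₁ ⊎ v ∈ l₂ → v ∈ l₁ ++ s ∷ l₂ ++ []
      lemma (inj₁ v∈) = ∈-++⁺ˡ v∈
      lemma (inj₂ v∈) = ∈-++⁺ʳ l₁ (there (∈-++⁺ˡ v∈))
    plain′ : Plain (B c′)
    plain′ v∈ = plain (old v∈)
    t∈′ : t ∈ l₁ ++ l₂
    t∈′ with ∈-++⁻ l₁ (∈-resp-↭ (layout parts) t∈)
    ... | inj₁ t∈₁ = ∈-++⁺ˡ t∈₁
    ... | inj₂ (here refl) = ⊥-elim (~-irr st)
    ... | inj₂ (there t∈₂) with ∈-++⁻ l₂ t∈₂
    ...   | inj₁ t∈₃ = ∈-++⁺ʳ l₁ t∈₃

  -- If `t` lies in `D`, it has to be moved to `B`, and `move` asks for ordinary neighbours on `D`.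
  -- In the closed graph the last hypothesis fails only for `a`, `b` and the extra vertex.
  cross : ∀ c → Plain (B c) → ∀ {s t} → x ~ s → x ~ t → InS c s → InT c t →
          s ~ t → ¬ (∀ {w} → t ≃ w → Ord w)
  cross c plain {s} {t} xs xt Ss Tt st Ot with D⊎B c xt
  ... | inj₂ t∈ = cross-B c plain xs xt Ss Tt t∈ st
  ... | inj₁ t∈ = cross-B c′ plain′ xs xt Ss (inj₁ refl , proj₂ Tt) (here refl) st
    where
    i = T-inner c xt Tt t∈
    c′ = move c xt Tt i (Ot (inj₂ (~-sym (Inner.p~y i)))) (Ot (inj₂ (Inner.y~q i)))
    plain′ : Plain (B c′)
    plain′ (here refl) = Ot
    plain′ (there v∈)  = plain v∈

  -- `y` is an ordinary neighbour of `t` on `D`. It is joined to each such `s`, as otherwise `t`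
  -- centres a claw with leaves `f₁`, `y`, `s`. These vertices later show that a clique meeting both
  -- sides has no simplicial edge.
  escape : ∀ c → Plain (B c) → ∀ {t} → x ~ t → InT c t → t ∈ D c →
           ∃ λ y → t ~ y × Ord y × y ≢ x × ¬ (x ~ y) ×
                   (∀ {s} → x ~ s → InS c s → s ~ t → y ~ s)
  escape c plain {t} xt Tt t∈ = choose (Ord₂ (Cut.p≢q c i))
    where
    i = T-inner c xt Tt t∈
    result : ∀ c → Plain (B c) → ∀ {t} → x ~ t → InT c t → (i : Inner (e₁ c) (e₂ c) t (D c)) →
             Ord (Inner.q i) → ∃ λ y → t ~ y × Ord y × y ≢ x × ¬ (x ~ y) ×
                   (∀ {s} → x ~ s → InS c s → s ~ t → y ~ s)
    result c plain {t} xt Tt i Oq =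
      q , y~q , Oq , q≢x , next≁x c xt Tt i , λ {s} xs Ss st →
      ≃⇒~ (λ { refl → next≁x c xt Tt i xs })
        (third (ordN xt) (ordN (xf₁ c)) Oq (ordN xs) (≃⇒~ (y≢B (first∈ (pB c))) (proj₁ Tt)) y~q (~-sym st)
          (λ { (inj₁ e) → q≢B (first∈ (pB c)) (sym e) ; (inj₂ e) → next≁f₁ c xt Tt i (~-sym e) })
          (λ { (inj₁ refl) → S∩T c xs Ss (inj₁ refl , e₁≃e₂ (exchange c))
             ; (inj₂ e) → cross-B c plain xs (xf₁ c) Ss (inj₁ refl , e₁≃e₂ (exchange c))
                                  (first∈ (pB c)) (~-sym e) }))
      where open Cut c i
    choose : Ord (Inner.p i) ⊎ Ord (Inner.q i) → _
    choose (inj₂ Oq) = result c plain xt Tt i Oq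
    choose (inj₁ Op) with result (revD c) plain xt Tt (rev-inner i) Op
    ... | y , ty , Oy , y≢x , xy , ys =
      y , ty , Oy , y≢x , xy , λ xs Ss → ys xs (proj₂ Ss , proj₁ Ss)

-- The same with paths from N(x) to b, i.e. x is the first vertex of the path to be rerouted.
module Linear (H : Adjacency) (noClaw : Local.NoClaw H (λ _ → ⊤)) (x b : Adjacency.V H)
  (L : List (Adjacency.V H)) (UL : Unique L) (x∉L : x ∉ L)
  (N⊆L : ∀ {v} → Adjacency._~_ H x v → v ∈ L)
  (noPath : ∀ {r} → Adjacency._~_ H x r → Local.Route H r b L → ⊥) where
  open Adjacency H
  open Local H
  open AtVertex H (λ _ → ⊤) (λ _ → yes tt) noClaw x tt (λ _ → tt)

  record Config : Set where
    field
      {d f₁ f₂} : V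
      {D B}     : List V
      pD  : Route d b D
      pB  : Route f₁ f₂ B
      xd  : x ~ d
      xf₁ : x ~ f₁
      xf₂ : x ~ f₂
      cov : Tiles (D ∷ B ∷ []) L
  open Config

  third′ : ∀ {c p q r} → c ~ p → c ~ q → c ~ r → ¬ (p ≃ q) → ¬ (p ≃ r) → q ≃ r
  third′ = third tt tt tt tt

  kill : ∀ {k} {Γ : Vec (List V) k} {r} → Tiles Γ L → Seg Γ r b ones → x ~ r → ⊥
  kill τ s xr = noPath xr (whole τ s)

  revB : Config → Config
  revB c = record c { pB = rev (pB c) ; xf₁ = xf₂ c ; xf₂ = xf₁ c }

  d≄f₂ : ∀ c → ¬ (d c ≃ f₂ c)
  d≄f₂ c (inj₁ e) = tiles-apart _ UL (cov c) 0F 1F (first∈ (pD c)) (last∈ (pB c)) e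
  d≄f₂ c (inj₂ e) = kill (cov c) (piece Γ 1F (pB c) ⟨ ~-sym e ⟩ piece Γ 0F (pD c)) (xf₁ c)
    where Γ = D c ∷ B c ∷ []

  f₁≃f₂ : ∀ c → f₁ c ≃ f₂ c
  f₁≃f₂ c = thirdN (xd c) (xf₁ c) (xf₂ c) (d≄f₂ (revB c)) (d≄f₂ c)

  -- Only one end of `D` is known to lie in N(x), so `S` is defined by `d` alone. In return `b` may
  -- belong to both sets.
  InS InT : Config → V → Set
  InS c v = v ≃ d c
  InT c v = v ≃ f₁ c × v ≃ f₂ c

  d∉T : ∀ c → ¬ InT c (d c)
  d∉T c (_ , h) = d≄f₂ c h

  S∪T : ∀ c {v} → x ~ v → InS c v ⊎ InT c v
  S∪T c {v} xv with v ≃? d c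
  ... | yes h = inj₁ h
  ... | no ¬h = inj₂ ( thirdN (xd c) xv (xf₁ c) (λ h → ¬h (≃-sym h)) (d≄f₂ (revB c))
                     , thirdN (xd c) xv (xf₂ c) (λ h → ¬h (≃-sym h)) (d≄f₂ c))

  D⊎B : ∀ c {v} → x ~ v → v ∈ D c ⊎ v ∈ B c
  D⊎B c {v} xv with ∈-++⁻ (D c) (∈-resp-↭ (layout (cov c)) (N⊆L xv))
  ... | inj₁ v∈ = inj₁ v∈
  ... | inj₂ v∈ with ∈-++⁻ (B c) v∈
  ...   | inj₁ v∈′ = inj₂ v∈′

  D∩B : ∀ c {u v} → u ∈ D c → v ∈ B c → u ≢ v
  D∩B c = tiles-apart _ UL (cov c) 0F 1F

  module CutD (c : Config) {y : V} (i : Inner (d c) b y (D c)) where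
    open Inner i public
    Γ : Vec (List V) 4
    Γ = l₁ ∷ (y ∷ []) ∷ l₂ ∷ B c ∷ []
    τ : Tiles Γ L
    τ = tiles-split parts (cov c)
    D₁ = piece Γ 0F before
    Y  = piece Γ 1F (point y)
    D₂ = piece Γ 2F after
    F  = piece Γ 3F (pB c)
    y≢d : y ≢ d c
    y≢d = tiles-apart Γ UL τ 1F 0F (here refl) (first∈ before)
    d≢b : d c ≢ b
    d≢b = tiles-apart Γ UL τ 0F 2F (first∈ before) (last∈ after)
    p≢q : p ≢ q
    p≢q = tiles-apart Γ UL τ 0F 2F (last∈ before) (first∈ after)
    q≢d : q ≢ d c
    q≢d = tiles-apart Γ UL τ 2F 0F (first∈ after) (first∈ before)
    p≢B : ∀ {f} → f ∈ B c → p ≢ f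
    p≢B = tiles-apart Γ UL τ 0F 3F (last∈ before)
    q≢B : ∀ {f} → f ∈ B c → q ≢ f
    q≢B = tiles-apart Γ UL τ 2F 3F (first∈ after)
    y≢B : ∀ {f} → f ∈ B c → y ≢ f
    y≢B = tiles-apart Γ UL τ 1F 3F (here refl)
    ∈L : ∀ j {v} → v ∈ lookup Γ j → v ∈ L
    ∈L j = tiles-∈ Γ τ j
    p≢x : x ≢ p
    p≢x refl = x∉L (∈L 0F (last∈ before))
    q≢x : x ≢ q
    q≢x refl = x∉L (∈L 2F (first∈ after))

  module CutB (c : Config) {y : V} (i : Inner (f₁ c) (f₂ c) y (B c)) where
    open Inner i public
    Γ : Vec (List V) 4
    Γ = l₁ ∷ (y ∷ []) ∷ l₂ ∷ D c ∷ []
    τ : Tiles Γ L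
    τ = tiles-split parts (tiles-swap (cov c))
    B₁ = piece Γ 0F before
    Y  = piece Γ 1F (point y)
    B₂ = piece Γ 2F after
    P  = piece Γ 3F (pD c)
    f₁~f₂ : f₁ c ~ f₂ c
    f₁~f₂ = ≃⇒~ (tiles-apart Γ UL τ 0F 2F (first∈ before) (last∈ after)) (f₁≃f₂ c)
    y≢f₂ : y ≢ f₂ c
    y≢f₂ = tiles-apart Γ UL τ 1F 2F (here refl) (last∈ after)
    y≢d : y ≢ d c
    y≢d = tiles-apart Γ UL τ 1F 3F (here refl) (first∈ (pD c))
    p≢d : p ≢ d c
    p≢d = tiles-apart Γ UL τ 0F 3F (last∈ before) (first∈ (pD c))
    q≢d : q ≢ d c
    q≢d = tiles-apart Γ UL τ 2F 3F (first∈ after) (first∈ (pD c))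
    p≢q : p ≢ q
    p≢q = tiles-apart Γ UL τ 0F 2F (last∈ before) (first∈ after)

  T-inner : ∀ c {t} → InT c t → t ≢ b → t ∈ D c → Inner (d c) b t (D c)
  T-inner c Tt t≢b t∈ with position (pD c) t∈
  ... | inj₁ refl        = ⊥-elim (d∉T c Tt)
  ... | inj₂ (inj₁ t≡b)  = ⊥-elim (t≢b t≡b)
  ... | inj₂ (inj₂ i)    = i

  S-inner : ∀ c {s} → InS c s → s ∈ B c → Inner (f₁ c) (f₂ c) s (B c)
  S-inner c Ss s∈ with position (pB c) s∈
  ... | inj₁ refl        = ⊥-elim (d≄f₂ (revB c) (≃-sym Ss))
  ... | inj₂ (inj₁ refl) = ⊥-elim (d≄f₂ c (≃-sym Ss))
  ... | inj₂ (inj₂ i)    = i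

  -- There is no claw at `t` with leaves `f₁`, `p`, `q`: if `f₁` were joined to `p` or `q`, then `B`
  -- could be inserted into `D` next to `t`.
  T-bridge : ∀ c {t} → InT c t → (i : Inner (d c) b t (D c)) → Inner.p i ~ Inner.q i
  T-bridge c {t} (tf₁ , tf₂) i = ≃⇒~ p≢q (third′ t~f₁ (~-sym p~y) y~q
    (λ { (inj₁ e) → p≢B (first∈ (pB c)) (sym e)
       ; (inj₂ e) → kill τ (D₁ ⟨ ~-sym e ⟩ F ⟨ ~-sym t~f₂ ⟩ Y ⟨ y~q ⟩ D₂) (xd c) })
    (λ { (inj₁ e) → q≢B (first∈ (pB c)) (sym e)
       ; (inj₂ e) → kill τ (D₁ ⟨ p~y ⟩ Y ⟨ t~f₂ ⟩ F ⁻ ⟨ e ⟩ D₂) (xd c) }))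
    where
    open CutD c i
    t~f₁ = ≃⇒~ (y≢B (first∈ (pB c))) tf₁
    t~f₂ = ≃⇒~ (y≢B (last∈ (pB c))) tf₂

  S-bridge : ∀ c {s} → x ~ s → InS c s → (i : Inner (f₁ c) (f₂ c) s (B c)) → Inner.p i ~ Inner.q i
  S-bridge c {s} xs Ss i = ≃⇒~ p≢q (third′ s~d (~-sym p~y) y~q
    (λ { (inj₁ e) → p≢d (sym e)
       ; (inj₂ e) → kill τ (Y ⟨ y~q ⟩ B₂ ⟨ ~-sym f₁~f₂ ⟩ B₁ ⟨ ~-sym e ⟩ P) xs })
    (λ { (inj₁ e) → q≢d (sym e)
       ; (inj₂ e) → kill τ (Y ⟨ ~-sym p~y ⟩ B₁ ⁻ ⟨ f₁~f₂ ⟩ B₂ ⁻ ⟨ ~-sym e ⟩ P) xs }))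
    where
    open CutB c i
    s~d = ≃⇒~ y≢d Ss

  -- The bridge over `y` frees it to link `B` to `d`, which gives a spanning path. The vertex `b`
  -- cannot be freed, being the end of the required path.
  S∩T : ∀ c {y} → x ~ y → y ≢ b → InS c y → InT c y → ⊥
  S∩T c xy y≢b Sy Ty with D⊎B c xy
  ... | inj₁ y∈ = kill τ
    (F ⟨ ~-sym (≃⇒~ (y≢B (last∈ (pB c))) (proj₂ Ty)) ⟩ Y ⟨ ≃⇒~ y≢d Sy ⟩ D₁ ⟨ T-bridge c Ty i ⟩ D₂) (xf₁ c)
    where
    i = T-inner c Ty y≢b y∈
    open CutD c i
  ... | inj₂ y∈ = kill τ
    (B₁ ⟨ S-bridge c xy Sy i ⟩ B₂ ⟨ ~-sym (≃⇒~ y≢f₂ (proj₂ Ty)) ⟩ Y ⟨ ≃⇒~ y≢d Sy ⟩ P) (xf₁ c)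
    where
    i = S-inner c Sy y∈
    open CutB c i

  moveT : ∀ c {t} → x ~ t → InT c t → Inner (d c) b t (D c) → Config
  moveT c {t} xt Tt i = record
    { pD = join before (T-bridge c Tt i) after
    ; pB = join (point t) (≃⇒~ (y≢B (first∈ (pB c))) (proj₁ Tt)) (pB c)
    ; xd = xd c ; xf₁ = xt ; xf₂ = xf₂ c
    ; cov = tiles (↭-trans (layout τ) (↭-trans (++⁺ˡ l₁ (↭-sym (shift t l₂ _)))
                                               (↭-reflexive (sym (List.++-assoc l₁ l₂ _))))) }
    where open CutD c i

  moveS : ∀ c {s} → x ~ s → InS c s → Inner (f₁ c) (f₂ c) s (B c) → Config
  moveS c {s} xs Ss i = record
    { pD = join (point s) (≃⇒~ y≢d Ss) (pD c)
    ; pB = join before (S-bridge c xs Ss i) after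
    ; xd = xs ; xf₁ = xf₁ c ; xf₂ = xf₂ c
    ; cov = tiles-swap (tiles (↭-trans (layout τ) (↭-trans (++⁺ˡ l₁ (↭-sym (shift s l₂ _)))
                                               (↭-reflexive (sym (List.++-assoc l₁ l₂ _)))))) }
    where open CutB c i

  Placed : Config → V → Set
  Placed c v = (InS c v → v ∈ D c) × (InT c v → v ∈ B c)

  other-part : ∀ {l l₁ l₂ : List V} {y v} → Tiles (l₁ ∷ (y ∷ []) ∷ l₂ ∷ []) l → v ∈ l → v ≢ y → v ∈ l₁ ++ l₂
  other-part {l₁ = l₁} {l₂} σ v∈ v≢y with ∈-++⁻ l₁ (∈-resp-↭ (layout σ) v∈)
  ... | inj₁ v∈₁         = ∈-++⁺ˡ v∈₁
  ... | inj₂ (here eq)   = ⊥-elim (v≢y eq)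
  ... | inj₂ (there v∈₂) with ∈-++⁻ l₂ v∈₂
  ...   | inj₁ v∈₃ = ∈-++⁺ʳ l₁ v∈₃

  Improves : Config → Config → Set
  Improves c c′ = ∀ {v} → x ~ v → v ≢ b → Placed c v → Placed c′ v

  -- A move changes an end and with it one of the sets `InS`, `InT`. On N(x) without `b` the sets
  -- stay the same: the old ones cover it and the new ones are disjoint on it.
  place : ∀ c w → Σ Config λ c′ → Improves c c′ × (x ~ w → w ≢ b → Placed c′ w)
  place c w with x ~? w | w ≟ⱽ b
  ... | no ¬xw | _       = c , (λ _ _ h → h) , λ xw → ⊥-elim (¬xw xw)
  ... | yes _  | yes w≡b = c , (λ _ _ h → h) , λ _ w≢b → ⊥-elim (w≢b w≡b)
  ... | yes xw | no w≢b with S∪T c xw | D⊎B c xw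
  ...   | inj₁ Sw | inj₁ w∈ = c , (λ _ _ h → h) , λ _ _ → (λ _ → w∈) , λ Tw → ⊥-elim (S∩T c xw w≢b Sw Tw)
  ...   | inj₂ Tw | inj₂ w∈ = c , (λ _ _ h → h) , λ _ _ → (λ Sw → ⊥-elim (S∩T c xw w≢b Sw Tw)) , λ _ → w∈
  ...   | inj₂ Tw | inj₁ w∈ = c′ , improves , λ _ _ → (λ Sw → ⊥-elim (S∩T c xw w≢b Sw Tw)) , λ _ → here refl
    where
    i = T-inner c Tw w≢b w∈
    c′ = moveT c xw Tw i
    improves : Improves c c′
    improves xv v≢b (inD , inB) =
        (λ Sv → other-part (Inner.parts i) (inD Sv) λ { refl → S∩T c xv v≢b Sv Tw })
      , λ Tv → [ (λ Sv → ⊥-elim (S∩T c′ xv v≢b Sv Tv)) , (λ Tv′ → there (inB Tv′)) ]′ (S∪T c xv)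
  ...   | inj₁ Sw | inj₂ w∈ = c′ , improves , λ _ _ → (λ _ → here refl) , λ Tw → ⊥-elim (S∩T c xw w≢b Sw Tw)
    where
    i = S-inner c Sw w∈
    c′ = moveS c xw Sw i
    improves : Improves c c′
    improves xv v≢b (inD , inB) =
        (λ Sv → [ (λ Sv′ → there (inD Sv′)) , (λ Tv → ⊥-elim (S∩T c′ xv v≢b Sv Tv)) ]′ (S∪T c xv))
      , λ Tv → other-part (Inner.parts i) (inB Tv) λ { refl → S∩T c xv v≢b Sw Tv }

  place-all : ∀ c (ws : List V) → Σ Config λ c′ → Improves c c′ × (∀ {w} → w ∈ ws → x ~ w → w ≢ b → Placed c′ w)
  place-all c []       = c , (λ _ _ h → h) , λ ()
  place-all c (w ∷ ws) with place c w
  ... | c′ , imp , pw with place-all c′ ws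
  ...   | c″ , imp′ , pws = c″ , (λ xv v≢b h → imp′ xv v≢b (imp xv v≢b h)) ,
    λ { (here refl) xw w≢b → imp′ xw w≢b (pw xw w≢b) ; (there w∈) → pws w∈ }

  -- Edges between the two sides of a settled configuration

  Settled : Config → Set
  Settled c = ∀ {w} → x ~ w → w ≢ b → Placed c w

  settled-revB : ∀ c → Settled c → Settled (revB c)
  settled-revB c σ xw w≢b = proj₁ (σ xw w≢b) , λ (h₁ , h₂) → proj₂ (σ xw w≢b) (h₂ , h₁)

  b∉B : ∀ c {t} → t ∈ B c → t ≢ b
  b∉B c t∈ t≡b = D∩B c (last∈ (pD c)) t∈ (sym t≡b)

  f₁∈T : ∀ c → InT c (f₁ c)
  f₁∈T c = inj₁ refl , f₁≃f₂ c

  T-clique : ∀ c {t t′} → x ~ t → x ~ t′ → ¬ InS c t → ¬ InS c t′ → t ≃ t′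
  T-clique c xt xt′ ¬S ¬S′ = thirdN (xd c) xt xt′ (λ h → ¬S (≃-sym h)) (λ h → ¬S′ (≃-sym h))

  B∌S : ∀ c → Settled c → ∀ {r} → x ~ r → r ∈ B c → ¬ InS c r
  B∌S c σ xr r∈ Sr = D∩B c (proj₁ (σ xr (b∉B c r∈)) Sr) r∈ refl

  B⊆T : ∀ c → Settled c → ∀ {r} → x ~ r → r ∈ B c → InT c r
  B⊆T c σ xr r∈ with S∪T c xr
  ... | inj₁ Sr = ⊥-elim (B∌S c σ xr r∈ Sr)
  ... | inj₂ Tr = Tr

  D∌T : ∀ c → Settled c → ∀ {r} → x ~ r → r ∈ D c → r ≢ b → InS c r
  D∌T c σ xr r∈ r≢b with S∪T c xr
  ... | inj₁ Sr = Sr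
  ... | inj₂ Tr = ⊥-elim (D∩B c r∈ (proj₂ (σ xr r≢b) Tr) refl)

  good-route : ∀ {e₁ e₂ K t} → Unique K → x ∉ K → Route e₁ e₂ K → x ~ e₁ → x ~ e₂ → e₁ ≃ e₂ →
               x ~ t → t ≃ e₁ → t ∈ K → Good t K
  good-route U x∉ k xe₁ xe₂ ee xt te t∈ with good U x∉ k xe₁ xe₂ ee xt te t∈
  ... | inj₁ g              = g
  ... | inj₂ (_ , inj₁ ¬Op) = ⊥-elim (¬Op tt)
  ... | inj₂ (_ , inj₂ ¬Oq) = ⊥-elim (¬Oq tt)

  x∉B : ∀ c → x ∉ B c
  x∉B c x∈ = x∉L (tiles-∈ (D c ∷ B c ∷ []) (cov c) 1F x∈)

  good-B : ∀ c {t} → x ~ t → InT c t → t ∈ B c → Good t (B c)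
  good-B c xt Tt t∈ = good-route (tiles-unique _ UL (cov c) 1F) (x∉B c) (pB c) (xf₁ c) (xf₂ c)
    (f₁≃f₂ c) xt (proj₁ Tt) t∈

  record Cross (c : Config) (s t : V) : Set where
    constructor crossing
    field
      xs  : x ~ s
      Ss  : InS c s
      s≢b : s ≢ b
      xt  : x ~ t
      Tt  : InT c t
      t≢b : t ≢ b
      s~t : s ~ t

  d≁T : ∀ c → Settled c → ∀ {t} → x ~ t → InT c t → t ≢ b → ¬ (d c ~ t)
  d≁T c σ xt Tt t≢b e with good-B c xt Tt (proj₂ (σ xt t≢b) Tt)
  ... | r , xr , k = kill (cov c) (piece Γ 1F (rev k) ⟨ ~-sym e ⟩ piece Γ 0F (pD c)) xr
    where Γ = D c ∷ B c ∷ []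

  abstract
    cross-inner : ∀ c → Settled c → ∀ {s t} → Cross c s t → Inner (d c) b s (D c)
    cross-inner c σ χ with position (pD c) (proj₁ (σ (Cross.xs χ) (Cross.s≢b χ)) (Cross.Ss χ))
    ... | inj₁ refl       = ⊥-elim (d≁T c σ (Cross.xt χ) (Cross.Tt χ) (Cross.t≢b χ) (Cross.s~t χ))
    ... | inj₂ (inj₁ s≡b) = ⊥-elim (Cross.s≢b χ s≡b)
    ... | inj₂ (inj₂ i)   = i

  module AtCross (c : Config) (σ : Settled c) {s t : V} (χ : Cross c s t)
    (i : Inner (d c) b s (D c)) where
    open Cross χ public
    open CutD c i public
    t∈ : t ∈ B c
    t∈ = proj₂ (σ xt t≢b) Tt
    abstract
      gt : Good t (B c)
      gt = good-B c xt Tt t∈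
    r : V
    r = proj₁ gt
    xr : x ~ r
    xr = proj₁ (proj₂ gt)
    t⇝r : Route t r (B c)
    t⇝r = proj₂ (proj₂ gt)
    R⁻ = piece Γ 3F (rev t⇝r)
    s~d : s ~ d c
    s~d = ≃⇒~ y≢d Ss
    p≁q : ¬ (p ~ q)
    p≁q e = kill τ (R⁻ ⟨ ~-sym s~t ⟩ Y ⟨ s~d ⟩ D₁ ⟨ e ⟩ D₂) xr
    q≁d : ¬ (q ~ d c)
    q≁d e = kill τ (R⁻ ⟨ ~-sym s~t ⟩ Y ⟨ ~-sym p~y ⟩ D₁ ⁻ ⟨ ~-sym e ⟩ D₂) xr
    p≁t : ¬ (p ~ t)
    p≁t e = kill τ (R⁻ ⟨ ~-sym e ⟩ D₁ ⁻ ⟨ ~-sym s~d ⟩ Y ⟨ y~q ⟩ D₂) xr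
    p≄q : ¬ (p ≃ q)
    p≄q (inj₁ e) = p≢q e
    p≄q (inj₂ e) = p≁q e
    -- The claw at `s` with leaves `p`, `q`, `t` must fail, and `p` is joined to neither of the
    -- others. Hence `B` can be entered from `s` or left to `q` at the same vertex `t`.
    q~t : q ~ t
    q~t = ≃⇒~ (q≢B t∈) (third′ (~-sym p~y) y~q s~t p≄q
      (λ { (inj₁ e) → p≢B t∈ e ; (inj₂ e) → p≁t e }))
    x~q⇒q≡b : x ~ q → q ≡ b
    x~q⇒q≡b xq with q ≟ⱽ b
    ... | yes e  = e
    ... | no q≢b with D∌T c σ xq (tiles-∈ (l₁ ∷ (s ∷ []) ∷ l₂ ∷ []) parts 2F (first∈ after)) q≢b
    ...   | inj₁ e = ⊥-elim (q≢d e)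
    ...   | inj₂ e = ⊥-elim (q≁d e)
    x~p : ¬ (x ~ q) → x ~ p
    x~p xq = decidable-stable (x ~? p) λ xp → p≄q (third′ (~-sym xs) (~-sym p~y) y~q
      (λ { (inj₁ e) → p≢x e ; (inj₂ e) → xp e }) (λ { (inj₁ e) → q≢x e ; (inj₂ e) → xq e }))

  T-adj : ∀ c → Settled c → ∀ {t r} → x ~ t → x ~ r → t ∈ B c → r ∈ B c → t ≢ r → t ~ r
  T-adj c σ xt xr t∈ r∈ t≢r = ≃⇒~ t≢r (T-clique c xt xr (B∌S c σ xt t∈) (B∌S c σ xr r∈))

  -- Otherwise `t` centres a claw with leaves `s`, `o`, `o′`: an edge from `s` to `o` or `o′` lets
  -- the path run from `s` through the rest of `B` to `t` and on to `q`. So `t` can be skipped on a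
  -- closed tour of `B`.
  bypass : ∀ c → Settled c → ∀ {s t} → Cross c s t → ∀ {o o′ m} → Tiles ((t ∷ []) ∷ m ∷ []) (B c) →
           Route o o′ m → o′ ~ t → t ~ o → o ≃ o′
  bypass c σ {s} {t} χ {o} {o′} {m} β k o′~t t~o = third′ (~-sym s~t) t~o (~-sym o′~t)
    (λ { (inj₁ e) → s≢ o (first∈ k) e
       ; (inj₂ e) → kill τ′ (E₁ ⟨ p~y ⟩ S ⟨ e ⟩ K ⟨ o′~t ⟩ Z ⟨ ~-sym q~t ⟩ E₂) (xd c) })
    (λ { (inj₁ e) → s≢ o′ (last∈ k) e
       ; (inj₂ e) → kill τ′ (E₁ ⟨ p~y ⟩ S ⟨ e ⟩ K ⁻ ⟨ ~-sym t~o ⟩ Z ⟨ ~-sym q~t ⟩ E₂) (xd c) })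
    where
    i = cross-inner c σ χ
    open AtCross c σ χ i
    Γ′ : Vec (List V) 5
    Γ′ = (t ∷ []) ∷ m ∷ l₁ ∷ (s ∷ []) ∷ l₂ ∷ []
    τ′ : Tiles Γ′ L
    τ′ = tiles-split β (tiles (↭-trans (layout (tiles-swap (cov c))) (++⁺ˡ (B c)
           (↭-trans (++⁺ʳ [] (layout parts)) (↭-reflexive (List.++-identityʳ _))))))
    Z  = piece Γ′ 0F (point t)
    K  = piece Γ′ 1F k
    E₁ = piece Γ′ 2F before
    S  = piece Γ′ 3F (point s)
    E₂ = piece Γ′ 4F after
    s≢ : ∀ o → o ∈ m → s ≢ o
    s≢ o o∈ = tiles-apart Γ′ UL τ′ 3F 1F (here refl) o∈

  -- `bypass` takes `t` out of `B`. What is left can be rearranged into a route from `t′` to a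
  -- neighbour `r` of `x`, and `t ~ r` because N(x) meets `B` in a clique.
  link-inner : ∀ c → Settled c → ∀ {s t} → Cross c s t → ∀ {t′} → x ~ t′ → t′ ∈ B c → t ≢ t′ →
               Inner (f₁ c) (f₂ c) t (B c) → Route t t′ (B c)
  link-inner c σ {s} {t} χ {t′} xt′ t′∈ t≢t′ i = whole parts
    (piece Δ 1F (point t) ⟨ t~r ⟩ seg (resp regroup (rev t′⇝r)))
    where
    open Cross χ using (xt; Tt; t≢b)
    open CutB c i
    Δ : Vec (List V) 3
    Δ = l₁ ∷ (t ∷ []) ∷ l₂ ∷ []
    k : Route q p (l₂ ++ l₁)
    k = join after (~-sym f₁~f₂) before
    β : Tiles ((t ∷ []) ∷ (l₂ ++ l₁) ∷ []) (B c)
    β = tiles (↭-trans (layout parts) (↭-trans (shift t l₁ _)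
          (prep t (↭-trans (↭-reflexive (cong (l₁ ++_) (List.++-identityʳ l₂)))
            (↭-trans (++-comm l₁ l₂) (↭-reflexive (sym (List.++-identityʳ _))))))))
    p~q : p ~ q
    p~q = ≃⇒~ p≢q (≃-sym (bypass c σ χ β k p~y y~q))
    K = l₁ ++ l₂
    K⊆B : ∀ {v} → v ∈ K → v ∈ B c
    K⊆B v∈ with ∈-++⁻ l₁ v∈
    ... | inj₁ v∈₁ = tiles-∈ Δ parts 0F v∈₁
    ... | inj₂ v∈₂ = tiles-∈ Δ parts 2F v∈₂
    UB : Unique (B c)
    UB = tiles-unique _ UL (cov c) 1F
    UtK : Unique ((t ∷ []) ++ (l₂ ++ l₁) ++ [])
    UtK = Unique-resp-↭ (layout β) UB
    UK : Unique K
    UK = Unique-resp-↭ (↭-trans (↭-reflexive (List.++-identityʳ _)) (++-comm l₂ l₁))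
           (proj₂ (Unique-++⁻ (t ∷ []) UtK))
    g : Good t′ K
    g = good-route UK (λ x∈ → x∉B c (K⊆B x∈)) (join before p~q after) (xf₁ c) (xf₂ c) (f₁≃f₂ c) xt′
          (proj₁ (B⊆T c σ xt′ t′∈)) (other-part parts t′∈ (λ e → t≢t′ (sym e)))
    r = proj₁ g
    t′⇝r : Route t′ r K
    t′⇝r = proj₂ (proj₂ g)
    t≢r : t ≢ r
    t≢r = Unique-++-apart (t ∷ []) UtK (here refl)
      (∈-resp-↭ (↭-trans (++-comm l₁ l₂) (↭-reflexive (sym (List.++-identityʳ _)))) (last∈ t′⇝r))
    t~r : t ~ r
    t~r = T-adj c σ xt (proj₁ (proj₂ g)) (proj₂ (σ xt t≢b) Tt) (K⊆B (last∈ t′⇝r)) t≢r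
    regroup : l₁ ++ l₂ ↭ pile Δ (1 ∷ 0 ∷ 1 ∷ [])
    regroup = ↭-reflexive (cong (l₁ ++_) (sym (List.++-identityʳ l₂)))

  -- Here `t` is the end `f₁`. Without it `B` is a route from `g` to `f₂`, and `bypass` joins these
  -- two ends; this cycle is then cut next to `t′`, or at its closing edge once `t′` is taken out.
  link-end : ∀ c → Settled c → ∀ {s} → Cross c s (f₁ c) → ∀ {t′} → x ~ t′ → t′ ∈ B c → f₁ c ≢ t′ →
             Route (f₁ c) t′ (B c)
  link-end c σ {s} χ {t′} xt′ t′∈ f₁≢t′ with t′ ≟ⱽ f₂ c
  ... | yes refl  = pB c
  ... | no t′≢f₂ with position (pB c) t′∈
  ...   | inj₁ e        = ⊥-elim (f₁≢t′ (sym e))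
  ...   | inj₂ (inj₁ e) = ⊥-elim (t′≢f₂ e)
  ...   | inj₂ (inj₂ j) with uncons (pB c) f₁≢f₂
    where
    f₁≢f₂ : f₁ c ≢ f₂ c
    f₁≢f₂ = tiles-apart _ (tiles-unique _ UL (cov c) 1F) (Inner.parts j) 0F 2F
              (first∈ (Inner.before j)) (last∈ (Inner.after j))
  ...     | g , m , f₁~g , k , β = go-on (position k t′∈m)
    where
    UB : Unique (B c)
    UB = tiles-unique _ UL (cov c) 1F
    Δ₀ : Vec (List V) 2
    Δ₀ = (f₁ c ∷ []) ∷ m ∷ []
    f₁~f₂ : f₁ c ~ f₂ c
    f₁~f₂ = ≃⇒~ (tiles-apart Δ₀ UB β 0F 1F (here refl) (last∈ k)) (f₁≃f₂ c)
    t′∈m : t′ ∈ m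
    t′∈m with ∈-resp-↭ (layout β) t′∈
    ... | here e   = ⊥-elim (f₁≢t′ (sym e))
    ... | there v∈ = subst (t′ ∈_) (List.++-identityʳ m) v∈
    go-on : t′ ≡ g ⊎ t′ ≡ f₂ c ⊎ Inner g (f₂ c) t′ m → Route (f₁ c) t′ (B c)
    go-on (inj₁ refl)        = whole β (piece Δ₀ 0F (point _) ⟨ f₁~f₂ ⟩ piece Δ₀ 1F (rev k))
    go-on (inj₂ (inj₁ e))    = ⊥-elim (t′≢f₂ e)
    go-on (inj₂ (inj₂ (inner {p} {q} {m₁} {m₂} b′ p~t′ t′~q a′ μ))) = cases
      where
      Δ : Vec (List V) 4
      Δ = m₁ ∷ (t′ ∷ []) ∷ m₂ ∷ (f₁ c ∷ []) ∷ []
      δ : Tiles Δ (B c)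
      δ = tiles-split μ (tiles-swap β)
      M₁ = piece Δ 0F b′
      T′ = piece Δ 1F (point t′)
      M₂ = piece Δ 2F a′
      F  = piece Δ 3F (point (f₁ c))
      g~f₂ : g ~ f₂ c
      g~f₂ = ≃⇒~ (tiles-apart Δ UB δ 0F 2F (first∈ b′) (last∈ a′))
                 (bypass c σ χ β k (~-sym f₁~f₂) f₁~g)
      t′~f₂ : t′ ~ f₂ c
      t′~f₂ = ≃⇒~ t′≢f₂ (proj₂ (B⊆T c σ xt′ t′∈))
      p≢q : p ≢ q
      p≢q = tiles-apart Δ UB δ 0F 2F (last∈ b′) (first∈ a′)
      p∈ : p ∈ B c
      p∈ = tiles-∈ Δ δ 0F (last∈ b′)
      q∈ : q ∈ B c
      q∈ = tiles-∈ Δ δ 2F (first∈ a′)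
      f₁~p : x ~ p → f₁ c ~ p
      f₁~p xp = T-adj c σ (xf₁ c) xp (first∈ (pB c)) p∈ (tiles-apart Δ UB δ 3F 0F (here refl) (last∈ b′))
      f₁~q : x ~ q → f₁ c ~ q
      f₁~q xq = T-adj c σ (xf₁ c) xq (first∈ (pB c)) q∈ (tiles-apart Δ UB δ 3F 2F (here refl) (first∈ a′))
      cases : Route (f₁ c) t′ (B c)
      cases with x ~? p | x ~? q
      ... | yes xp | _      = whole δ (F ⟨ f₁~p xp ⟩ M₁ ⁻ ⟨ g~f₂ ⟩ M₂ ⁻ ⟨ ~-sym t′~q ⟩ T′)
      ... | no _   | yes xq = whole δ (F ⟨ f₁~q xq ⟩ M₂ ⟨ ~-sym g~f₂ ⟩ M₁ ⟨ p~t′ ⟩ T′)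
      -- With neither neighbour of `t′` seeing `x`, the absence of a claw at `t′` joins them, and
      -- `t′` is free to become the last vertex.
      ... | no xp  | no xq  = whole δ (F ⟨ f₁~g ⟩ M₁ ⟨ p~q ⟩ M₂ ⟨ ~-sym t′~f₂ ⟩ T′)
        where
        p~q : p ~ q
        p~q = ≃⇒~ p≢q (third′ (~-sym xt′) (~-sym p~t′) t′~q
          (λ { (inj₁ refl) → x∉B c p∈ ; (inj₂ e) → xp e })
          (λ { (inj₁ refl) → x∉B c q∈ ; (inj₂ e) → xq e }))

  link : ∀ c → Settled c → ∀ {s t} → Cross c s t → ∀ {t′} → x ~ t′ → t′ ∈ B c → t ≢ t′ → Route t t′ (B c)
  link c σ χ xt′ t′∈ t≢t′ with position (pB c) (proj₂ (σ (Cross.xt χ) (Cross.t≢b χ)) (Cross.Tt χ))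
  ... | inj₁ refl        = link-end c σ χ xt′ t′∈ t≢t′
  ... | inj₂ (inj₁ refl) = link-end (revB c) (settled-revB c σ)
    (record { xs = xs ; Ss = Ss ; s≢b = s≢b ; xt = xt ; Tt = proj₂ Tt , proj₁ Tt ; t≢b = t≢b ; s~t = s~t })
    xt′ t′∈ t≢t′
    where open Cross χ
  ... | inj₂ (inj₂ i)    = link-inner c σ χ xt′ t′∈ t≢t′ i

  -- From `x` the forbidden path goes to `s`, back along `D` to `d`, over to `s′`, back to the
  -- successor of `s`, through `B` from `t` to `t′`, and on from the successor of `s′` to `b`.
  two-crosses-ordered : ∀ c (σ : Settled c) {s t s′ t′} → Cross c s t → (χ′ : Cross c s′ t′) →
                        Route t t′ (B c) → ¬ Ordered (d c) b s s′ (D c)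
  two-crosses-ordered c σ {s} {t} {s′} {t′} χ χ′ t⇝t′ o =
    kill τ (S ⟨ ~-sym p~s ⟩ E₁ ⁻ ⟨ ~-sym K′.s~d ⟩ E₂ ⁻ ⟨ K.q~t ⟩ T ⟨ ~-sym K′.q~t ⟩ E₃) K.xs
    where
    open Ordered o
    module K  = AtCross c σ χ inner₁
    module K′ = AtCross c σ χ′ inner₂
    Γ : Vec (List V) 5
    Γ = l₁ ∷ (s ∷ []) ∷ l₂ ∷ l₃ ∷ B c ∷ []
    τ : Tiles Γ L
    τ = tiles-split parts (cov c)
    E₁ = piece Γ 0F before
    S  = piece Γ 1F (point s)
    E₂ = piece Γ 2F middle
    E₃ = piece Γ 3F after
    T  = piece Γ 4F t⇝t′

  -- For `t ≢ t′` the segment `B` has a spanning route between them. If `s` and `s′` coincide, it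
  -- fits between `s` and its successor; if not, their order on `D` decides which crossing comes
  -- first.
  two-crosses : ∀ c → Settled c → ∀ {s t s′ t′} → Cross c s t → Cross c s′ t′ → t ≡ t′
  two-crosses c σ {s} {t} {s′} {t′} χ χ′ = decidable-stable (t ≟ⱽ t′) absurd
    where
    open Cross χ′ using () renaming (xt to xt′; Tt to Tt′; t≢b to t′≢b)
    i  = cross-inner c σ χ
    i′ = cross-inner c σ χ′
    absurd : ¬ (t ≢ t′)
    absurd t≢t′ with s ≟ⱽ s′
    ... | yes refl = kill K.τ (K.D₁ ⟨ K.p~y ⟩ K.Y ⟨ K.s~t ⟩ piece K.Γ 3F t⇝t′ ⟨ ~-sym K′.q~t ⟩ K.D₂) (xd c)
      where
      module K  = AtCross c σ χ i
      module K′ = AtCross c σ χ′ i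
      t⇝t′ = link c σ χ xt′ K′.t∈ t≢t′
    ... | no s≢s′ with order (tiles-unique _ UL (cov c) 0F) i i′ s≢s′
    ...   | inj₁ o = two-crosses-ordered c σ χ χ′ t⇝t′ o
      where t⇝t′ = link c σ χ xt′ (proj₂ (σ xt′ t′≢b) Tt′) t≢t′
    ...   | inj₂ o = two-crosses-ordered c σ χ′ χ t′⇝t o
      where
      open Cross χ
      t′⇝t = link c σ χ′ xt (proj₂ (σ xt t≢b) Tt) (λ e → t≢t′ (sym e))

  -- The end `b` in the presence of a crossing

  module BeforeEnd (c : Config) (σ : Settled c) {s t : V} (χ : Cross c s t)
    (q≢b : Inner.q (cross-inner c σ χ) ≢ b) where
    open AtCross c σ χ (cross-inner c σ χ) public hiding (Γ; τ; D₁; D₂; Y; F; R⁻; ∈L)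
    x≁q : ¬ (x ~ q)
    x≁q xq = q≢b (x~q⇒q≡b xq)
    xp : x ~ p
    xp = x~p x≁q
    abstract
      tail : ∃ λ p → ∃ λ m → b ~ p × Route p q m × Tiles ((b ∷ []) ∷ m ∷ []) l₂
      tail = uncons (rev after) (λ e → q≢b (sym e))
    z : V
    z = proj₁ tail
    m : List V
    m = proj₁ (proj₂ tail)
    b~z : b ~ z
    b~z = proj₁ (proj₂ (proj₂ tail))
    q⇝z : Route q z m
    q⇝z = rev (proj₁ (proj₂ (proj₂ (proj₂ tail))))
    Γ : Vec (List V) 5
    Γ = m ∷ (b ∷ []) ∷ l₁ ∷ (s ∷ []) ∷ B c ∷ []
    τ : Tiles Γ L
    τ = tiles (↭-trans (layout (cov c)) (↭-trans (++⁺ʳ (B c ++ []) (layout parts)) regroup))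
      where
      regroup : (l₁ ++ s ∷ l₂ ++ []) ++ B c ++ [] ↭ m ++ b ∷ l₁ ++ s ∷ B c ++ []
      regroup = begin
        (l₁ ++ s ∷ l₂ ++ []) ++ B c ++ []    ≡⟨ cong (λ k → (l₁ ++ s ∷ k) ++ B c ++ []) (List.++-identityʳ l₂) ⟩
        (l₁ ++ s ∷ l₂) ++ B c ++ []          ≡⟨ cong (_++ B c ++ []) (List.++-assoc l₁ (s ∷ []) l₂) ⟨
        ((l₁ ++ s ∷ []) ++ l₂) ++ B c ++ []  ≡⟨ List.++-assoc (l₁ ++ s ∷ []) l₂ _ ⟩
        (l₁ ++ s ∷ []) ++ l₂ ++ B c ++ []    ↭⟨ shifts (l₁ ++ s ∷ []) l₂ ⟩
        l₂ ++ (l₁ ++ s ∷ []) ++ B c ++ []    ↭⟨ ++⁺ʳ _ (layout (proj₂ (proj₂ (proj₂ (proj₂ tail))))) ⟩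
        (b ∷ m ++ []) ++ (l₁ ++ s ∷ []) ++ B c ++ []
                                             ≡⟨ cong (λ k → (b ∷ k) ++ (l₁ ++ s ∷ []) ++ B c ++ []) (List.++-identityʳ m) ⟩
        b ∷ m ++ (l₁ ++ s ∷ []) ++ B c ++ [] ↭⟨ shift b m _ ⟨
        m ++ b ∷ (l₁ ++ s ∷ []) ++ B c ++ [] ≡⟨ cong (λ k → m ++ b ∷ k) (List.++-assoc l₁ (s ∷ []) _) ⟩
        m ++ b ∷ l₁ ++ s ∷ B c ++ []         ∎
        where open PermutationReasoning
    l₂-parts : l₂ ++ [] ↭ b ∷ m
    l₂-parts = ↭-trans (↭-reflexive (List.++-identityʳ l₂))
      (↭-trans (layout (proj₂ (proj₂ (proj₂ (proj₂ tail))))) (↭-reflexive (cong (b ∷_) (List.++-identityʳ m))))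
    M  = piece Γ 0F q⇝z
    Z  = piece Γ 1F (point b)
    D₁ = piece Γ 2F before
    S  = piece Γ 3F (point s)
    F  = piece Γ 4F (pB c)
    R  = piece Γ 4F t⇝r
    z≢d : z ≢ d c
    z≢d = tiles-apart Γ UL τ 0F 2F (last∈ q⇝z) (first∈ before)
    z≢B : ∀ {f} → f ∈ B c → z ≢ f
    z≢B = tiles-apart Γ UL τ 0F 4F (last∈ q⇝z)
    M⊆D : ∀ {v} → v ∈ m → v ∈ D c
    M⊆D v∈ with ∈-++⁻ (D c) (∈-resp-↭ (layout (cov c)) (tiles-∈ Γ τ 0F v∈))
    ... | inj₁ v∈D = v∈D
    ... | inj₂ v∈B = ⊥-elim (tiles-apart Γ UL τ 0F 4F v∈ (subst (_ ∈_) (List.++-identityʳ (B c)) v∈B) refl)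
    M∌b : ∀ {v} → v ∈ m → v ≢ b
    M∌b v∈ = tiles-apart Γ UL τ 0F 1F v∈ (here refl)

  -- If both ends of `B` were `t`, then `B` would fit between `s` and `q`. The vertex `f` serves as
  -- a `T`-vertex without neighbours in `S`.
  another-end : ∀ c → Settled c → ∀ {s t} → Cross c s t → ∃ λ f → f ∈ B c × x ~ f × f ≢ t × (∀ {v} → InT c v → v ≃ f)
  another-end c σ {s} {t} χ with f₁ c ≟ⱽ t | f₂ c ≟ⱽ t
  ... | no f₁≢t  | _        = f₁ c , first∈ (pB c) , xf₁ c , f₁≢t , proj₁
  ... | yes _    | no f₂≢t  = f₂ c , last∈ (pB c) , xf₂ c , f₂≢t , proj₂
  ... | yes refl | yes f₂≡t =
    ⊥-elim (kill τ (D₁ ⟨ p~y ⟩ Y ⟨ s~t ⟩ F ⟨ subst (_~ q) (sym f₂≡t) (~-sym q~t) ⟩ D₂) (xd c))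
    where open AtCross c σ χ (cross-inner c σ χ)

  -- Let `z` be the neighbour of `b` on `D`. If `z ~ d`, a spanning path can start at `p` and
  -- traverse `B` from `t` to `t′` just before `b`. If not, the absence of a claw at `b` with leaves
  -- `d`, `z`, `t′` gives `z ~ t′`, and a path can start in `B`.
  b∈S-single : ∀ c → Settled c → ∀ {s t} → Cross c s t → x ~ b → InS c b →
               ∀ {t′} → x ~ t′ → InT c t′ → t′ ≢ b → b ~ t′ → t ≡ t′
  b∈S-single c σ {s} {t} χ xb Sb {t′} xt′ Tt′ t′≢b b~t′ = decidable-stable (t ≟ⱽ t′) absurd
    where
    module K = AtCross c σ χ (cross-inner c σ χ)
    b~d : b ~ d c
    b~d = ≃⇒~ (λ e → K.d≢b (sym e)) Sb
    open BeforeEnd c σ χ (λ e → K.q≁d (subst (_~ d c) (sym e) b~d))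
    t′∈ = proj₂ (σ xt′ t′≢b) Tt′
    absurd : ¬ (t ≢ t′)
    absurd t≢t′ with z ~? d c
    ... | yes zd = kill τ (D₁ ⁻ ⟨ ~-sym zd ⟩ M ⁻ ⟨ ~-sym y~q ⟩ S ⟨ s~t ⟩ T ⟨ ~-sym b~t′ ⟩ Z) xp
      where T = piece Γ 4F (link c σ χ xt′ t′∈ t≢t′)
    ... | no z≁d with good-B c xt′ Tt′ t′∈
    ...   | r′ , xr′ , k =
      kill τ (piece Γ 4F (rev k) ⟨ ~-sym z~t′ ⟩ M ⁻ ⟨ ~-sym y~q ⟩ S ⟨ ~-sym p~y ⟩ D₁ ⁻ ⟨ ~-sym b~d ⟩ Z) xr′
      where
      z~t′ : z ~ t′
      z~t′ = ≃⇒~ (z≢B t′∈) (third′ b~d b~z b~t′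
        (λ { (inj₁ e) → z≢d (sym e) ; (inj₂ e) → z≁d (~-sym e) })
        (λ { (inj₁ e) → D∩B c (first∈ (pD c)) t′∈ e ; (inj₂ e) → d≁T c σ xt′ Tt′ t′≢b e }))

  -- If `b` directly follows `s` on `D`, then `B` fits between them. Otherwise let `z` be the
  -- neighbour of `b` on `D`. Excluding claws at `b` joins `z` to `s′` and to every other neighbour
  -- of `b` outside N[x]. With these links each possible position of `s′` on `D` admits a spanning
  -- path.
  b∈T-single : ∀ c → Settled c → ∀ {s t} → Cross c s t → x ~ b → InT c b → ¬ InS c b →
               ∀ {s′} → x ~ s′ → InS c s′ → s′ ≢ b → ¬ (s′ ~ b)
  b∈T-single c σ {s} {t} χ xb Tb ¬Sb {s′} xs′ Ss′ s′≢b s′~b with Inner.q (cross-inner c σ χ) ≟ⱽ b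
  ... | yes q≡b = kill τ (D₁ ⟨ p~y ⟩ Y ⟨ s~t ⟩ piece Γ 3F t⇝r ⟨ subst (r ~_) (sym q≡b) r~b ⟩ D₂) (xd c)
    where
    open AtCross c σ χ (cross-inner c σ χ)
    r~b : r ~ b
    r~b = ≃⇒~ (b∉B c (last∈ t⇝r)) (T-clique c xr xb (B∌S c σ xr (last∈ t⇝r)) ¬Sb)
  ... | no q≢b = cases (s′ ≟ⱽ s)
    where
    open BeforeEnd c σ χ q≢b
    r~b : r ~ b
    r~b = ≃⇒~ (b∉B c (last∈ t⇝r)) (T-clique c xr xb (B∌S c σ xr (last∈ t⇝r)) ¬Sb)
    z≁f₁ : ¬ (z ~ f₁ c)
    z≁f₁ e = kill τ (D₁ ⟨ p~y ⟩ S ⟨ y~q ⟩ M ⟨ e ⟩ F ⟨ ~-sym b~f₂ ⟩ Z) (xd c)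
      where
      b~f₂ : b ~ f₂ c
      b~f₂ = ≃⇒~ (λ e → b∉B c (last∈ (pB c)) (sym e)) (proj₂ Tb)
    z≁f₂ : ¬ (z ~ f₂ c)
    z≁f₂ e = kill τ (D₁ ⟨ p~y ⟩ S ⟨ y~q ⟩ M ⟨ e ⟩ F ⁻ ⟨ ~-sym b~f₁ ⟩ Z) (xd c)
      where
      b~f₁ : b ~ f₁ c
      b~f₁ = ≃⇒~ (λ e → b∉B c (first∈ (pB c)) (sym e)) (proj₁ Tb)
    z≁d : ¬ (z ~ d c)
    z≁d e = kill τ (D₁ ⁻ ⟨ ~-sym e ⟩ M ⁻ ⟨ ~-sym y~q ⟩ S ⟨ s~t ⟩ R ⟨ r~b ⟩ Z) xp
    M≁x : ∀ {v} → v ∈ m → ¬ (v ~ d c) → ¬ (x ~ v)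
    M≁x v∈ v≁d xv with D∌T c σ xv (M⊆D v∈) (M∌b v∈)
    ... | inj₁ e = tiles-apart Γ UL τ 0F 2F v∈ (first∈ before) e
    ... | inj₂ e = v≁d e
    x≁z : ¬ (x ~ z)
    x≁z = M≁x (last∈ q⇝z) z≁d
    x≄z : ¬ (x ≃ z)
    x≄z (inj₁ e) = x∉L (subst (_∈ L) (sym e) (tiles-∈ Γ τ 0F (last∈ q⇝z)))
    x≄z (inj₂ e)    = x≁z e
    s′≢z : s′ ≢ z
    s′≢z e = x≁z (subst (x ~_) e xs′)
    s′≢B : ∀ {f} → f ∈ B c → s′ ≢ f
    s′≢B f∈ = D∩B c (proj₁ (σ xs′ s′≢b) Ss′) f∈
    z~s′ : z ~ s′
    z~s′ with s′ ~? f₁ c | s′ ~? f₂ c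
    ... | no ¬e | _ = ≃⇒~ (λ e → s′≢z (sym e)) (third′
      (≃⇒~ (λ e → b∉B c (first∈ (pB c)) (sym e)) (proj₁ Tb)) b~z (~-sym s′~b)
      (λ { (inj₁ e) → z≢B (first∈ (pB c)) (sym e) ; (inj₂ e) → z≁f₁ (~-sym e) })
      (λ { (inj₁ e) → s′≢B (first∈ (pB c)) (sym e) ; (inj₂ e) → ¬e (~-sym e) }))
    ... | yes _ | no ¬e = ≃⇒~ (λ e → s′≢z (sym e)) (third′
      (≃⇒~ (λ e → b∉B c (last∈ (pB c)) (sym e)) (proj₂ Tb)) b~z (~-sym s′~b)
      (λ { (inj₁ e) → z≢B (last∈ (pB c)) (sym e) ; (inj₂ e) → z≁f₂ (~-sym e) })
      (λ { (inj₁ e) → s′≢B (last∈ (pB c)) (sym e) ; (inj₂ e) → ¬e (~-sym e) }))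
    ... | yes e | yes e′ = ⊥-elim (S∩T c xs′ s′≢b Ss′ (inj₂ e , inj₂ e′))
    d≄b : ¬ (d c ≃ b)
    d≄b h = ¬Sb (≃-sym h)
    near-b : ∀ {o} → o ∈ L → o ≢ z → ¬ (x ~ o) → b ~ o → o ~ z
    near-b o∈ o≢z x≁o b~o = ≃⇒~ o≢z (third′ (~-sym xb) b~o b~z
      (λ { (inj₁ refl) → x∉L o∈ ; (inj₂ e) → x≁o e }) x≄z)
    s~s′ : s ≢ s′ → s ~ s′
    s~s′ s≢s′ with another-end c σ χ
    ... | f , f∈ , xf , f≢t , _ = ≃⇒~ s≢s′ (thirdN xf xs xs′
      (λ { (inj₁ e) → D∩B c (proj₁ (σ xs s≢b) Ss) f∈ (sym e)
         ; (inj₂ e) → f≢t (sym (two-crosses c σ χ (χ→ xs Ss s≢b (~-sym e)))) })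
      (λ { (inj₁ e) → s′≢B f∈ (sym e)
         ; (inj₂ e) → f≢t (sym (two-crosses c σ χ (χ→ xs′ Ss′ s′≢b (~-sym e)))) }))
      where
      χ→ : ∀ {u} → x ~ u → InS c u → u ≢ b → u ~ f → Cross c u f
      χ→ xu Su u≢b e = crossing xu Su u≢b xf (B⊆T c σ xf f∈) (b∉B c f∈) e

    in-D₁ : Inner (d c) p s′ l₁ → ⊥
    in-D₁ (inner {o} {o′} {k₁} {k₂} b₁ o~s′ s′~o′ a₁ κ) = finish (x ~? o′) (o′ ~? d c)
      where
      Δ : Vec (List V) 7
      Δ = k₁ ∷ (s′ ∷ []) ∷ k₂ ∷ m ∷ (b ∷ []) ∷ (s ∷ []) ∷ B c ∷ []
      δ : Tiles Δ L
      δ = tiles-split κ (tiles-third τ)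
      A₁ = piece Δ 0F b₁
      W  = piece Δ 1F (point s′)
      A₂ = piece Δ 2F a₁
      N  = piece Δ 3F q⇝z
      Z′ = piece Δ 4F (point b)
      S′ = piece Δ 5F (point s)
      R′ = piece Δ 6F t⇝r
      s′~d : s′ ~ d c
      s′~d = ≃⇒~ (tiles-apart Δ UL δ 1F 0F (here refl) (first∈ b₁)) Ss′
      finish : Dec (x ~ o′) → Dec (o′ ~ d c) → ⊥
      finish (yes xo′) _ =
        kill δ (A₂ ⟨ p~y ⟩ S′ ⟨ s~d ⟩ A₁ ⟨ o~s′ ⟩ W ⟨ ~-sym z~s′ ⟩ N ⁻ ⟨ q~t ⟩ R′ ⟨ r~b ⟩ Z′) xo′
      finish (no _) (yes o′~d) =
        kill δ (S′ ⟨ ~-sym p~y ⟩ A₂ ⁻ ⟨ o′~d ⟩ A₁ ⟨ o~s′ ⟩ W ⟨ ~-sym z~s′ ⟩ N ⁻ ⟨ q~t ⟩ R′ ⟨ r~b ⟩ Z′) xs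
      finish (no x≁o′) (no o′≁d) =
        kill δ (W ⟨ ~-sym o~s′ ⟩ A₁ ⁻ ⟨ ~-sym s~d ⟩ S′ ⟨ ~-sym p~y ⟩ A₂ ⁻ ⟨ o′~z ⟩ N ⁻ ⟨ q~t ⟩ R′ ⟨ r~b ⟩ Z′) xs′
        where
        o′~b : o′ ~ b
        o′~b = ≃⇒~ (tiles-apart Δ UL δ 2F 4F (first∈ a₁) (here refl)) (third′ s′~d s′~o′ s′~b
          (λ { (inj₁ e) → tiles-apart Δ UL δ 0F 2F (first∈ b₁) (first∈ a₁) e ; (inj₂ e) → o′≁d (~-sym e) }) d≄b)
        o′~z : o′ ~ z
        o′~z = near-b (tiles-∈ Δ δ 2F (first∈ a₁)) (tiles-apart Δ UL δ 2F 3F (first∈ a₁) (last∈ q⇝z)) x≁o′ (~-sym o′~b)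

    in-M : s ≢ s′ → Inner q z s′ m → ⊥
    in-M s≢s′ (inner {o} {o′} {k₁} {k₂} b₁ o~s′ s′~o′ a₁ κ) = finish (o ~? d c)
      where
      Δ : Vec (List V) 7
      Δ = k₁ ∷ (s′ ∷ []) ∷ k₂ ∷ (b ∷ []) ∷ l₁ ∷ (s ∷ []) ∷ B c ∷ []
      δ : Tiles Δ L
      δ = tiles-split κ τ
      A₁ = piece Δ 0F b₁
      W  = piece Δ 1F (point s′)
      A₂ = piece Δ 2F a₁
      Z′ = piece Δ 3F (point b)
      N  = piece Δ 4F before
      S′ = piece Δ 5F (point s)
      R′ = piece Δ 6F t⇝r
      s′~d : s′ ~ d c
      s′~d = ≃⇒~ (tiles-apart Δ UL δ 1F 4F (here refl) (first∈ before)) Ss′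
      finish : Dec (o ~ d c) → ⊥
      finish (yes o~d) =
        kill δ (R′ ⁻ ⟨ ~-sym q~t ⟩ A₁ ⟨ o~d ⟩ N ⟨ p~y ⟩ S′ ⟨ s~s′ s≢s′ ⟩ W ⟨ s′~o′ ⟩ A₂ ⟨ ~-sym b~z ⟩ Z′) xr
      finish (no o≁d) =
        kill δ (N ⁻ ⟨ ~-sym s′~d ⟩ W ⟨ s′~o′ ⟩ A₂ ⟨ ~-sym o~z ⟩ A₁ ⁻ ⟨ ~-sym y~q ⟩ S′ ⟨ s~t ⟩ R′ ⟨ r~b ⟩ Z′) xp
        where
        o~b : o ~ b
        o~b = ≃⇒~ (tiles-apart Δ UL δ 0F 3F (last∈ b₁) (here refl)) (third′ s′~d (~-sym o~s′) s′~b
          (λ { (inj₁ e) → tiles-apart Δ UL δ 4F 0F (first∈ before) (last∈ b₁) e ; (inj₂ e) → o≁d (~-sym e) }) d≄b)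
        o∈m : o ∈ m
        o∈m = tiles-∈ (k₁ ∷ (s′ ∷ []) ∷ k₂ ∷ []) κ 0F (last∈ b₁)
        o~z : o ~ z
        o~z = near-b (tiles-∈ Δ δ 0F (last∈ b₁)) (tiles-apart Δ UL δ 0F 2F (last∈ b₁) (last∈ a₁))
                     (M≁x o∈m o≁d) (~-sym o~b)

    cases : Dec (s′ ≡ s) → ⊥
    cases (yes refl) = kill τ (D₁ ⟨ p~y ⟩ S ⟨ ~-sym z~s′ ⟩ M ⁻ ⟨ q~t ⟩ R ⟨ r~b ⟩ Z) (xd c)
    cases (no s′≢s) with ∈-++⁻ l₁ (∈-resp-↭ (layout parts) (proj₁ (σ xs′ s′≢b) Ss′))
    ... | inj₂ (here e) = s′≢s e
    ... | inj₂ (there s′∈) with ∈-resp-↭ l₂-parts s′∈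
    ...   | here e = s′≢b e
    ...   | there s′∈m with position q⇝z s′∈m
    ...     | inj₁ e        = x≁q (subst (x ~_) e xs′)
    ...     | inj₂ (inj₁ e) = s′≢z e
    ...     | inj₂ (inj₂ i) = in-M (λ e → s′≢s (sym e)) i
    cases (no s′≢s) | inj₁ s′∈ with position before s′∈
    ... | inj₁ e        = z≁d (subst (z ~_) e z~s′)
    ... | inj₂ (inj₁ e) =
      kill τ (S ⟨ s~d ⟩ D₁ ⟨ ~-sym (subst (z ~_) e z~s′) ⟩ M ⁻ ⟨ q~t ⟩ R ⟨ r~b ⟩ Z) xs
    ... | inj₂ (inj₂ i) = in-D₁ i

  -- The exceptional vertex is `b` if every edge between the sides contains `b`, and otherwise the
  -- common `T`-end `t` of the crossings. In the latter case `b` itself can be on an edge between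
  -- the sides only as an `S`-vertex joined to `t`.
  outcome : Config → Separation x
  outcome c₀ with place-all c₀ L
  ... | c , _ , placed = decide (Any.any? (λ s → Any.any? (λ t → cross? s t) L) L)
    where
    σ : Settled c
    σ xw = placed (N⊆L xw) xw
    Cross′ : V → V → Set
    Cross′ s t = (x ~ s × InS c s × s ≢ b) × (x ~ t × InT c t × t ≢ b) × s ~ t
    cross? : ∀ s t → Dec (Cross′ s t)
    cross? s t = ((x ~? s) ×-dec (s ≃? d c) ×-dec ¬? (s ≟ⱽ b)) ×-dec
      ((x ~? t) ×-dec ((t ≃? f₁ c) ×-dec (t ≃? f₂ c)) ×-dec ¬? (t ≟ⱽ b)) ×-dec (s ~? t)
    f₁≢b : f₁ c ≢ b
    f₁≢b = b∉B c (first∈ (pB c))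
    decide : Dec (Any (λ s → Any (Cross′ s) L) L) → Separation x
    decide (no none) = record
      { w = b ; P = InS c ; R = InT c ; P? = λ v → v ≃? d c ; R? = λ v → (v ≃? f₁ c) ×-dec (v ≃? f₂ c)
      ; cover = S∪T c
      ; P-clique = λ xu xv Su Sv u≢b v≢b → thirdN (xf₁ c) xu xv
          (λ h → apart′ xu (xf₁ c) Su (f₁∈T c) u≢b f₁≢b (≃-sym h))
          (λ h → apart′ xv (xf₁ c) Sv (f₁∈T c) v≢b f₁≢b (≃-sym h))
      ; R-clique = λ xu xv Tu Tv u≢b v≢b → T-clique c xu xv (λ Su → S∩T c xu u≢b Su Tu) (λ Sv → S∩T c xv v≢b Sv Tv)
      ; apart = apart′ }
      where
      apart′ : ∀ {u v} → x ~ u → x ~ v → InS c u → InT c v → u ≢ b → v ≢ b → ¬ (u ≃ v)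
      apart′ xu xv Su Tv u≢b v≢b (inj₁ refl) = S∩T c xu u≢b Su Tv
      apart′ xu xv Su Tv u≢b v≢b (inj₂ e) =
        none (lose (N⊆L xu) (lose (N⊆L xv) ((xu , Su , u≢b) , (xv , Tv , v≢b) , e)))
    decide (yes some) with find some
    ... | s , _ , some′ with find some′
    ...   | t , _ , ((xs , Ss , s≢b) , (xt , Tt , t≢b) , s~t) = record
      { w = t ; P = InS c ; R = InT c ; P? = λ v → v ≃? d c ; R? = λ v → (v ≃? f₁ c) ×-dec (v ≃? f₂ c)
      ; cover = S∪T c
      ; P-clique = λ xu xv Su Sv _ _ → thirdN xf xu xv
          (λ h → S≄f xu Su (≃-sym h)) (λ h → S≄f xv Sv (≃-sym h))
      ; R-clique = λ xu xv Tu Tv _ _ → T-clique c xu xv (S∩T′ xu Tu) (S∩T′ xv Tv)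
      ; apart = λ { xu xv Su Tv _ v≢t (inj₁ refl) → S∩T′ xu Tv Su
                  ; xu xv Su Tv _ v≢t (inj₂ e) → S≁T xu xv Su Tv v≢t e } }
      where
      χ : Cross c s t
      χ = crossing xs Ss s≢b xt Tt t≢b s~t
      E = another-end c σ χ
      f = proj₁ E
      f∈ = proj₁ (proj₂ E)
      xf = proj₁ (proj₂ (proj₂ E))
      f≢t = proj₁ (proj₂ (proj₂ (proj₂ E)))
      T⇒≃f : ∀ {v} → InT c v → v ≃ f
      T⇒≃f = proj₂ (proj₂ (proj₂ (proj₂ E)))
      S≁B : ∀ {u v} → x ~ u → x ~ v → InS c u → InT c v → v ≢ b → v ≢ t → ¬ (u ~ v)
      S≁B {u} {v} xu xv Su Tv v≢b v≢t e with u ≟ⱽ b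
      ... | yes refl = v≢t (sym (b∈S-single c σ χ xu Su xv Tv v≢b e))
      ... | no u≢b   = v≢t (sym (two-crosses c σ χ (crossing xu Su u≢b xv Tv v≢b e)))
      S≁f : ∀ {u} → x ~ u → InS c u → ¬ (u ~ f)
      S≁f xu Su = S≁B xu xf Su (B⊆T c σ xf f∈) (b∉B c f∈) f≢t
      S≄f : ∀ {u} → x ~ u → InS c u → ¬ (u ≃ f)
      S≄f xu Su (inj₁ refl) = B∌S c σ xu f∈ Su
      S≄f xu Su (inj₂ e)    = S≁f xu Su e
      S∩T′ : ∀ {v} → x ~ v → InT c v → ¬ InS c v
      S∩T′ xv Tv Sv = S≄f xv Sv (T⇒≃f Tv)
      S≁T : ∀ {u v} → x ~ u → x ~ v → InS c u → InT c v → v ≢ t → ¬ (u ~ v)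
      S≁T {u} {v} xu xv Su Tv v≢t e with v ≟ⱽ b
      ... | no v≢b   = S≁B xu xv Su Tv v≢b v≢t e
      ... | yes refl = b∈T-single c σ χ xv Tv (S∩T′ xv Tv) xu Su (λ { refl → ~-irr e }) e

-- Paths of a local completion

Unique-∷⁻ : ∀ {A : Set} {u : A} {l} → Unique (u ∷ l) → u ∉ l × Unique l
Unique-∷⁻ (p ∷ U) = (λ u∈ → All.lookup p u∈ refl) , U

module Neighbours {n : ℕ} (G : Graph n) where

  _~_ : Fin n → Fin n → Set
  _~_ = Adj G

  ~-sym : ∀ {u v} → u ~ v → v ~ u
  ~-sym {u} {v} e = trans (symm G v u) e

  ~-irr : ∀ {v} → ¬ (v ~ v)
  ~-irr {v} e with trans (sym e) (irrefl G v)
  ... | ()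

  _~?_ : ∀ u v → Dec (u ~ v)
  u ~? v = adj G u v Bool.≟ true

  adjacency : Adjacency
  adjacency = record { V = Fin n ; _≟ⱽ_ = _≟_ ; _~_ = _~_ ; ~-sym = ~-sym ; ~-irr = ~-irr ; _~?_ = _~?_ }

  open Local adjacency public

  claw-free⇒noClaw : ClawFree G → NoClaw (λ _ → ⊤)
  claw-free⇒noClaw free {c} {p} {q} {r} _ _ _ _ cp cq cr pq pr qr =
    free (c , p , q , r , cp , cq , cr , (λ e → pq (inj₁ e)) , (λ e → pr (inj₁ e)) , (λ e → qr (inj₁ e)) ,
          Bool.¬-not (λ e → pq (inj₂ e)) , Bool.¬-not (λ e → pr (inj₂ e)) , Bool.¬-not (λ e → qr (inj₂ e)))

  thirdN : ClawFree G → ∀ {x p q r} → x ~ p → x ~ q → x ~ r → ¬ (p ≃ q) → ¬ (p ≃ r) → q ≃ r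
  thirdN free {q = q} {r} xp xq xr pq pr =
    decidable-stable (q ≃? r) (claw-free⇒noClaw free tt tt tt tt xp xq xr pq pr)

  walk⇒trail : ∀ {a b l} → Walk G a b l → Trail a b l
  walk⇒trail single     = stop
  walk⇒trail (cons e w) = go e (walk⇒trail w)

  trail⇒walk : ∀ {a b l} → Trail a b l → Walk G a b l
  trail⇒walk stop     = single
  trail⇒walk (go e t) = cons e (trail⇒walk t)

-- G with an extra vertex `nothing` adjacent to exactly a and b: the (a,b)-paths of G become cycles.
module Closing {n : ℕ} (G : Graph n) (a b : Fin n) where
  open Neighbours G using (_~_; ~-sym; ~-irr; _~?_)
  module N = Neighbours G

  End : Fin n → Set
  End v = v ≡ a ⊎ v ≡ b

  _∞~_ : Maybe (Fin n) → Maybe (Fin n) → Set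
  just u  ∞~ just v  = u ~ v
  just u  ∞~ nothing = End u
  nothing ∞~ just v  = End v
  nothing ∞~ nothing = ⊥

  ∞~-sym : ∀ {u v} → u ∞~ v → v ∞~ u
  ∞~-sym {just u}  {just v}  e = ~-sym e
  ∞~-sym {just u}  {nothing} e = e
  ∞~-sym {nothing} {just v}  e = e

  ∞~-irr : ∀ {v} → ¬ (v ∞~ v)
  ∞~-irr {just v} e = ~-irr e

  _∞~?_ : ∀ u v → Dec (u ∞~ v)
  just u  ∞~? just v  = u ~? v
  just u  ∞~? nothing = (u ≟ a) ⊎-dec (u ≟ b)
  nothing ∞~? just v  = (v ≟ a) ⊎-dec (v ≟ b)
  nothing ∞~? nothing = no λ ()

  closing : Adjacency
  closing = record
    { V = Maybe (Fin n) ; _≟ⱽ_ = Maybe.≡-dec _≟_ ; _~_ = _∞~_ ; ~-sym = λ {u} {v} → ∞~-sym {u} {v}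
    ; ~-irr = λ {v} → ∞~-irr {v} ; _~?_ = _∞~?_ }

  module C = Local closing

  Ord : Maybe (Fin n) → Set
  Ord (just _) = ⊤
  Ord nothing  = ⊥

  Ord? : ∀ v → Dec (Ord v)
  Ord? (just _) = yes tt
  Ord? nothing  = no λ ()

  Ord₂ : ∀ {u v} → u ≢ v → Ord u ⊎ Ord v
  Ord₂ {just _}           _   = inj₁ tt
  Ord₂ {nothing} {just _} _   = inj₂ tt
  Ord₂ {nothing} {nothing} u≢v = ⊥-elim (u≢v refl)

  ≃-up : ∀ {u v} → u N.≃ v → just u C.≃ just v
  ≃-up (inj₁ e) = inj₁ (cong just e)
  ≃-up (inj₂ e) = inj₂ e

  ≃-down : ∀ {u v} → just u C.≃ just v → u N.≃ v
  ≃-down (inj₁ e) = inj₁ (Maybe.just-injective e)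
  ≃-down (inj₂ e) = inj₂ e

  noClaw : ClawFree G → C.NoClaw Ord
  noClaw free {just c} {just p} {just q} {just r} Oc Op Oq Or cp cq cr pq pr qr =
    N.claw-free⇒noClaw free tt tt tt tt cp cq cr
      (λ e → pq (≃-up e)) (λ e → pr (≃-up e)) (λ e → qr (≃-up e))

  trail-up : ∀ {u v l} → N.Trail u v l → C.Trail (just u) (just v) (map just l)
  trail-up N.stop     = C.stop
  trail-up (N.go e t) = C.go e (trail-up t)

  up : ∀ {u v l} → N.Route u v l → C.Route (just u) (just v) (map just l)
  up (N.route t σ) = C.route (trail-up t) (map⁺ just σ)

  trail-down : ∀ {u v l} → C.Trail u v l → (∀ {w} → w ∈ l → Ord w) →
               ∃ λ u′ → ∃ λ v′ → ∃ λ m → u ≡ just u′ × v ≡ just v′ × l ≡ map just m × N.Trail u′ v′ m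
  trail-down {just u} C.stop ord = u , u , u ∷ [] , refl , refl , refl , N.stop
  trail-down {nothing} C.stop ord = ⊥-elim (ord (here refl))
  trail-down {nothing} (C.go e t) ord = ⊥-elim (ord (here refl))
  trail-down {just u} (C.go e t) ord with trail-down t (λ w∈ → ord (there w∈))
  ... | u′ , v′ , m , refl , refl , refl , t′ = u , v′ , u ∷ m , refl , refl , refl , N.go e t′

  down : ∀ {u v l} → C.Route (just u) (just v) (map just l) → N.Route u v l
  down {u} {v} {l} (C.route t σ) with trail-down t ord
    where
    ord : ∀ {w} → w ∈ _ → Ord w
    ord w∈ with ∈-map⁻ just (∈-resp-↭ σ w∈)
    ... | _ , _ , refl = tt
  ... | u′ , v′ , m , refl , refl , refl , t′ = N.route t′ m↭l
    where
    strip : ∀ k → map (fromMaybe u) (map just k) ≡ k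
    strip k = trans (sym (List.map-∘ k)) (List.map-id k)
    m↭l : m ↭ l
    m↭l = ↭-trans (↭-reflexive (sym (strip m))) (↭-trans (map⁺ (fromMaybe u) σ) (↭-reflexive (strip l)))

  loop : ∀ {v P w} → Unique P → N.Route v v P → w ∈ P → w ≡ v
  loop U (N.route N.stop σ) w∈ with ∈-resp-↭ (↭-sym σ) w∈
  ... | here e = e
  loop U (N.route (N.go e t) σ) w∈ =
    ⊥-elim (proj₁ (Unique-∷⁻ (Unique-resp-↭ (↭-sym σ) U)) (N.last∈ (N.route t ↭-refl)))

  -- A repetition-free route with equal ends is a single vertex. As `a` and `b` both lie on `P`, the
  -- ends `q`, `p` are therefore `a` and `b` in some order.
  open-at-∞ : ∀ {q p P} → Unique P → a ≢ b → a ∈ P → b ∈ P → nothing ∞~ q → nothing ∞~ p →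
              C.Route q p (map just P) → N.Route a b P
  open-at-∞ {just q} {just p} U a≢b a∈ b∈ eq ep r with eq | ep
  ... | inj₁ refl | inj₂ refl = down r
  ... | inj₂ refl | inj₁ refl = N.rev (down r)
  ... | inj₁ refl | inj₁ refl = ⊥-elim (a≢b (sym (loop U (down r) b∈)))
  ... | inj₂ refl | inj₂ refl = ⊥-elim (a≢b (loop U (down r) a∈))

  uncycle : ∀ {u v P} → Unique P → a ≢ b → a ∈ P → b ∈ P →
            C.Route u v (nothing ∷ map just P) → v ∞~ u → N.Route a b P
  uncycle {u} {v} {P} U a≢b a∈ b∈ r e with C.position r (here refl)
  ... | inj₁ refl with C.uncons r (λ { refl → e })
  ...   | q , m , eq , k , τ = open-at-∞ U a≢b a∈ b∈ eq (∞~-sym {v} e)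
    (C.resp (drop-∷ (↭-trans (↭-reflexive (cong (nothing ∷_) (sym (List.++-identityʳ m)))) (↭-sym (layout τ)))) k)
  uncycle {u} {v} {P} U a≢b a∈ b∈ r e | inj₂ (inj₁ refl) with C.uncons (C.rev r) (λ { refl → e })
  ...   | q , m , eq , k , τ = open-at-∞ U a≢b a∈ b∈ eq e
    (C.resp (drop-∷ (↭-trans (↭-reflexive (cong (nothing ∷_) (sym (List.++-identityʳ m)))) (↭-sym (layout τ)))) k)
  uncycle {u} {v} {P} U a≢b a∈ b∈ r e | inj₂ (inj₂ (C.inner {p} {q} {l₁} {l₂} b₁ p~∞ ∞~q a₁ τ)) =
    open-at-∞ U a≢b a∈ b∈ ∞~q (∞~-sym {p} p~∞)
      (C.resp (↭-trans (++-comm l₂ l₁) (drop-∷ (↭-trans (↭-sym (shift nothing l₁ l₂))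
        (↭-trans (↭-reflexive (cong (λ k → l₁ ++ nothing ∷ k) (sym (List.++-identityʳ l₂)))) (↭-sym (layout τ))))))
        (C.join a₁ e b₁))

module Completion {n : ℕ} (G : Graph n) (x : Fin n) where
  open Neighbours G
  G* = localCompletion G x

  *-adj⁻ : ∀ {u v} → Adj G* u v → u ~ v ⊎ (u ≢ v × x ~ u × x ~ v)
  *-adj⁻ {u} {v} e with adj G u v | u ≟ v | adj G x u | adj G x v
  ... | true  | _     | _    | _    = inj₁ refl
  ... | false | no u≢v | true | true = inj₂ (u≢v , refl , refl)

  *-adj⁺ˡ : ∀ {u v} → u ~ v → Adj G* u v
  *-adj⁺ˡ {u} {v} e rewrite e = refl

  *-adj⁺ʳ : ∀ {u v} → u ≢ v → x ~ u → x ~ v → Adj G* u v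
  *-adj⁺ʳ {u} {v} u≢v xu xv rewrite xu | xv with adj G u v | u ≟ v
  ... | true  | _       = refl
  ... | false | no _    = refl
  ... | false | yes u≡v = ⊥-elim (u≢v u≡v)

  *-clawFree : ClawFree G → ClawFree G*
  *-clawFree free (c , p , q , r , cp , cq , cr , p≢q , p≢r , q≢r , pq , pr , qr) =
    body (old cp) (old cq) (old cr)
    where
    old = *-adj⁻
    non : ∀ {u v} → adj G* u v ≡ false → ¬ Adj G* u v
    non e e′ with trans (sym e) e′
    ... | ()
    non-old : ∀ {u v} → adj G* u v ≡ false → adj G u v ≡ false
    non-old e = Bool.¬-not (λ e′ → non e (*-adj⁺ˡ e′))
    -- If the edge cp is new, then q and r are not neighbours of x, and x can replace p.
    replace : ∀ {p q r} → x ~ c → x ~ p → Adj G* c q → Adj G* c r → p ≢ q → p ≢ r → q ≢ r →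
              adj G* p q ≡ false → adj G* p r ≡ false → adj G* q r ≡ false → ⊥
    replace {p} {q} {r} xc xp cq cr p≢q p≢r q≢r pq pr qr =
      free (c , x , q , r , ~-sym xc , edge cq x≁q , edge cr x≁r ,
            (λ { refl → non pq (*-adj⁺ˡ (~-sym xp)) }) , (λ { refl → non pr (*-adj⁺ˡ (~-sym xp)) }) , q≢r ,
            Bool.¬-not x≁q , Bool.¬-not x≁r , non-old qr)
      where
      x≁q : ¬ (x ~ q)
      x≁q xq = non pq (*-adj⁺ʳ p≢q xp xq)
      x≁r : ¬ (x ~ r)
      x≁r xr = non pr (*-adj⁺ʳ p≢r xp xr)
      edge : ∀ {v} → Adj G* c v → ¬ (x ~ v) → c ~ v
      edge e x≁v with old e
      ... | inj₁ e′           = e′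
      ... | inj₂ (_ , _ , xv) = ⊥-elim (x≁v xv)
    flip : ∀ {u v} → adj G* u v ≡ false → adj G* v u ≡ false
    flip {u} {v} e = trans (symm G* v u) e
    body : c ~ p ⊎ (c ≢ p × x ~ c × x ~ p) → c ~ q ⊎ (c ≢ q × x ~ c × x ~ q) →
           c ~ r ⊎ (c ≢ r × x ~ c × x ~ r) → ⊥
    body (inj₂ (_ , xc , xp)) _ _ = replace xc xp cq cr p≢q p≢r q≢r pq pr qr
    body _ (inj₂ (_ , xc , xq)) _ =
      replace xc xq cp cr (λ e → p≢q (sym e)) q≢r p≢r (flip pq) qr pr
    body _ _ (inj₂ (_ , xc , xr)) =
      replace xc xr cp cq (λ e → p≢r (sym e)) (λ e → q≢r (sym e)) p≢q (flip pr) (flip qr) pq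
    body (inj₁ e) (inj₁ e′) (inj₁ e″) =
      free (c , p , q , r , e , e′ , e″ , p≢q , p≢r , q≢r , non-old pq , non-old pr , non-old qr)

  walk⁺ : ∀ {a b l} → Walk G a b l → Walk G* a b l
  walk⁺ single     = single
  walk⁺ (cons e w) = cons (*-adj⁺ˡ e) (walk⁺ w)

  first-cons : ∀ {H : Graph n} {a b l} → Walk H a b l → ∃ λ m → l ≡ a ∷ m
  first-cons single     = _ , refl
  first-cons (cons _ _) = _ , refl

  -- A walk of G* that is not a walk of G uses a new edge, into which any vertex of N[x] can be inserted.
  insert : ∀ {a b l w} → Walk G* a b l → w ∉ l → w ≡ x ⊎ x ~ w →
           Walk G a b l ⊎ ∃ λ l′ → Walk G* a b l′ × l′ ↭ w ∷ l
  insert single w∉ Nw = inj₁ single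
  insert {a} {b} {w = w} (cons {b = c} {p = l} e W) w∉ Nw with *-adj⁻ e
  ... | inj₁ e′ with insert W (λ w∈ → w∉ (there w∈)) Nw
  ...   | inj₁ W′            = inj₁ (cons e′ W′)
  ...   | inj₂ (l′ , W′ , σ) = inj₂ (a ∷ l′ , cons e W′ , ↭-trans (prep a σ) (swap a w ↭-refl))
  insert {a} {b} {w = w} (cons {b = c} {p = l} e W) w∉ Nw | inj₂ (_ , xa , xc) =
    inj₂ (a ∷ w ∷ l , cons (aw Nw) (cons (wc Nw) W) , swap a w ↭-refl)
    where
    aw : w ≡ x ⊎ x ~ w → Adj G* a w
    aw (inj₁ refl) = *-adj⁺ˡ (~-sym xa)
    aw (inj₂ xw)   = *-adj⁺ʳ (λ a≡w → w∉ (here (sym a≡w))) xa xw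
    c∈ : c ∈ l
    c∈ with first-cons W
    ... | _ , refl = here refl
    wc : w ≡ x ⊎ x ~ w → Adj G* w c
    wc (inj₁ refl) = *-adj⁺ˡ xc
    wc (inj₂ xw)   = *-adj⁺ʳ (λ { refl → w∉ (there c∈) }) xw xc

  -- The pieces are routes of `G`, and the vertices on both sides of a gap are neighbours of `x`.
  -- The pieces may be reversed and reordered, so the gaps need not be the new edges of the original
  -- path.
  data Gapped (u v : Fin n) (l : List (Fin n)) : Set where
    one   : Route u v l → Gapped u v l
    two   : ∀ {p q l₁ l₂} → Route u p l₁ → x ~ p → x ~ q → Route q v l₂ →
            Tiles (l₁ ∷ l₂ ∷ []) l → Gapped u v l
    three : ∀ {p q p′ q′ l₁ l₂ l₃} → Route u p l₁ → x ~ p → x ~ q → Route q p′ l₂ → x ~ p′ → x ~ q′ →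
            Route q′ v l₃ → Tiles (l₁ ∷ l₂ ∷ l₃ ∷ []) l → Gapped u v l

  -- Taking `x` out of a path leaves a gap at its place. `Wide` remembers that some gap survives,
  -- since a single route might have no place where `x` can be put back.
  data Wide {u v l} : Gapped u v l → Set where
    two   : ∀ {p q l₁ l₂} {r₁ : Route u p l₁} {xp} {xq : x ~ q} {r₂ : Route q v l₂} {τ} → Wide (two r₁ xp xq r₂ τ)
    three : ∀ {p q p′ q′ l₁ l₂ l₃} {r₁ : Route u p l₁} {xp} {xq : x ~ q} {r₂ : Route q p′ l₂} {xp′} {xq′ : x ~ q′}
            {r₃ : Route q′ v l₃} {τ} → Wide (three r₁ xp xq r₂ xp′ xq′ r₃ τ)

  tiles-cons : ∀ {k} {u} {l m : List (Fin n)} {Γ : Vec (List (Fin n)) k} → Tiles (m ∷ Γ) l → Tiles ((u ∷ m) ∷ Γ) (u ∷ l)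
  tiles-cons (tiles τ) = tiles (prep _ τ)

  prepend : ∀ {u v w l} → u ~ v → (g : Gapped v w l) → Σ (Gapped u w (u ∷ l)) λ g′ → Wide g → Wide g′
  prepend {u} e (one r)                        = one (join (point u) e r) , λ ()
  prepend {u} e (two r xp xq s τ)              = two (join (point u) e r) xp xq s (tiles-cons τ) , λ _ → two
  prepend {u} e (three r xp xq s xp′ xq′ t τ)  =
    three (join (point u) e r) xp xq s xp′ xq′ t (tiles-cons τ) , λ _ → three

  module _ (free : ClawFree G) where
    -- Among the ends of three pieces, all in N(x), two are adjacent.
    prepend-gap : ∀ {u v w l} → Unique (u ∷ l) → x ~ u → x ~ v → Gapped v w l → Σ (Gapped u w (u ∷ l)) Wide
    prepend-gap {u} U xu xv (one r) =
      two (point u) xu xv r (tiles (prep u (↭-reflexive (sym (List.++-identityʳ _))))) , two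
    prepend-gap {u} U xu xv (two r xp xq s τ) = three (point u) xu xv r xp xq s (tiles (prep u (layout τ))) , three
    prepend-gap {u} {v} {w} {l} U xu xv (three {p} {q} {p′} {q′} {l₁} {l₂} {l₃} r xp xq s xp′ xq′ t τ) =
      cases (u ~? p) (u ~? p′)
      where
      Γ : Vec (List (Fin n)) 4
      Γ = (u ∷ []) ∷ l₁ ∷ l₂ ∷ l₃ ∷ []
      τ′ : Tiles Γ (u ∷ l)
      τ′ = tiles (prep u (layout τ))
      cases : Dec (u ~ p) → Dec (u ~ p′) → Σ (Gapped u w (u ∷ l)) Wide
      cases (yes up) _ = three (join (point u) up (rev r)) xv xq s xp′ xq′ t τ′′ , three
        where
        τ′′ : Tiles ((u ∷ l₁) ∷ l₂ ∷ l₃ ∷ []) (u ∷ l)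
        τ′′ = tiles (layout τ′)
      cases (no _) (yes up′) = three (join (point u) up′ (rev s)) xq xp (rev r) xv xq′ t τ′′ , three
        where
        τ′′ : Tiles ((u ∷ l₂) ∷ l₁ ∷ l₃ ∷ []) (u ∷ l)
        τ′′ = tiles (↭-trans (layout τ′) (prep u (shifts l₁ l₂)))
      cases (no u≁p) (no u≁p′) = three (point u) xu xv (join r p~p′ (rev s)) xq xq′ t τ′′ , three
        where
        p~p′ : p ~ p′
        p~p′ = ≃⇒~ (tiles-apart Γ U τ′ 1F 2F (last∈ r) (last∈ s)) (thirdN free xu xp xp′
          (λ { (inj₁ e) → tiles-apart Γ U τ′ 0F 1F (here refl) (last∈ r) e ; (inj₂ e) → u≁p e })
          (λ { (inj₁ e) → tiles-apart Γ U τ′ 0F 2F (here refl) (last∈ s) e ; (inj₂ e) → u≁p′ e }))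
        τ′′ : Tiles ((u ∷ []) ∷ (l₁ ++ l₂) ∷ l₃ ∷ []) (u ∷ l)
        τ′′ = tiles (↭-trans (layout τ′) (prep u (↭-reflexive (sym (List.++-assoc l₁ l₂ _)))))

    gapped : ∀ {u v l} → Walk G* u v l → Unique l → x ∉ l → Gapped u v l
    gapped single U x∉ = one (point _)
    gapped (cons e W) U x∉ with gapped W (proj₂ (Unique-∷⁻ U)) (λ x∈ → x∉ (there x∈)) | *-adj⁻ e
    ... | g | inj₁ e′            = proj₁ (prepend e′ g)
    ... | g | inj₂ (_ , xu , xv) = proj₁ (prepend-gap U xu xv g)

    x-edge : ∀ {v} → Adj G* x v → x ~ v
    x-edge e with *-adj⁻ e
    ... | inj₁ e′          = e′
    ... | inj₂ (_ , _ , xv) = xv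

    gapped-through : ∀ {u v l} → Walk G* u v l → Unique l → x ∈ l → u ≢ x → v ≢ x →
                     ∃ λ l′ → l ↭ x ∷ l′ × Σ (Gapped u v l′) Wide
    gapped-through W U (here refl) u≢x v≢x with first-cons W
    ... | _ , refl = ⊥-elim (u≢x refl)
    gapped-through {u} (cons {b = c} {p = l} e W) U (there x∈) u≢x v≢x with c ≟ x
    gapped-through {u} (cons e single) U (there x∈) u≢x v≢x | yes refl = ⊥-elim (v≢x refl)
    gapped-through {u} (cons e (cons {p = l} e′ W)) U (there x∈) u≢x v≢x | yes refl =
      u ∷ l , swap u x ↭-refl , prepend-gap Uul (x-edge (*-sym e)) (x-edge e′) (gapped W Ul x∉l)
      where
      *-sym : ∀ {u v} → Adj G* u v → Adj G* v u
      *-sym {u} {v} e = trans (symm G* v u) e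
      Uul : Unique (u ∷ l)
      Uul = proj₂ (Unique-∷⁻ (Unique-resp-↭ (swap u x ↭-refl) U))
      Ul = proj₂ (Unique-∷⁻ Uul)
      x∉l : x ∉ l
      x∉l = proj₁ (Unique-∷⁻ (proj₂ (Unique-∷⁻ U)))
    ... | no c≢x with gapped-through W (proj₂ (Unique-∷⁻ U)) x∈ c≢x v≢x | *-adj⁻ e
    ...   | l′ , σ , g , wide | inj₁ e′ =
      u ∷ l′ , ↭-trans (prep u σ) (swap u x ↭-refl) , proj₁ (prepend e′ g) , proj₂ (prepend e′ g) wide
    ...   | l′ , σ , g , wide | inj₂ (_ , xu , xc) =
      u ∷ l′ , ↭-trans (prep u σ) (swap u x ↭-refl) , prepend-gap Uul xu xc g
      where
      Uul : Unique (u ∷ l′)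
      Uul = proj₂ (Unique-∷⁻ (Unique-resp-↭ (↭-trans (prep u σ) (swap u x ↭-refl)) U))

-- `S` comes from the ends of the two outer pieces of the path and `T` from those of the middle
-- piece, which contains neither `a` nor `b`. This is why `cross` restricts only the `T`-end of an
-- edge.
record TwoSided {n : ℕ} (G : Graph n) (a b x : Fin n) : Set where
  open Neighbours G
  field
    {e₁ e₂ f₁ f₂} : Fin n
  InS : Fin n → Set
  InS v = v ≃ e₁ × v ≃ e₂
  InT : Fin n → Set
  InT v = v ≃ f₁ × v ≃ f₂
  field
    xe₁      : x ~ e₁
    xe₂      : x ~ e₂
    xf₁      : x ~ f₁
    e₁∈S     : InS e₁
    e₂∈S     : InS e₂
    f₁∈T     : InT f₁
    f₁≢a     : f₁ ≢ a
    f₁≢b     : f₁ ≢ b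
    cover    : ∀ {v} → x ~ v → InS v ⊎ InT v
    disjoint : ∀ {v} → x ~ v → InS v → InT v → ⊥
    cross    : ∀ {s t} → x ~ s → x ~ t → InS s → InT t → s ~ t → t ≡ a ⊎ t ≡ b
    escape   : ∀ {t} → t ≡ a ⊎ t ≡ b → x ~ t → InT t →
               ∃ λ y → t ~ y × y ≢ x × ¬ (x ~ y) × (∀ {s} → x ~ s → InS s → s ~ t → y ~ s)

module NoSpanningPath {n : ℕ} (G : Graph n) (free : ClawFree G) (x : Fin n) {a b : Fin n} {P : List (Fin n)}
  (W : Walk (localCompletion G x) a b P) (U : Unique P)
  (N⊆P : ∀ {w} → w ≡ x ⊎ Adj G x w → w ∈ P) (none : ∀ {l} → l ↭ P → ¬ Walk G a b l) where

  open Neighbours G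
  open Completion G x

  no-route : ¬ Route a b P
  no-route (route t σ) = none σ (trail⇒walk t)

  first-∈ : ∀ {a b l} → Walk G* a b l → a ∈ l
  first-∈ W with first-cons W
  ... | _ , refl = here refl

  last-∈ : ∀ {a b l} → Walk G* a b l → b ∈ l
  last-∈ single     = here refl
  last-∈ (cons _ W) = there (last-∈ W)

  from-end : a ≡ x → a ≢ b → Separation x
  from-end refl a≢b = start W U no-route (λ xw → N⊆P (inj₂ xw))
    where
    start : ∀ {P} → Walk G* x b P → Unique P → ¬ Route x b P → (∀ {w} → x ~ w → w ∈ P) → Separation x
    start single U none _ = ⊥-elim (a≢b refl)
    start (cons {b = v} {p = l} e W) U none N⊆ = pieces (gapped free W Ul x∉l)
      where
      xv = x-edge free e
      x∉l = proj₁ (Unique-∷⁻ U)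
      Ul = proj₂ (Unique-∷⁻ U)
      noPath : ∀ {r} → x ~ r → Route r b l → ⊥
      noPath xr k = none (join (point x) xr k)
      N⊆l : ∀ {w} → x ~ w → w ∈ l
      N⊆l xw with N⊆ xw
      ... | here refl = ⊥-elim (~-irr xw)
      ... | there w∈  = w∈
      open Linear adjacency (claw-free⇒noClaw free) x b l Ul x∉l N⊆l noPath
      pieces : Gapped v b l → Separation x
      pieces (one r) = ⊥-elim (noPath xv r)
      pieces (two r xp xq s τ) = outcome (record { pD = s ; pB = r ; xd = xq ; xf₁ = xv ; xf₂ = xp ; cov = tiles-swap τ })
      -- Two of `v`, `q`, `q′` are joined because `x` centres no claw; that edge merges two of the
      -- pieces.
      pieces (three {p} {q} {p′} {q′} {l₁} {l₂} {l₃} r xp xq s xp′ xq′ t τ) = cases (v ~? q) (v ~? q′)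
        where
        Γ : Vec (List (Fin n)) 3
        Γ = l₁ ∷ l₂ ∷ l₃ ∷ []
        cases : Dec (v ~ q) → Dec (v ~ q′) → Separation x
        cases (yes e) _ = outcome (record { pD = t ; pB = join (rev r) e s ; xd = xq′ ; xf₁ = xp ; xf₂ = xp′ ; cov = τ′ })
          where
          τ′ : Tiles (l₃ ∷ (l₁ ++ l₂) ∷ []) l
          τ′ = tiles-swap (tiles (↭-trans (layout τ) (↭-reflexive (sym (List.++-assoc l₁ l₂ _)))))
        cases (no _) (yes e) = outcome (record { pD = join r′ e t ; pB = rev s ; xd = xp ; xf₁ = xp′ ; xf₂ = xq ; cov = τ′ })
          where
          r′ = rev r
          τ′ : Tiles ((l₁ ++ l₃) ∷ l₂ ∷ []) l
          τ′ = tiles-swap (tiles (↭-trans (layout (tiles-swap τ)) (++⁺ˡ l₂ (↭-reflexive (sym (List.++-assoc l₁ l₃ []))))))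
        cases (no v≁q) (no v≁q′) = outcome (record
          { pD = join (rev s) q~q′ t ; pB = r ; xd = xp′ ; xf₁ = xv ; xf₂ = xp ; cov = τ′ })
          where
          q~q′ : q ~ q′
          q~q′ = ≃⇒~ (tiles-apart Γ Ul τ 1F 2F (first∈ s) (first∈ t)) (thirdN free xv xq xq′
            (λ { (inj₁ e) → tiles-apart Γ Ul τ 0F 1F (first∈ r) (first∈ s) e ; (inj₂ e) → v≁q e })
            (λ { (inj₁ e) → tiles-apart Γ Ul τ 0F 2F (first∈ r) (first∈ t) e ; (inj₂ e) → v≁q′ e }))
          τ′ : Tiles ((l₂ ++ l₃) ∷ l₁ ∷ []) l
          τ′ = tiles-swap (tiles (↭-trans (layout τ) (++⁺ˡ l₁ (↭-reflexive (sym (List.++-assoc l₂ l₃ []))))))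

  from-inside : a ≢ x → b ≢ x → a ≢ b → TwoSided G a b x
  from-inside a≢x b≢x a≢b with gapped-through free W U (N⊆P (inj₁ refl)) a≢x b≢x
  ... | l′ , σ , two {l₁ = l₁} {l₂} r xp xq s τ , _ =
    ⊥-elim (no-route (resp (↭-sym (↭-trans σ (↭-trans (prep x (layout τ)) x-in)))
      (join r (~-sym xp) (join (point x) xq s))))
    where
    x-in : x ∷ l₁ ++ l₂ ++ [] ↭ l₁ ++ x ∷ l₂
    x-in = ↭-trans (↭-reflexive (cong (λ k → x ∷ l₁ ++ k) (List.++-identityʳ l₂))) (↭-sym (shift x l₁ l₂))
  ... | l′ , σ , three {p} {q} {p′} {q′} {l₁} {l₂} {l₃} r xp xq s xp′ xq′ t τ , _ = record
    { e₁ = q′ ; e₂ = p ; f₁ = q ; f₂ = p′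
    ; xe₁ = xq′ ; xe₂ = xp ; xf₁ = xq
    ; e₁∈S = inj₁ refl , ≃-down (e₁≃e₂ c) ; e₂∈S = ≃-sym (≃-down (e₁≃e₂ c)) , inj₁ refl
    ; f₁∈T = inj₁ refl , ≃-down (e₁≃e₂ (exchange c))
    ; f₁≢a = λ e → tiles-apart Γ Ul′ τ 1F 0F (first∈ s) (first∈ r) e
    ; f₁≢b = λ e → tiles-apart Γ Ul′ τ 1F 2F (first∈ s) (last∈ t) e
    ; cover = λ {v} xv → [ (λ h → inj₁ (downs h)) , (λ h → inj₂ (downs h)) ]′ (S∪T c {just v} xv)
    ; disjoint = λ {v} xv h k → S∩T c {just v} xv (ups h) (ups k)
    ; cross = λ {u} {v} xu xv h k e → decidable-stable ((v ≟ a) ⊎-dec (v ≟ b)) λ ¬end →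
        cross c plain {just u} {just v} xu xv (ups h) (ups k) e λ { {just w} _ → tt ; {nothing} (inj₂ end) → ¬end end }
    ; escape = λ {v} end xv k → escapes end xv k
    }
    where
    open Closing G a b
    ordN : ∀ {v} → just x ∞~ v → Ord v
    ordN {just _}  _        = tt
    ordN {nothing} (inj₁ e) = ⊥-elim (a≢x (sym e))
    ordN {nothing} (inj₂ e) = ⊥-elim (b≢x (sym e))
    UL : Unique (nothing ∷ map just P)
    UL = All.tabulate (λ v∈ → λ { refl → no-nothing v∈ }) ∷ Unique.map⁺ Maybe.just-injective U
      where
      no-nothing : nothing ∉ map just P
      no-nothing v∈ with ∈-map⁻ just v∈
      ... | _ , _ , ()
    N⊆L : ∀ {v} → just x ∞~ v → v ∈ nothing ∷ map just P
    N⊆L {just v}  xv = there (∈-map⁺ just (N⊆P (inj₂ xv)))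
    N⊆L {nothing} xv = here refl
    noCycle : ∀ {u v} → C.Route u v (nothing ∷ map just P) → v ∞~ u → ⊥
    noCycle k e = no-route (uncycle U a≢b (first-∈ W) (last-∈ W) k e)
    open Cyclic closing Ord Ord? (noClaw free) (just x) tt ordN Ord₂ (nothing ∷ map just P) UL N⊆L noCycle
    Γ : Vec (List (Fin n)) 3
    Γ = l₁ ∷ l₂ ∷ l₃ ∷ []
    Ul′ : Unique l′
    Ul′ = proj₂ (Unique-∷⁻ (Unique-resp-↭ σ U))
    c : Config
    c = record
      -- The last piece ends in `b` and the first begins in `a`, so `nothing` joins them into one
      -- segment.
      { pD = C.join (C.join (up t) (inj₂ refl) (C.point nothing)) (inj₁ refl) (up r) ; pB = up s
      ; xe₁ = xq′ ; xe₂ = xp ; xf₁ = xq ; xf₂ = xp′ ; cov = tiles cov′ }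
      where
      J = map {A = Fin n} just
      cov′ : nothing ∷ J P ↭ ((J l₃ ++ nothing ∷ []) ++ J l₁) ++ J l₂ ++ just x ∷ []
      cov′ = begin
        nothing ∷ J P                                    ↭⟨ prep nothing (map⁺ just (↭-trans σ (prep x (layout τ)))) ⟩
        nothing ∷ just x ∷ J (l₁ ++ l₂ ++ l₃ ++ [])
          ≡⟨ cong (λ k → nothing ∷ just x ∷ J (l₁ ++ l₂ ++ k)) (List.++-identityʳ l₃) ⟩
        nothing ∷ just x ∷ J (l₁ ++ l₂ ++ l₃)
          ≡⟨ cong (λ k → nothing ∷ just x ∷ k) (trans (List.map-++ just l₁ (l₂ ++ l₃))
               (cong (J l₁ ++_) (List.map-++ just l₂ l₃))) ⟩
        nothing ∷ just x ∷ J l₁ ++ J l₂ ++ J l₃          ↭⟨ prep nothing (∷↭∷ʳ (just x) (J l₁ ++ J l₂ ++ J l₃)) ⟩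
        nothing ∷ (J l₁ ++ J l₂ ++ J l₃) ++ just x ∷ []
          ↭⟨ prep nothing (++⁺ʳ _ (↭-trans (↭-reflexive (sym (List.++-assoc (J l₁) (J l₂) (J l₃))))
               (++-comm (J l₁ ++ J l₂) (J l₃)))) ⟩
        nothing ∷ (J l₃ ++ J l₁ ++ J l₂) ++ just x ∷ []  ≡⟨ cong (nothing ∷_) (List.++-assoc (J l₃) _ _) ⟩
        nothing ∷ J l₃ ++ (J l₁ ++ J l₂) ++ just x ∷ []  ↭⟨ shift nothing (J l₃) _ ⟨
        J l₃ ++ nothing ∷ (J l₁ ++ J l₂) ++ just x ∷ []
          ≡⟨ cong (λ k → J l₃ ++ nothing ∷ k) (List.++-assoc (J l₁) (J l₂) _) ⟩
        J l₃ ++ nothing ∷ J l₁ ++ J l₂ ++ just x ∷ []    ≡⟨ List.++-assoc (J l₃) (nothing ∷ J l₁) _ ⟨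
        (J l₃ ++ nothing ∷ J l₁) ++ J l₂ ++ just x ∷ []
          ≡⟨ cong (_++ J l₂ ++ just x ∷ []) (List.++-assoc (J l₃) (nothing ∷ []) (J l₁)) ⟨
        ((J l₃ ++ nothing ∷ []) ++ J l₁) ++ J l₂ ++ just x ∷ [] ∎
        where open PermutationReasoning
    ups : ∀ {v g h} → v ≃ g × v ≃ h → just v C.≃ just g × just v C.≃ just h
    ups (k , k′) = ≃-up k , ≃-up k′
    downs : ∀ {v g h} → just v C.≃ just g × just v C.≃ just h → v ≃ g × v ≃ h
    downs (k , k′) = ≃-down k , ≃-down k′
    plain : Plain (map just l₂)
    plain {w = just _} v∈ e = tt
    plain {w = nothing} v∈ e with ∈-map⁻ just v∈ | e
    ... | _ , v∈′ , refl | inj₂ (inj₁ e′) = tiles-apart Γ Ul′ τ 1F 0F v∈′ (first∈ r) e′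
    ... | _ , v∈′ , refl | inj₂ (inj₂ e′) = tiles-apart Γ Ul′ τ 1F 2F v∈′ (last∈ t) e′
    end∈D : ∀ {v} → v ≡ a ⊎ v ≡ b → just v ∈ (map just l₃ ++ nothing ∷ []) ++ map just l₁
    end∈D (inj₁ refl) = ∈-++⁺ʳ (map just l₃ ++ nothing ∷ []) (∈-map⁺ just (first∈ r))
    end∈D (inj₂ refl) = ∈-++⁺ˡ (∈-++⁺ˡ (∈-map⁺ just (last∈ t)))
    escapes : ∀ {v} → v ≡ a ⊎ v ≡ b → x ~ v → v ≃ q × v ≃ p′ →
              ∃ λ y → v ~ y × y ≢ x × ¬ (x ~ y) × (∀ {s} → x ~ s → s ≃ q′ × s ≃ p → s ~ v → y ~ s)
    escapes {v} end xv k with escape c plain {just v} xv (ups k) (end∈D end)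
    ... | just y , vy , _ , y≢x , x≁y , ys =
      y , vy , (λ e → y≢x (cong just e)) , x≁y , λ {s} xs h → ys {just s} xs (ups h)

-- Clique covers

module _ {n : ℕ} {P : Fin n → Set} (P? : ∀ v → Dec (P v)) where

  ⟪_⟫ : Subset n
  ⟪_⟫ = tabulate (λ v → does (P? v))

  ∈-⟪⟫⁺ : ∀ {v} → P v → v ∈ˢ ⟪_⟫
  ∈-⟪⟫⁺ {v} p = lookup⇒[]= v _ (trans (lookup∘tabulate _ v) (dec-true (P? v) p))

  ∈-⟪⟫⁻ : ∀ {v} → v ∈ˢ ⟪_⟫ → P v
  ∈-⟪⟫⁻ {v} v∈ with P? v | trans (sym (lookup∘tabulate (λ v → does (P? v)) v)) ([]=⇒lookup v∈)
  ... | yes p | _ = p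

-- The ground set of the hypergraph has to be some `Fin m`, so sets of vertices are coded as numbers
-- below `2 ^ n`.
subset : ∀ {n} → Fin (2 ^ n) → Subset n
subset {zero}  _ = []
subset {suc n} i with remQuot {2} (2 ^ n) i
... | 0F , j = inside ∷ subset {n} j
... | 1F , j = outside ∷ subset {n} j

index : ∀ {n} → Subset n → Fin (2 ^ n)
index []            = 0F
index {suc n} (inside  ∷ p) = combine {2} 0F (index p)
index {suc n} (outside ∷ p) = combine {2} 1F (index p)

subset-index : ∀ {n} (p : Subset n) → subset {n} (index p) ≡ p
subset-index []            = refl
subset-index {suc n} (inside ∷ p) rewrite remQuot-combine {2} {2 ^ n} 0F (index p) = cong (inside ∷_) (subset-index p)
subset-index {suc n} (outside ∷ p) rewrite remQuot-combine {2} {2 ^ n} 1F (index p) = cong (outside ∷_) (subset-index p)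

index-subset : ∀ {n} (i : Fin (2 ^ n)) → index (subset {n} i) ≡ i
index-subset {zero} 0F = refl
index-subset {suc n} i with remQuot {2} (2 ^ n) i in eq
... | 0F , j = trans (cong (combine {2} 0F) (index-subset {n} j))
  (trans (sym (cong (λ (k , l) → combine {2} k l) eq)) (combine-remQuot {2} (2 ^ n) i))
... | 1F , j = trans (cong (combine {2} 1F) (index-subset {n} j))
  (trans (sym (cong (λ (k , l) → combine {2} k l) eq)) (combine-remQuot {2} (2 ^ n) i))

∣p∪q∣≤ : ∀ {n} (p q : Subset n) → ∣ p ∪ q ∣ ≤ ∣ p ∣ + ∣ q ∣
∣p∪q∣≤ []            []            = z≤n
∣p∪q∣≤ (outside ∷ p) (outside ∷ q) = ∣p∪q∣≤ p q
∣p∪q∣≤ (outside ∷ p) (inside  ∷ q) = ℕ.≤-trans (s≤s (∣p∪q∣≤ p q)) (ℕ.≤-reflexive (sym (ℕ.+-suc ∣ p ∣ ∣ q ∣)))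
∣p∪q∣≤ (inside  ∷ p) (outside ∷ q) = s≤s (∣p∪q∣≤ p q)
∣p∪q∣≤ (inside  ∷ p) (inside  ∷ q) = s≤s (ℕ.≤-trans (∣p∪q∣≤ p q) (ℕ.+-monoʳ-≤ ∣ p ∣ (ℕ.n≤1+n ∣ q ∣)))

three-elements : ∀ {n} (p : Subset n) i j k → (∀ {v} → v ∈ˢ p → v ≡ i ⊎ v ≡ j ⊎ v ≡ k) → ∣ p ∣ ≤ 3
three-elements p i j k only = ℕ.≤-trans (p⊆q⇒∣p∣≤∣q∣ p⊆) (ℕ.≤-trans (∣p∪q∣≤ ⁅ i ⁆ (⁅ j ⁆ ∪ ⁅ k ⁆))
    (ℕ.+-mono-≤ (ℕ.≤-reflexive (∣⁅x⁆∣≡1 i)) (ℕ.≤-trans (∣p∪q∣≤ ⁅ j ⁆ ⁅ k ⁆)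
      (ℕ.+-mono-≤ (ℕ.≤-reflexive (∣⁅x⁆∣≡1 j)) (ℕ.≤-reflexive (∣⁅x⁆∣≡1 k))))))
  where
  p⊆ : p ⊆ ⁅ i ⁆ ∪ (⁅ j ⁆ ∪ ⁅ k ⁆)
  p⊆ v∈ with only v∈
  ... | inj₁ refl        = x∈p∪q⁺ (inj₁ (x∈⁅x⁆ i))
  ... | inj₂ (inj₁ refl) = x∈p∪q⁺ (inj₂ (x∈p∪q⁺ (inj₁ (x∈⁅x⁆ j))))
  ... | inj₂ (inj₂ refl) = x∈p∪q⁺ {p = ⁅ i ⁆} (inj₂ (x∈p∪q⁺ {p = ⁅ j ⁆} (inj₂ (x∈⁅x⁆ k))))

module Cliques {n : ℕ} (G : Graph n) where
  open Neighbours G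

  Clique : (Fin n → Set) → Set
  Clique X = ∀ {u v} → X u → X v → u ≃ v

  MaxClique : Subset n → Set
  MaxClique M = Clique (_∈ˢ M) × (∀ w → (∀ u → u ∈ˢ M → w ≃ u) → w ∈ˢ M)

  maxClique? : ∀ M → Dec (MaxClique M)
  maxClique? M with all? (λ u → all? (λ v → (u ∈ˢ? M) →-dec ((v ∈ˢ? M) →-dec (u ≃? v))))
                  | all? (λ w → all? (λ u → (u ∈ˢ? M) →-dec (w ≃? u)) →-dec (w ∈ˢ? M))
  ... | yes c | yes m = yes ((λ {u} {v} → c u v) , m)
  ... | no ¬c | _     = no λ h → ¬c (λ u v → proj₁ h)
  ... | yes _ | no ¬m = no λ h → ¬m (proj₂ h)

  maximal-≡ : ∀ {M X} → MaxClique M → Clique (_∈ˢ X) → M ⊆ X → M ≡ X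
  maximal-≡ (_ , maximal) cl M⊆X = ⊆-antisym M⊆X (λ {w} w∈ → maximal w (λ u u∈ → cl w∈ (M⊆X u∈)))

  -- One pass over the list is enough: a vertex rejected once stays excluded, as the clique only
  -- grows.
  grow : ∀ (ws : List (Fin n)) M → Clique (_∈ˢ M) →
         ∃ λ M′ → M ⊆ M′ × Clique (_∈ˢ M′) × (∀ {w} → w ∈ ws → (∀ u → u ∈ˢ M′ → w ≃ u) → w ∈ˢ M′)
  grow []       M cl = M , (λ v∈ → v∈) , cl , λ ()
  grow (w ∷ ws) M cl with all? (λ u → (u ∈ˢ? M) →-dec (w ≃? u))
  ... | no ¬all with grow ws M cl
  ...   | M′ , M⊆ , cl′ , max =
    M′ , M⊆ , cl′ , λ { (here refl) h → ⊥-elim (¬all (λ u u∈ → h u (M⊆ u∈))) ; (there w∈) → max w∈ }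
  grow (w ∷ ws) M cl | yes all with grow ws (⁅ w ⁆ ∪ M) cl⁺
    where
    cl⁺ : Clique (_∈ˢ ⁅ w ⁆ ∪ M)
    cl⁺ u∈ v∈ with x∈p∪q⁻ ⁅ w ⁆ M u∈ | x∈p∪q⁻ ⁅ w ⁆ M v∈
    ... | inj₁ p | inj₁ q rewrite x∈⁅y⁆⇒x≡y w p | x∈⁅y⁆⇒x≡y w q = inj₁ refl
    ... | inj₁ p | inj₂ q rewrite x∈⁅y⁆⇒x≡y w p = all _ q
    ... | inj₂ p | inj₁ q rewrite x∈⁅y⁆⇒x≡y w q = ≃-sym (all _ p)
    ... | inj₂ p | inj₂ q = cl p q
  ...   | M′ , M⊆ , cl′ , max = M′ , (λ v∈ → M⊆ (x∈p∪q⁺ {p = ⁅ w ⁆} (inj₂ v∈))) , cl′ ,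
    λ { (here refl) _ → M⊆ (x∈p∪q⁺ (inj₁ (x∈⁅x⁆ w))) ; (there w∈) → max w∈ }

  extend : ∀ {u v} → u ≃ v → ∃ λ M → MaxClique M × u ∈ˢ M × v ∈ˢ M
  extend {u} {v} uv with grow (allFin n) (⁅ u ⁆ ∪ ⁅ v ⁆) cl
    where
    cl : Clique (_∈ˢ ⁅ u ⁆ ∪ ⁅ v ⁆)
    cl p∈ q∈ with x∈p∪q⁻ ⁅ u ⁆ ⁅ v ⁆ p∈ | x∈p∪q⁻ ⁅ u ⁆ ⁅ v ⁆ q∈
    ... | inj₁ p | inj₁ q rewrite x∈⁅y⁆⇒x≡y u p | x∈⁅y⁆⇒x≡y u q = inj₁ refl
    ... | inj₁ p | inj₂ q rewrite x∈⁅y⁆⇒x≡y u p | x∈⁅y⁆⇒x≡y v q = uv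
    ... | inj₂ p | inj₁ q rewrite x∈⁅y⁆⇒x≡y v p | x∈⁅y⁆⇒x≡y u q = ≃-sym uv
    ... | inj₂ p | inj₂ q rewrite x∈⁅y⁆⇒x≡y v p | x∈⁅y⁆⇒x≡y v q = inj₁ refl
  ... | M , ⊆M , cl′ , max = M , (cl′ , λ w → max (∈-allFin w)) ,
    ⊆M (x∈p∪q⁺ (inj₁ (x∈⁅x⁆ u))) , ⊆M (x∈p∪q⁺ {p = ⁅ u ⁆} (inj₂ (x∈⁅x⁆ v)))

  -- An edge in exactly one maximal clique, namely the common closed neighbourhood of its ends.
  SimplicialEdge : Fin n → Fin n → Set
  SimplicialEdge p q = p ~ q × (∀ u v → (u ≃ p × u ≃ q) → (v ≃ p × v ≃ q) → u ≃ v)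

  simplicialEdge? : ∀ p q → Dec (SimplicialEdge p q)
  simplicialEdge? p q = (p ~? q) ×-dec all? (λ u → all? (λ v →
    ((u ≃? p) ×-dec (u ≃? q)) →-dec (((v ≃? p) ×-dec (v ≃? q)) →-dec (u ≃? v))))

  InSimplicialEdge : Fin n → Fin n → Set
  InSimplicialEdge u v = ∃ λ p → ∃ λ q → SimplicialEdge p q × (u ≃ p × u ≃ q) × (v ≃ p × v ≃ q)

  span? : ∀ p q v → Dec (v ≃ p × v ≃ q)
  span? p q v = (v ≃? p) ×-dec (v ≃? q)

  span-maximal : ∀ {p q} → SimplicialEdge p q → MaxClique ⟪ span? p q ⟫
  span-maximal {p} {q} (pq , cl) =
    (λ u∈ v∈ → cl _ _ (∈-⟪⟫⁻ (span? p q) u∈) (∈-⟪⟫⁻ (span? p q) v∈)) ,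
    λ w h → ∈-⟪⟫⁺ (span? p q)
      ( h p (∈-⟪⟫⁺ (span? p q) (inj₁ refl , inj₂ pq))
      , h q (∈-⟪⟫⁺ (span? p q) (inj₂ (~-sym pq) , inj₁ refl)))

  -- The hypergraph has the maximal cliques as vertices, except for some through a or b all of whose
  -- edges are covered by other maximal cliques.
  module Family (a b : Fin n) where

    Redundant : Subset n → Set
    Redundant M = (a ∈ˢ M ⊎ b ∈ˢ M)
      × (∀ p q → p ∈ˢ M → q ∈ˢ M → ¬ SimplicialEdge p q)
      × (∀ u v → (u ∈ˢ M × u ≢ a × u ≢ b) → (v ∈ˢ M × v ≢ a × v ≢ b) →
         ∃ λ M′ → MaxClique M′ × u ∈ˢ M′ × v ∈ˢ M′ × a ∉ˢ M′ × b ∉ˢ M′)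

    redundant? : ∀ M → Dec (Redundant M)
    redundant? M = ((a ∈ˢ? M) ⊎-dec (b ∈ˢ? M))
      ×-dec all? (λ p → all? (λ q → (p ∈ˢ? M) →-dec ((q ∈ˢ? M) →-dec ¬? (simplicialEdge? p q))))
      ×-dec all? (λ u → all? (λ v → (u′? u) →-dec ((u′? v) →-dec anySubset? (λ M′ →
        maxClique? M′ ×-dec (u ∈ˢ? M′) ×-dec (v ∈ˢ? M′) ×-dec ¬? (a ∈ˢ? M′) ×-dec ¬? (b ∈ˢ? M′)))))
      where u′? = λ u → (u ∈ˢ? M) ×-dec ¬? (u ≟ a) ×-dec ¬? (u ≟ b)

    Member : Subset n → Set
    Member M = MaxClique M × ¬ Redundant M

    member? : ∀ M → Dec (Member M)
    member? M = maxClique? M ×-dec ¬? (redundant? M)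

    incident? : ∀ (v : Fin n) (i : Fin (2 ^ n)) → Dec (v ∈ˢ subset {n} i × Member (subset {n} i))
    incident? v i = (v ∈ˢ? subset {n} i) ×-dec member? (subset {n} i)

    edge : Fin n → Subset (2 ^ n)
    edge v = ⟪ incident? v ⟫

    -- `X`, `Y`, `Z` need not be maximal: a maximal clique contained in a clique equals it, so at
    -- most three members contain `x`.
    Few : Fin n → Set
    Few x = ∃ λ X → ∃ λ Y → ∃ λ Z → Clique (_∈ˢ X) × Clique (_∈ˢ Y) × Clique (_∈ˢ Z) ×
            (∀ {M} → Member M → x ∈ˢ M → M ⊆ X ⊎ M ⊆ Y ⊎ M ⊆ Z)

    few⇒rank≤3 : ∀ {x} → Few x → ∣ edge x ∣ ≤ 3
    few⇒rank≤3 {x} (X , Y , Z , cX , cY , cZ , h) = three-elements (edge x) (index X) (index Y) (index Z) only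
      where
      only : ∀ {i} → i ∈ˢ edge x → i ≡ index X ⊎ i ≡ index Y ⊎ i ≡ index Z
      only {i} i∈ with ∈-⟪⟫⁻ (incident? x) i∈
      ... | x∈ , mem with h mem x∈
      ...   | inj₁ ⊆X        = inj₁ (trans (sym (index-subset {n} i)) (cong index (maximal-≡ (proj₁ mem) cX ⊆X)))
      ...   | inj₂ (inj₁ ⊆Y) = inj₂ (inj₁ (trans (sym (index-subset {n} i)) (cong index (maximal-≡ (proj₁ mem) cY ⊆Y))))
      ...   | inj₂ (inj₂ ⊆Z) = inj₂ (inj₂ (trans (sym (index-subset {n} i)) (cong index (maximal-≡ (proj₁ mem) cZ ⊆Z))))

    common⇒≃ : ∀ {u v} → (∃ λ z → z ∈ˢ edge u × z ∈ˢ edge v) → u ≃ v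
    common⇒≃ {u} {v} (z , zu , zv) with ∈-⟪⟫⁻ (incident? u) zu | ∈-⟪⟫⁻ (incident? v) zv
    ... | u∈ , ((cl , _) , _) | v∈ , _ = cl u∈ v∈

    member⇒common : ∀ {u v M} → Member M → u ∈ˢ M → v ∈ˢ M → ∃ λ z → z ∈ˢ edge u × z ∈ˢ edge v
    member⇒common {u} {v} {M} mem u∈ v∈ = index M , ∈-⟪⟫⁺ (incident? u) (at u∈) , ∈-⟪⟫⁺ (incident? v) (at v∈)
      where
      at : ∀ {w} → w ∈ˢ M → w ∈ˢ subset {n} (index M) × Member (subset {n} (index M))
      at w∈ rewrite subset-index M = w∈ , mem

    simplicial⇒common : ∀ {u v} → InSimplicialEdge u v → ∃ λ z → z ∈ˢ edge u × z ∈ˢ edge v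
    simplicial⇒common (p , q , s@(pq , _) , u∈ , v∈) = member⇒common
      (span-maximal s , λ (_ , none , _) → none p q (∈-⟪⟫⁺ (span? p q) (inj₁ refl , inj₂ pq))
         (∈-⟪⟫⁺ (span? p q) (inj₂ (~-sym pq) , inj₁ refl)) s)
      (∈-⟪⟫⁺ (span? p q) u∈) (∈-⟪⟫⁺ (span? p q) v∈)

    adjacent⇒common : (∀ v → a ~ v → InSimplicialEdge a v) → (∀ v → b ~ v → InSimplicialEdge b v) →
                      ∀ {u v} → u ~ v → ∃ λ z → z ∈ˢ edge u × z ∈ˢ edge v
    adjacent⇒common at-a at-b {u} {v} uv with u ≟ a | v ≟ a | u ≟ b | v ≟ b
    ... | yes refl | _ | _ | _ = simplicial⇒common (at-a v uv)
    ... | no _ | yes refl | _ | _ with at-a u (~-sym uv)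
    ...   | p , q , s , h , k = simplicial⇒common (p , q , s , k , h)
    adjacent⇒common at-a at-b {u} {v} uv | no _ | no _ | yes refl | _ = simplicial⇒common (at-b v uv)
    adjacent⇒common at-a at-b {u} {v} uv | no _ | no _ | no _ | yes refl with at-b u (~-sym uv)
    ...   | p , q , s , h , k = simplicial⇒common (p , q , s , k , h)
    adjacent⇒common at-a at-b {u} {v} uv | no u≢a | no v≢a | no u≢b | no v≢b with extend (inj₂ uv)
    ... | M , max , u∈ , v∈ with redundant? M
    ...   | no ¬red = member⇒common (max , ¬red) u∈ v∈
    ...   | yes (_ , _ , away) with away u v (u∈ , u≢a , u≢b) (v∈ , v≢a , v≢b)
    ...     | M′ , max′ , u∈′ , v∈′ , a∉ , b∉ = member⇒common (max′ , λ (ends , _) → [ a∉ , b∉ ]′ ends) u∈′ v∈′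

  -- The maximal cliques through one vertex

  module Structure (free : ClawFree G) where

    record OneSided (x : Fin n) : Set₁ where
      field separation : Separation x
      open Separation separation public
      field complete : x ~ w → ∀ {v} → x ~ v → P v → v ≢ w → w ≃ v

    flip-separation : ∀ {x} → Separation x → Separation x
    flip-separation s = record
      { w = w ; P = R ; R = P ; P? = R? ; R? = P? ; cover = λ xv → [ inj₂ , inj₁ ]′ (cover xv)
      ; P-clique = R-clique ; R-clique = P-clique
      ; apart = λ xu xv Ru Pv u≢w v≢w h → apart xv xu Pv Ru v≢w u≢w (≃-sym h) }
      where open Separation s

    -- If `w` misses some `p` on side `P`, then `w` is joined to all of side `R`: `p` misses that
    -- side as well, and `x` centres no claw. The sides are then swapped.
    oneSided : ∀ {x} → Separation x → OneSided x
    oneSided {x} s with all? (λ v → ((x ~? v) ×-dec P? v ×-dec ¬? (v ≟ w)) →-dec (w ≃? v))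
      where open Separation s
    ... | yes h = record { separation = s ; complete = λ _ xv Pv v≢w → h _ (xv , Pv , v≢w) }
    ... | no ¬h with ¬∀⟶∃¬ n _ (λ v → ((x ~? v) ×-dec P? v ×-dec ¬? (v ≟ w)) →-dec (w ≃? v)) ¬h
      where open Separation s
    ...   | p , ¬hp = record { separation = flip-separation s ; complete = complete′ }
      where
      open Separation s
      p∈ : x ~ p × P p × p ≢ w
      p∈ = decidable-stable ((x ~? p) ×-dec P? p ×-dec ¬? (p ≟ w)) (λ no-p → ¬hp (λ h → ⊥-elim (no-p h)))
      complete′ : x ~ w → ∀ {v} → x ~ v → R v → v ≢ w → w ≃ v
      complete′ xw xv Rv v≢w = thirdN free (proj₁ p∈) xw xv (λ h → ¬hp (λ _ → ≃-sym h))
        (apart (proj₁ p∈) xv (proj₁ (proj₂ p∈)) Rv (proj₂ (proj₂ p∈)) v≢w)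

    module Sides {x : Fin n} (one-sided : OneSided x) where
      open OneSided one-sided

      data Class (v : Fin n) : Set where
        centre : v ≡ x → Class v
        cut    : x ~ v → v ≡ w → Class v
        left   : x ~ v → P v → v ≢ w → Class v
        right  : x ~ v → R v → v ≢ w → Class v

      classify : ∀ {v} → v ≃ x → Class v
      classify (inj₁ e) = centre e
      classify {v} (inj₂ e) with v ≟ w | cover (~-sym e)
      ... | yes v≡w | _       = cut (~-sym e) v≡w
      ... | no v≢w  | inj₁ Pv = left (~-sym e) Pv v≢w
      ... | no v≢w  | inj₂ Rv = right (~-sym e) Rv v≢w

      X Y Z : Fin n → Set
      X v = v ≡ x ⊎ (x ~ v × v ≡ w) ⊎ (x ~ v × P v × v ≢ w)
      Y v = v ≡ x ⊎ (x ~ v × v ≡ w) ⊎ (x ~ v × R v × v ≢ w × v ≃ w)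
      Z v = v ≡ x ⊎ (x ~ v × R v × v ≢ w)

      X-clique : Clique X
      X-clique (inj₁ refl) (inj₁ refl) = inj₁ refl
      X-clique (inj₁ refl) (inj₂ (inj₁ (xv , _))) = inj₂ xv
      X-clique (inj₁ refl) (inj₂ (inj₂ (xv , _))) = inj₂ xv
      X-clique (inj₂ (inj₁ (xu , _))) (inj₁ refl) = inj₂ (~-sym xu)
      X-clique (inj₂ (inj₂ (xu , _))) (inj₁ refl) = inj₂ (~-sym xu)
      X-clique (inj₂ (inj₁ (xu , refl))) (inj₂ (inj₁ (xv , refl))) = inj₁ refl
      X-clique (inj₂ (inj₁ (xu , refl))) (inj₂ (inj₂ (xv , Pv , v≢w))) = complete xu xv Pv v≢w
      X-clique (inj₂ (inj₂ (xu , Pu , u≢w))) (inj₂ (inj₁ (xv , refl))) = ≃-sym (complete xv xu Pu u≢w)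
      X-clique (inj₂ (inj₂ (xu , Pu , u≢w))) (inj₂ (inj₂ (xv , Pv , v≢w))) = P-clique xu xv Pu Pv u≢w v≢w

      Y-clique : Clique Y
      Y-clique (inj₁ refl) (inj₁ refl) = inj₁ refl
      Y-clique (inj₁ refl) (inj₂ (inj₁ (xv , _))) = inj₂ xv
      Y-clique (inj₁ refl) (inj₂ (inj₂ (xv , _))) = inj₂ xv
      Y-clique (inj₂ (inj₁ (xu , _))) (inj₁ refl) = inj₂ (~-sym xu)
      Y-clique (inj₂ (inj₂ (xu , _))) (inj₁ refl) = inj₂ (~-sym xu)
      Y-clique (inj₂ (inj₁ (xu , refl))) (inj₂ (inj₁ (xv , refl))) = inj₁ refl
      Y-clique (inj₂ (inj₁ (xu , refl))) (inj₂ (inj₂ (xv , _ , _ , vw))) = ≃-sym vw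
      Y-clique (inj₂ (inj₂ (xu , _ , _ , uw))) (inj₂ (inj₁ (xv , refl))) = uw
      Y-clique (inj₂ (inj₂ (xu , Ru , u≢w , _))) (inj₂ (inj₂ (xv , Rv , v≢w , _))) = R-clique xu xv Ru Rv u≢w v≢w

      Z-clique : Clique Z
      Z-clique (inj₁ refl) (inj₁ refl) = inj₁ refl
      Z-clique (inj₁ refl) (inj₂ (xv , _)) = inj₂ xv
      Z-clique (inj₂ (xu , _)) (inj₁ refl) = inj₂ (~-sym xu)
      Z-clique (inj₂ (xu , Ru , u≢w)) (inj₂ (xv , Rv , v≢w)) = R-clique xu xv Ru Rv u≢w v≢w

      X? : ∀ v → Dec (X v)
      X? v = (v ≟ x) ⊎-dec ((x ~? v) ×-dec (v ≟ w)) ⊎-dec ((x ~? v) ×-dec P? v ×-dec ¬? (v ≟ w))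
      Y? : ∀ v → Dec (Y v)
      Y? v = (v ≟ x) ⊎-dec ((x ~? v) ×-dec (v ≟ w)) ⊎-dec ((x ~? v) ×-dec R? v ×-dec ¬? (v ≟ w) ×-dec (v ≃? w))
      Z? : ∀ v → Dec (Z v)
      Z? v = (v ≟ x) ⊎-dec ((x ~? v) ×-dec R? v ×-dec ¬? (v ≟ w))

      -- A clique through `x` with no vertex of `R` other than `w` lies in `X`. Any other one has no
      -- vertex of `P` besides possibly `w`, and lies in `Y` or `Z` according to whether it contains
      -- `w` as a neighbour of `x`.
      few : ∀ a b → Family.Few a b x
      few a b = ⟪ X? ⟫ , ⟪ Y? ⟫ , ⟪ Z? ⟫ , (λ p q → X-clique (∈-⟪⟫⁻ X? p) (∈-⟪⟫⁻ X? q)) ,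
        (λ p q → Y-clique (∈-⟪⟫⁻ Y? p) (∈-⟪⟫⁻ Y? q)) , (λ p q → Z-clique (∈-⟪⟫⁻ Z? p) (∈-⟪⟫⁻ Z? q)) , within
        where
        within : ∀ {M} → Family.Member a b M → x ∈ˢ M → M ⊆ ⟪ X? ⟫ ⊎ M ⊆ ⟪ Y? ⟫ ⊎ M ⊆ ⟪ Z? ⟫
        within {M} ((cl , _) , _) x∈
          with any? (λ r → (r ∈ˢ? M) ×-dec ((x ~? r) ×-dec R? r ×-dec ¬? (r ≟ w))) | (x ~? w) ×-dec (w ∈ˢ? M)
        ... | no none | _ = inj₁ λ {v} v∈ → ∈-⟪⟫⁺ X? (inX v∈ (classify (cl v∈ x∈)))
          where
          inX : ∀ {v} → v ∈ˢ M → Class v → X v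
          inX v∈ (centre e)       = inj₁ e
          inX v∈ (cut xv e)       = inj₂ (inj₁ (xv , e))
          inX v∈ (left xv Pv ne)  = inj₂ (inj₂ (xv , Pv , ne))
          inX v∈ (right xv Rv ne) = ⊥-elim (none (_ , v∈ , xv , Rv , ne))
        ... | yes (r , r∈ , xr , Rr , r≢w) | yes (xw , w∈) = inj₂ (inj₁ λ v∈ → ∈-⟪⟫⁺ Y? (inY v∈ (classify (cl v∈ x∈))))
          where
          inY : ∀ {v} → v ∈ˢ M → Class v → Y v
          inY v∈ (centre e)       = inj₁ e
          inY v∈ (cut xv e)       = inj₂ (inj₁ (xv , e))
          inY v∈ (left xv Pv ne)  = ⊥-elim (apart xv xr Pv Rr ne r≢w (cl v∈ r∈))
          inY v∈ (right xv Rv ne) = inj₂ (inj₂ (xv , Rv , ne , cl v∈ w∈))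
        ... | yes (r , r∈ , xr , Rr , r≢w) | no ¬w = inj₂ (inj₂ λ v∈ → ∈-⟪⟫⁺ Z? (inZ v∈ (classify (cl v∈ x∈))))
          where
          inZ : ∀ {v} → v ∈ˢ M → Class v → Z v
          inZ v∈ (centre e)       = inj₁ e
          inZ v∈ (cut xv refl)    = ⊥-elim (¬w (xv , v∈))
          inZ v∈ (left xv Pv ne)  = ⊥-elim (apart xv xr Pv Rr ne r≢w (cl v∈ r∈))
          inZ v∈ (right xv Rv ne) = inj₂ (xv , Rv , ne)

      simplicial-in : ∀ {v} (K : Fin n → Set) → Clique K → x ~ v → (∀ {u} → u ≃ v → Class u → K u) → SimplicialEdge x v
      simplicial-in K cl xv inK = xv , λ u v (ux , uv) (vx , vv) → cl (inK uv (classify ux)) (inK vv (classify vx))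

      left-simplicial : ∀ {v} → x ~ v → P v → v ≢ w → SimplicialEdge x v
      left-simplicial {v} xv Pv v≢w = simplicial-in X X-clique xv inX
        where
        inX : ∀ {u} → u ≃ v → Class u → X u
        inX h (centre e)       = inj₁ e
        inX h (cut xu e)       = inj₂ (inj₁ (xu , e))
        inX h (left xu Pu ne)  = inj₂ (inj₂ (xu , Pu , ne))
        inX h (right xu Ru ne) = ⊥-elim (apart xv xu Pv Ru v≢w ne (≃-sym h))

      right-simplicial : ∀ {v} → x ~ v → R v → v ≢ w → ¬ (x ~ w × v ≃ w) → SimplicialEdge x v
      right-simplicial {v} xv Rv v≢w ¬vw = simplicial-in Z Z-clique xv inZ
        where
        inZ : ∀ {u} → u ≃ v → Class u → Z u
        inZ h (centre e)       = inj₁ e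
        inZ h (cut xu refl)    = ⊥-elim (¬vw (xu , ≃-sym h))
        inZ h (left xu Pu ne)  = ⊥-elim (apart xu xv Pu Rv ne v≢w h)
        inZ h (right xu Ru ne) = inj₂ (xu , Ru , ne)

      itself : ∀ {v} → SimplicialEdge x v → InSimplicialEdge x v
      itself s = x , _ , s , (inj₁ refl , inj₂ (proj₁ s)) , (inj₂ (~-sym (proj₁ s)) , inj₁ refl)

      -- When the edge from `x` to `v` need not be simplicial, another edge at `x` is, and its
      -- clique contains `v`: the edge to some `r` on side `R` that misses `w`, or for `v = w` the
      -- edge to some `p` on side `P`. If no such vertex exists, the clique `Y` shows that the edge
      -- itself is simplicial.
      in-simplicial-edge : ∀ v → x ~ v → InSimplicialEdge x v
      in-simplicial-edge v xv with classify (inj₂ (~-sym xv))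
      ... | centre refl      = ⊥-elim (~-irr xv)
      ... | left _ Pv ne     = itself (left-simplicial xv Pv ne)
      ... | right _ Rv ne with (x ~? w) ×-dec (v ≃? w)
      ...   | no ¬vw = itself (right-simplicial xv Rv ne ¬vw)
      ...   | yes (xw , vw) with any? (λ r → (x ~? r) ×-dec R? r ×-dec ¬? (r ≟ w) ×-dec ¬? (r ≃? w))
      ...     | yes (r , xr , Rr , r≢w , rw) =
        x , r , right-simplicial xr Rr r≢w (λ (_ , h) → rw h) , (inj₁ refl , inj₂ xr) ,
        (inj₂ (~-sym xv) , R-clique xv xr Rv Rr ne r≢w)
      ...     | no none = itself (simplicial-in Y Y-clique xv inY)
        where
        inY : ∀ {u} → u ≃ v → Class u → Y u
        inY h (centre e)        = inj₁ e
        inY h (cut xu e)        = inj₂ (inj₁ (xu , e))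
        inY h (left xu Pu ne′)  = ⊥-elim (apart xu xv Pu Rv ne′ ne h)
        inY {u} h (right xu Ru ne′) =
          inj₂ (inj₂ (xu , Ru , ne′ , decidable-stable (u ≃? w) λ ¬uw → none (u , xu , Ru , ne′ , ¬uw)))
      in-simplicial-edge v xv | cut xw refl with any? (λ p → (x ~? p) ×-dec P? p ×-dec ¬? (p ≟ w))
      ...   | yes (p , xp , Pp , p≢w) =
        x , p , left-simplicial xp Pp p≢w , (inj₁ refl , inj₂ xp) , (inj₂ (~-sym xv) , complete xv xp Pp p≢w)
      ...   | no none = itself (simplicial-in Y Y-clique xv inY)
        where
        inY : ∀ {u} → u ≃ v → Class u → Y u
        inY h (centre e)        = inj₁ e
        inY h (cut xu e)        = inj₂ (inj₁ (xu , e))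
        inY h (left xu Pu ne′)  = ⊥-elim (none (_ , xu , Pu , ne′))
        inY h (right xu Ru ne′) = inj₂ (inj₂ (xu , Ru , ne′ , h))

    -- N(x) is a clique and forms one side. The choice `w = x` exempts no neighbour of `x`.
    simplicial-separation : ∀ {x} → ¬ NonSimplicial G x → Separation x
    simplicial-separation {x} simp = record
      { w = x ; P = λ _ → ⊤ ; R = λ _ → ⊥ ; P? = λ _ → yes tt ; R? = λ _ → no λ () ; cover = λ _ → inj₁ tt
      ; P-clique = λ {u} {v} xu xv _ _ _ _ → decidable-stable (u ≃? v) λ ¬uv →
          simp (u , v , (λ e → ¬uv (inj₁ e)) , xu , xv , Bool.¬-not (λ e → ¬uv (inj₂ e)))
      ; R-clique = λ _ _ () ; apart = λ _ _ _ () }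

    module TwoSides {a b x : Fin n} (x≢a : x ≢ a) (x≢b : x ≢ b) (two-sided : TwoSided G a b x) where
      open TwoSided two-sided
      open Family a b

      S≄f₁ : ∀ {s} → x ~ s → InS s → ¬ (f₁ ≃ s)
      S≄f₁ xs Ss (inj₁ refl) = disjoint xs Ss f₁∈T
      S≄f₁ xs Ss (inj₂ e)    = [ f₁≢a , f₁≢b ]′ (cross xs xf₁ Ss f₁∈T (~-sym e))

      S-clique : ∀ {u v} → x ~ u → x ~ v → InS u → InS v → u ≃ v
      S-clique xu xv Su Sv = thirdN free xf₁ xu xv (S≄f₁ xu Su) (S≄f₁ xv Sv)

      inner≄S : ∀ {s t} → x ~ s → x ~ t → InS s → InT t → t ≢ a → t ≢ b → ¬ (s ≃ t)
      inner≄S xs xt Ss Tt t≢a t≢b (inj₁ refl) = disjoint xs Ss Tt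
      inner≄S xs xt Ss Tt t≢a t≢b (inj₂ e)    = [ t≢a , t≢b ]′ (cross xs xt Ss Tt e)

      far : ∀ {t} → x ~ t → InT t → ∃ λ e → x ~ e × InS e × ¬ (e ≃ t)
      far {t} xt Tt with e₁ ≃? t | e₂ ≃? t
      ... | no h  | _     = e₁ , xe₁ , e₁∈S , h
      ... | yes _ | no h  = e₂ , xe₂ , e₂∈S , h
      ... | yes h | yes k = ⊥-elim (disjoint xt (≃-sym h , ≃-sym k) Tt)

      -- Some end `e` on side `S` misses `v`, and it misses `u` since `u` is neither `a` nor `b`;
      -- there is no claw at `x`. So `a`, `b` is the only pair that may be non-adjacent on side `T`.
      T-adjacent : ∀ {u v} → x ~ u → x ~ v → InT u → InT v → u ≢ a → u ≢ b → u ≃ v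
      T-adjacent xu xv Tu Tv u≢a u≢b with far xv Tv
      ... | e , xe , Se , h = thirdN free xe xu xv (inner≄S xe xu Se Tu u≢a u≢b) h

      S? : ∀ v → Dec (InS v)
      S? v = (v ≃? e₁) ×-dec (v ≃? e₂)
      T? : ∀ v → Dec (InT v)
      T? v = (v ≃? f₁) ×-dec (v ≃? f₂)

      one-end : ∀ w → (∀ {t} → x ~ t → InT t → t ≡ a ⊎ t ≡ b → t ≡ w) → Separation x
      one-end w only = record
        { w = w ; P = InS ; R = InT ; P? = S? ; R? = T? ; cover = cover
        ; P-clique = λ xu xv Su Sv _ _ → S-clique xu xv Su Sv
        ; R-clique = λ xu xv Tu Tv u≢w _ →
            T-adjacent xu xv Tu Tv (λ e → u≢w (only xu Tu (inj₁ e))) (λ e → u≢w (only xu Tu (inj₂ e)))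
        ; apart = λ { xu xv Su Tv _ _ (inj₁ refl) → disjoint xu Su Tv
                    ; xu xv Su Tv _ v≢w (inj₂ e) → v≢w (only xv Tv (cross xu xv Su Tv e)) } }

      module BothEnds (xa : x ~ a) (xb : x ~ b) (Ta : InT a) (Tb : InT b) where

        data Kind (v : Fin n) : Set where
          centre : v ≡ x → Kind v
          inS    : x ~ v → InS v → Kind v
          inT    : x ~ v → InT v → Kind v

        kind : ∀ {v} → v ≃ x → Kind v
        kind (inj₁ e) = centre e
        kind (inj₂ e) = [ inS (~-sym e) , inT (~-sym e) ]′ (cover (~-sym e))

        xS : Fin n → Set
        xS v = v ≡ x ⊎ (x ~ v × InS v)
        xS? : ∀ v → Dec (xS v)
        xS? v = (v ≟ x) ⊎-dec ((x ~? v) ×-dec S? v)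

        xS-clique : Clique xS
        xS-clique (inj₁ refl)      (inj₁ refl)      = inj₁ refl
        xS-clique (inj₁ refl)      (inj₂ (xv , _))  = inj₂ xv
        xS-clique (inj₂ (xu , _))  (inj₁ refl)      = inj₂ (~-sym xu)
        xS-clique (inj₂ (xu , Su)) (inj₂ (xv , Sv)) = S-clique xu xv Su Sv

        xS-maximal : MaxClique ⟪ xS? ⟫
        xS-maximal = (λ p q → xS-clique (∈-⟪⟫⁻ xS? p) (∈-⟪⟫⁻ xS? q)) , maximal
          where
          maximal : ∀ w → (∀ u → u ∈ˢ ⟪ xS? ⟫ → w ≃ u) → w ∈ˢ ⟪ xS? ⟫
          maximal w h with h x (∈-⟪⟫⁺ xS? (inj₁ refl))
          ... | inj₁ e = ∈-⟪⟫⁺ xS? (inj₁ e)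
          ... | inj₂ e = ∈-⟪⟫⁺ xS? (inj₂ (~-sym e , h e₁ (∈-⟪⟫⁺ xS? (inj₂ (xe₁ , e₁∈S))) ,
                                                     h e₂ (∈-⟪⟫⁺ xS? (inj₂ (xe₂ , e₂∈S)))))

        T∉xS : ∀ {t} → x ≢ t → x ~ t → InT t → t ∉ˢ ⟪ xS? ⟫
        T∉xS x≢t xt Tt t∈ with ∈-⟪⟫⁻ xS? t∈
        ... | inj₁ e        = x≢t (sym e)
        ... | inj₂ (_ , St) = disjoint xt St Tt

        -- A clique meeting both S and T has no simplicial edge: the pairs of non-adjacent common
        -- neighbours are taken among f₁, x, the vertices of S and T in it, and the escape vertices.
        mixed-redundant : ∀ {M s t} → Clique (_∈ˢ M) → x ∈ˢ M → s ∈ˢ M → x ~ s → InS s → t ∈ˢ M → x ~ t → InT t → Redundant M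
        mixed-redundant {M} {s} {t} cl x∈ s∈ xs Ss t∈ xt Tt = ends , no-simplicial , away
          where
          S~T : ∀ {u v} → u ∈ˢ M → v ∈ˢ M → x ~ u → x ~ v → InS u → InT v → u ~ v
          S~T u∈ v∈ xu xv Su Tv = ≃⇒~ (λ { refl → disjoint xu Su Tv }) (cl u∈ v∈)
          end : ∀ {v} → v ∈ˢ M → x ~ v → InT v → v ≡ a ⊎ v ≡ b
          end v∈ xv Tv = cross xs xv Ss Tv (S~T s∈ v∈ xs xv Ss Tv)
          ends : a ∈ˢ M ⊎ b ∈ˢ M
          ends with end t∈ xt Tt
          ... | inj₁ refl = inj₁ t∈
          ... | inj₂ refl = inj₂ t∈
          f₁≃T : ∀ {v} → InT v → f₁ ≃ v
          f₁≃T Tv = ≃-sym (proj₁ Tv)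
          x≄ : ∀ {y} → y ≢ x → ¬ (x ~ y) → ¬ (x ≃ y)
          x≄ y≢x x≁y (inj₁ e) = y≢x (sym e)
          x≄ y≢x x≁y (inj₂ e) = x≁y e
          TS : ∀ {u v} → u ∈ˢ M → v ∈ˢ M → x ~ u → x ~ v → InT u → InS v → ∃ λ y → u ≃ y × v ≃ y × ¬ (x ≃ y)
          TS u∈ v∈ xu xv Tu Sv with escape (end u∈ xu Tu) xu Tu
          ... | y , uy , y≢x , x≁y , ys = y , inj₂ uy , inj₂ (~-sym (ys xv Sv (S~T v∈ u∈ xv xu Sv Tu))) , x≄ y≢x x≁y
          SS : ∀ {u v} → u ∈ˢ M → v ∈ˢ M → x ~ u → x ~ v → InS u → InS v → ∃ λ y → u ≃ y × v ≃ y × ¬ (x ≃ y)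
          SS u∈ v∈ xu xv Su Sv with escape (end t∈ xt Tt) xt Tt
          ... | y , ty , y≢x , x≁y , ys = y , inj₂ (~-sym (ys xu Su (S~T u∈ t∈ xu xt Su Tt))) ,
            inj₂ (~-sym (ys xv Sv (S~T v∈ t∈ xv xt Sv Tt))) , x≄ y≢x x≁y
          refute : ∀ {p q} u v → u ≃ p → u ≃ q → v ≃ p → v ≃ q → ¬ (u ≃ v) → ¬ SimplicialEdge p q
          refute u v up uq vp vq ¬uv (_ , h) = ¬uv (h u v (up , uq) (vp , vq))
          flip-simplicial : ∀ {p q} → SimplicialEdge p q → SimplicialEdge q p
          flip-simplicial (pq , h) = ~-sym pq , λ u v (uq , up) (vq , vp) → h u v (up , uq) (vp , vq)
          xT : ∀ {v} → v ∈ˢ M → x ~ v → InT v → ¬ SimplicialEdge x v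
          xT v∈ xv Tv = refute f₁ s (inj₂ (~-sym xf₁)) (f₁≃T Tv) (inj₂ (~-sym xs)) (cl s∈ v∈) (S≄f₁ xs Ss)
          xS′ : ∀ {v} → v ∈ˢ M → x ~ v → InS v → ¬ SimplicialEdge x v
          xS′ v∈ xv Sv with far xt Tt
          ... | e , xe , Se , h = refute e t (inj₂ (~-sym xe)) (S-clique xe xv Se Sv) (inj₂ (~-sym xt)) (cl t∈ v∈) h
          via-x : ∀ {u v} → u ≃ x → v ≃ x → (∃ λ y → u ≃ y × v ≃ y × ¬ (x ≃ y)) → ¬ SimplicialEdge u v
          via-x ux vx (y , uy , vy , ¬xy) = refute x y (≃-sym ux) (≃-sym vx) (≃-sym uy) (≃-sym vy) ¬xy
          no-simplicial : ∀ p q → p ∈ˢ M → q ∈ˢ M → ¬ SimplicialEdge p q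
          no-simplicial p q p∈ q∈ h with kind (cl p∈ x∈) | kind (cl q∈ x∈)
          ... | centre refl | centre refl = ~-irr (proj₁ h)
          ... | centre refl | inS xq Sq   = xS′ q∈ xq Sq h
          ... | centre refl | inT xq Tq   = xT q∈ xq Tq h
          ... | inS xp Sp   | centre refl = xS′ p∈ xp Sp (flip-simplicial h)
          ... | inT xp Tp   | centre refl = xT p∈ xp Tp (flip-simplicial h)
          ... | inS xp Sp   | inS xq Sq   = via-x (cl p∈ x∈) (cl q∈ x∈) (SS p∈ q∈ xp xq Sp Sq) h
          ... | inT xp Tp   | inS xq Sq   = via-x (cl p∈ x∈) (cl q∈ x∈) (TS p∈ q∈ xp xq Tp Sq) h
          ... | inS xp Sp   | inT xq Tq   = via-x (cl q∈ x∈) (cl p∈ x∈) (TS q∈ p∈ xq xp Tq Sp) (flip-simplicial h)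
          ... | inT xp Tp   | inT xq Tq   =
            refute f₁ s (f₁≃T Tp) (f₁≃T Tq) (cl s∈ p∈) (cl s∈ q∈) (S≄f₁ xs Ss) h
          in-xS : ∀ {v} → v ∈ˢ M × v ≢ a × v ≢ b → v ∈ˢ ⟪ xS? ⟫
          in-xS (v∈ , v≢a , v≢b) with kind (cl v∈ x∈)
          ... | centre e  = ∈-⟪⟫⁺ xS? (inj₁ e)
          ... | inS xv Sv = ∈-⟪⟫⁺ xS? (inj₂ (xv , Sv))
          ... | inT xv Tv = ⊥-elim ([ v≢a , v≢b ]′ (end v∈ xv Tv))
          away : ∀ u v → (u ∈ˢ M × u ≢ a × u ≢ b) → (v ∈ˢ M × v ≢ a × v ≢ b) →
                 ∃ λ M′ → MaxClique M′ × u ∈ˢ M′ × v ∈ˢ M′ × a ∉ˢ M′ × b ∉ˢ M′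
          away u v hu hv = ⟪ xS? ⟫ , xS-maximal , in-xS hu , in-xS hv , T∉xS x≢a xa Ta , T∉xS x≢b xb Tb

        xT : (Fin n → Set) → Fin n → Set
        xT K v = v ≡ x ⊎ (x ~ v × InT v × K v)

        xT-clique : ∀ K → (K a → K b → a ≃ b) → Clique (xT K)
        xT-clique K ab (inj₁ refl)     (inj₁ refl)     = inj₁ refl
        xT-clique K ab (inj₁ refl)     (inj₂ (xv , _)) = inj₂ xv
        xT-clique K ab (inj₂ (xu , _)) (inj₁ refl)     = inj₂ (~-sym xu)
        xT-clique K ab {u} {v} (inj₂ (xu , Tu , Ku)) (inj₂ (xv , Tv , Kv)) with u ≟ a | u ≟ b | v ≟ a | v ≟ b
        ... | no u≢a   | no u≢b   | _        | _        = T-adjacent xu xv Tu Tv u≢a u≢b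
        ... | _        | _        | no v≢a   | no v≢b   = ≃-sym (T-adjacent xv xu Tv Tu v≢a v≢b)
        ... | yes refl | _        | yes refl | _        = inj₁ refl
        ... | yes refl | _        | no _     | yes refl = ab Ku Kv
        ... | no _     | yes refl | yes refl | _        = ≃-sym (ab Kv Ku)
        ... | no _     | yes refl | no _     | yes refl = inj₁ refl

        -- Cliques meeting both sides are redundant, so a member through `x` meets only one. Side
        -- `T` is taken once without `b` and once without `a`; if `a ≃ b`, the second disjunct in
        -- `A` and `B` makes both the whole side, which is then a clique.
        few : Few x
        few = ⟪ xS? ⟫ , ⟪ A? ⟫ , ⟪ B? ⟫ , proj₁ xS-maximal ,
          (λ p q → xT-clique A ab-A (∈-⟪⟫⁻ A? p) (∈-⟪⟫⁻ A? q)) ,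
          (λ p q → xT-clique B ab-B (∈-⟪⟫⁻ B? p) (∈-⟪⟫⁻ B? q)) , within
          where
          A B : Fin n → Set
          A v = v ≢ b ⊎ a ≃ b
          B v = v ≢ a ⊎ a ≃ b
          A? : ∀ v → Dec (xT A v)
          A? v = (v ≟ x) ⊎-dec ((x ~? v) ×-dec T? v ×-dec (¬? (v ≟ b) ⊎-dec (a ≃? b)))
          B? : ∀ v → Dec (xT B v)
          B? v = (v ≟ x) ⊎-dec ((x ~? v) ×-dec T? v ×-dec (¬? (v ≟ a) ⊎-dec (a ≃? b)))
          ab-A : A a → A b → a ≃ b
          ab-A _ (inj₁ b≢b) = ⊥-elim (b≢b refl)
          ab-A _ (inj₂ h)   = h
          ab-B : B a → B b → a ≃ b
          ab-B (inj₁ a≢a) _ = ⊥-elim (a≢a refl)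
          ab-B (inj₂ h)   _ = h
          within : ∀ {M} → Member M → x ∈ˢ M → M ⊆ ⟪ xS? ⟫ ⊎ M ⊆ ⟪ A? ⟫ ⊎ M ⊆ ⟪ B? ⟫
          within {M} ((cl , _) , ¬red) x∈
            with any? (λ s → (s ∈ˢ? M) ×-dec (x ~? s) ×-dec S? s)
               | any? (λ t → (t ∈ˢ? M) ×-dec (x ~? t) ×-dec T? t) | b ∈ˢ? M
          ... | yes (s , s∈ , xs , Ss) | yes (t , t∈ , xt , Tt) | _ =
            ⊥-elim (¬red (mixed-redundant cl x∈ s∈ xs Ss t∈ xt Tt))
          ... | yes _ | no none | _ = inj₁ λ {v} v∈ → ∈-⟪⟫⁺ xS? (inS′ v∈ (kind (cl v∈ x∈)))
            where
            inS′ : ∀ {v} → v ∈ˢ M → Kind v → xS v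
            inS′ v∈ (centre e)  = inj₁ e
            inS′ v∈ (inS xv Sv) = inj₂ (xv , Sv)
            inS′ v∈ (inT xv Tv) = ⊥-elim (none (_ , v∈ , xv , Tv))
          ... | no none | _ | yes b∈ = inj₂ (inj₂ λ {v} v∈ → ∈-⟪⟫⁺ B? (inB v∈ (kind (cl v∈ x∈))))
            where
            K : ∀ {v} → v ∈ˢ M → B v
            K {v} v∈ with v ≟ a
            ... | yes refl = inj₂ (cl v∈ b∈)
            ... | no v≢a   = inj₁ v≢a
            inB : ∀ {v} → v ∈ˢ M → Kind v → xT B v
            inB v∈ (centre e)  = inj₁ e
            inB v∈ (inS xv Sv) = ⊥-elim (none (_ , v∈ , xv , Sv))
            inB v∈ (inT xv Tv) = inj₂ (xv , Tv , K v∈)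
          ... | no none | _ | no b∉ = inj₂ (inj₁ λ {v} v∈ → ∈-⟪⟫⁺ A? (inA v∈ (kind (cl v∈ x∈))))
            where
            inA : ∀ {v} → v ∈ˢ M → Kind v → xT A v
            inA v∈ (centre e)  = inj₁ e
            inA v∈ (inS xv Sv) = ⊥-elim (none (_ , v∈ , xv , Sv))
            inA v∈ (inT xv Tv) = inj₂ (xv , Tv , inj₁ λ { refl → b∉ v∈ })

      few : Few x
      few with (x ~? a) ×-dec T? a | (x ~? b) ×-dec T? b
      ... | yes (xa , Ta) | yes (xb , Tb) = BothEnds.few xa xb Ta Tb
      ... | yes _ | no ¬b = Sides.few (oneSided (one-end a only-a)) a b
        where
        only-a : ∀ {t} → x ~ t → InT t → t ≡ a ⊎ t ≡ b → t ≡ a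
        only-a xt Tt (inj₁ e)    = e
        only-a xt Tt (inj₂ refl) = ⊥-elim (¬b (xt , Tt))
      ... | no ¬a | _ = Sides.few (oneSided (one-end b only-b)) a b
        where
        only-b : ∀ {t} → x ~ t → InT t → t ≡ a ⊎ t ≡ b → t ≡ b
        only-b xt Tt (inj₁ refl) = ⊥-elim (¬a (xt , Tt))
        only-b xt Tt (inj₂ e)    = e

-- The closure

¬¬-∀ : ∀ {n} {P : Fin n → Set} → (∀ i → ¬ ¬ P i) → ¬ ¬ (∀ i → P i)
¬¬-∀ {zero}  h k = k λ ()
¬¬-∀ {suc n} h k = h zero λ p₀ → ¬¬-∀ (λ i → h (suc i)) λ ps → k λ { zero → p₀ ; (suc i) → ps i }

module _ {n : ℕ} where

  TuttePath : Graph n → Fin n → Fin n → Set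
  TuttePath G a b = Σ (List (Fin n)) λ P → IsMaximalPath G a b P × IsTuttePath G P

  -- With fewer edges, each component off the path lies in an old one and has no new neighbours on
  -- the path, so the same list bounds them.
  tutte-mono : ∀ {G H : Graph n} {l P} → (∀ {u v} → Adj G u v → Adj H u v) → l ↭ P →
               IsTuttePath H P → IsTuttePath G l
  tutte-mono {G} {H} {l} {P} G⊆H σ tutte v v∉ with tutte v (λ v∈ → v∉ (∈-resp-↭ (↭-sym σ) v∈))
  ... | K , len , h = K , subst (λ k → length K ≤ 3 ⊓ (k ∸ 1)) (sym (↭-length σ)) len ,
    λ p p∈ (w , r , e) → h p (∈-resp-↭ σ p∈) (w , reach r , G⊆H e)
    where
    reach : ∀ {u w} → Reach G l u w → Reach H P u w
    reach (here u∉)     = here (λ u∈ → u∉ (∈-resp-↭ (↭-sym σ) u∈))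
    reach (step r e w∉) = step (reach r) (G⊆H e) (λ w∈ → w∉ (∈-resp-↭ (↭-sym σ) w∈))

  tuttePath-rev : ∀ {G a b} → TuttePath G a b → TuttePath G b a
  tuttePath-rev {G} (P , ((W , U) , max) , tutte) with rev (route (walk⇒trail W) ↭-refl)
    where open Neighbours G
  ... | Neighbours.route {l} t σ = l , ((trail⇒walk t , Unique-resp-↭ (↭-sym σ) U) , max′) , tutte-mono (λ e → e) σ tutte
    where
    open Neighbours G
    max′ : ¬ (Σ (List (Fin n)) λ P′ → IsPath G _ _ P′ × (∀ v → v ∈ l → v ∈ P′) × (Σ (Fin n) λ w → w ∈ P′ × w ∉ l))
    max′ (P′ , (W′ , U′) , l⊆ , w , w∈ , w∉) with rev (route (walk⇒trail W′) ↭-refl)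
    ... | route {m} t′ σ′ = max (m , (trail⇒walk t′ , Unique-resp-↭ (↭-sym σ′) U′) ,
      (λ v v∈ → ∈-resp-↭ (↭-sym σ′) (l⊆ v (∈-resp-↭ (↭-sym σ) v∈))) ,
      w , ∈-resp-↭ (↭-sym σ′) w∈ , λ w∈P → w∉ (∈-resp-↭ (↭-sym σ) w∈P))

  module Descend (G : Graph n) (x : Fin n) where
    open Completion G x

    descend : ∀ {a b P l} → IsMaximalPath G* a b P → IsTuttePath G* P → l ↭ P → Walk G a b l → TuttePath G a b
    descend {l = l} ((W , U) , max) tutte σ W′ = l , ((W′ , Unique-resp-↭ (↭-sym σ) U) , max′) , tutte-mono *-adj⁺ˡ σ tutte
      where
      max′ : ¬ _
      max′ (P′ , (W″ , U″) , l⊆ , w , w∈ , w∉) = max (P′ , (walk⁺ W″ , U″) ,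
        (λ v v∈ → l⊆ v (∈-resp-↭ (↭-sym σ) v∈)) , w , w∈ , λ w∈P → w∉ (∈-resp-↭ (↭-sym σ) w∈P))

    -- As `P` is not a walk of `G`, it uses a new edge. A vertex of N[x] missing from `P` could be
    -- inserted there, against maximality.
    N⊆path : ∀ {a b P} → IsMaximalPath G* a b P → ¬ Walk G a b P → ∀ {w} → w ≡ x ⊎ Adj G x w → w ∈ P
    N⊆path {a} {b} {P} ((W , U) , max) noWalk {w} Nw = decidable-stable (w ∈? P) absurd
      where
      open DecMembership _≟_ using (_∈?_)
      absurd : ¬ (w ∉ P)
      absurd w∉ with insert W w∉ Nw
      ... | inj₁ W′           = noWalk W′
      ... | inj₂ (l , W′ , σ) = max (l , (W′ , Unique-resp-↭ (↭-sym σ) (¬Any⇒All¬ P w∉ ∷ U)) ,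
        (λ v v∈ → ∈-resp-↭ (↭-sym σ) (there v∈)) , w , ∈-resp-↭ (↭-sym σ) (here refl) , w∉)

  nonSimplicial? : ∀ (G : Graph n) x → Dec (NonSimplicial G x)
  nonSimplicial? G x = any? λ u → any? λ v →
    ¬? (u ≟ v) ×-dec (adj G x u Bool.≟ true) ×-dec (adj G x v Bool.≟ true) ×-dec (adj G u v Bool.≟ false)

  module Stopped (G : Graph n) (free : ClawFree G)
    (stop : ∀ x → NonSimplicial G x → TutteConnected (localCompletion G x)) where
    open Neighbours G using (_~_; _~?_; ~-sym; ≃⇒~; Separation)
    open Cliques G
    open Structure free

    separation-at-end : ∀ {a b} → a ≢ b → ¬ TuttePath G a b → Separation a
    separation-at-end {a} {b} a≢b none with nonSimplicial? G a
    ... | no simp = simplicial-separation simp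
    ... | yes ns with stop a ns a b a≢b
    ...   | P , max@((W , U) , _) , tutte = NoSpanningPath.from-end G free a W U
      (Descend.N⊆path G a max (λ W′ → none (Descend.descend G a max tutte ↭-refl W′)))
      (λ σ W′ → none (Descend.descend G a max tutte σ W′)) refl a≢b

    few-inside : ∀ {a b} → a ≢ b → ¬ TuttePath G a b → ∀ {x} → x ≢ a → x ≢ b → Family.Few a b x
    few-inside {a} {b} a≢b none {x} x≢a x≢b with nonSimplicial? G x
    ... | no simp = Sides.few (oneSided (simplicial-separation simp)) a b
    ... | yes ns with stop x ns a b a≢b
    ...   | P , max@((W , U) , _) , tutte = TwoSides.few x≢a x≢b (NoSpanningPath.from-inside G free x W U
      (Descend.N⊆path G x max (λ W′ → none (Descend.descend G x max tutte ↭-refl W′)))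
      (λ σ W′ → none (Descend.descend G x max tutte σ W′)) (λ e → x≢a (sym e)) (λ e → x≢b (sym e)) a≢b)

    Represents : Fin n → Fin n → Set
    Represents a b = (∀ v → ∣ Family.edge a b v ∣ ≤ 3) ×
      (∀ u v → u ~ v → ∃ λ z → z ∈ˢ Family.edge a b u × z ∈ˢ Family.edge a b v)

    represents? : ∀ a b → Dec (Represents a b)
    represents? a b = all? (λ v → ∣ Family.edge a b v ∣ ℕ.≤? 3) ×-dec
      all? (λ u → all? (λ v → (u ~? v) →-dec any? (λ z → (z ∈ˢ? Family.edge a b u) ×-dec (z ∈ˢ? Family.edge a b v))))

    represents : ∀ {a b} → a ≢ b → ¬ TuttePath G a b → Represents a b
    represents {a} {b} a≢b none = (λ v → few⇒rank≤3 (few v)) ,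
      λ u v → adjacent⇒common (Sides.in-simplicial-edge at-a) (Sides.in-simplicial-edge at-b)
      where
      open Family a b
      at-a : OneSided a
      at-a = oneSided (separation-at-end a≢b none)
      at-b : OneSided b
      -- Reversing paths makes `b` the first vertex.
      at-b = oneSided (separation-at-end (λ e → a≢b (sym e)) (λ t → none (tuttePath-rev t)))
      few : ∀ v → Few v
      few v with v ≟ a | v ≟ b
      ... | yes refl | _        = Sides.few at-a a b
      ... | no _     | yes refl = Sides.few at-b a b
      ... | no v≢a   | no v≢b   = few-inside a≢b none v≢a v≢b

    represents⇒lineGraph : ∀ {a b} → Represents a b → IsLineGraphOfRank≤3Hypergraph G
    represents⇒lineGraph {a} {b} (rank , covers) = 2 ^ n , Family.edge a b , rank ,
      λ u v u≢v → mk⇔ (covers u v) (λ c → ≃⇒~ u≢v (Family.common⇒≃ a b c))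

    -- If no pair satisfied the decidable `Represents`, then by `represents` no two distinct
    -- vertices could lack a maximal Tutte path. This gives only doubly negated paths, which `¬¬-∀`
    -- collects over the finitely many pairs to contradict `¬conn`.
    lineGraph : ¬ TutteConnected G → IsLineGraphOfRank≤3Hypergraph G
    lineGraph ¬conn with any? (λ a → any? (λ b → represents? a b))
    ... | yes (a , b , r) = represents⇒lineGraph {a} {b} r
    ... | no none = ⊥-elim (¬¬-∀ (λ a → ¬¬-∀ (λ b k → k λ a≢b → ⊥-elim
        (none (a , b , represents a≢b λ t → k λ _ → t)))) ¬conn)

  lineGraph-resp : ∀ {G H : Graph n} → SameGraph H G → IsLineGraphOfRank≤3Hypergraph G → IsLineGraphOfRank≤3Hypergraph H
  lineGraph-resp same (m , e , rank , adj⇔) = m , e , rank , λ u v u≢v →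
    mk⇔ (λ h → Equivalence.to (adj⇔ u v u≢v) (trans (sym (same u v)) h))
        (λ c → trans (same u v) (Equivalence.from (adj⇔ u v u≢v) c))

  complete-lineGraph : IsLineGraphOfRank≤3Hypergraph Complete
  complete-lineGraph = 1 , (λ _ → inside ∷ []) , (λ _ → s≤s z≤n) ,
    λ u v u≢v → mk⇔ (λ _ → zero , here , here) (λ _ → neq-true u≢v)
    where
    neq-true : ∀ {u v : Fin n} → u ≢ v → neq u v ≡ true
    neq-true {u} {v} u≢v with u ≟ v
    ... | yes e = ⊥-elim (u≢v e)
    ... | no _  = refl

theorem6 : (n : ℕ) (G T : Graph n) → ClawFree G → IsTutteClosure G T
    → IsLineGraphOfRank≤3Hypergraph T
theorem6 n G T free (tc-conn _ same)         = lineGraph-resp {G = Complete} {T} same complete-lineGraph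
theorem6 n G T free (tc-step _ x _ _ cl)     = theorem6 n _ T (Completion.*-clawFree G x free) cl
theorem6 n G T free (tc-stop ¬conn stop same) = lineGraph-resp {G = G} {T} same (Stopped.lineGraph G free stop ¬conn)
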